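{- For a positive integer $n$, let $A$, $B$ and $C$ be independent random $n$-sided dice in the balanced sequences model. Then the probability that $A$ beats $C$, conditioned on the event that $A$ beats $B$ and $B$ beats $C$, is $\frac12+o(1)$ as $n\to\infty$.
   Context: An $n$-sided die in the balanced sequences model is a sequence $(a_1,\dots,a_n)\in\{1,2,\dots,n\}^n$ with $\sum_i a_i=n(n+1)/2$; a random $n$-sided die is such a sequence chosen uniformly at random. For dice $A=(a_1,\dots,a_n)$ and $B=(b_1,\dots,b_n)$, $A$ beats $B$ if the number of pairs $(i,j)$ with $a_i>b_j$ is greater than the number of pairs $(i,j)$ with $a_i<b_j$. -}

module Defs where

open import Data.Nat using (ℕ; zero; suc; _*_; _<_; _<?_)
open import Data.Nat.Properties using (_≟_)
open import Data.Nat.DivMod using (_/_)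
open import Data.Product using (_×_; _,_; proj₁; proj₂)
open import Data.List using (List; []; _∷_; map; concatMap; filter; length; upTo; cartesianProduct)
open import Data.Vec as Vec using (Vec; toList)
open import Data.Integer using (+_)
open import Data.Rational as ℚ using (ℚ; 0ℚ)
open import Relation.Nullary using (Dec)
open import Relation.Nullary.Decidable using (_×-dec_)
open import Relation.Binary.PropositionalEquality using (_≡_)

faces : ℕ → List ℕ
faces n = map suc (upTo n)

seqs : (m : ℕ) → List ℕ → List (Vec ℕ m)
seqs zero    vs = Vec.[] ∷ []
seqs (suc m) vs = concatMap (λ v → map (v Vec.∷_) (seqs m vs)) vs

-- an n-sided die (balanced sequences model): sequence in {1..n}^n with sum n(n+1)/2
Die : ℕ → Set
Die n = Vec ℕ n

IsBalanced : (n : ℕ) → Die n → Set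
IsBalanced n a = Vec.sum a ≡ (n * suc n) / 2

dice : (n : ℕ) → List (Die n)
dice n = filter (λ a → Vec.sum a ≟ (n * suc n) / 2) (seqs n (faces n))

#gt : ∀ {n} → Die n → Die n → ℕ
#gt a b = length (filter (λ p → proj₂ p <? proj₁ p) (cartesianProduct (toList a) (toList b)))

Beats : ∀ {n} → Die n → Die n → Set
Beats a b = #gt b a < #gt a b

beats? : ∀ {n} (a b : Die n) → Dec (Beats a b)
beats? a b = #gt b a <? #gt a b

-- all ordered triples (A , B , C) of n-sided dice (uniform independent choice)
triples : (n : ℕ) → List (Die n × Die n × Die n)
triples n = concatMap (λ a → concatMap (λ b → map (λ c → (a , b , c)) (dice n)) (dice n)) (dice n)

#cond : ℕ → ℕ
#cond n = length (filter (λ t → beats? (proj₁ t) (proj₁ (proj₂ t)) ×-dec beats? (proj₁ (proj₂ t)) (proj₂ (proj₂ t))) (triples n))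

#condAC : ℕ → ℕ
#condAC n = length (filter (λ t → (beats? (proj₁ t) (proj₁ (proj₂ t)) ×-dec beats? (proj₁ (proj₂ t)) (proj₂ (proj₂ t))) ×-dec beats? (proj₁ t) (proj₂ (proj₂ t))) (triples n))

-- ratio a / d in ℚ, with the convention 0 when d = 0
ratio : ℕ → ℕ → ℚ
ratio a zero    = 0ℚ
ratio a (suc d) = (+ a) ℚ./ suc d

condProb : ℕ → ℚ
condProb n = ratio (#condAC n) (#cond n)

{-# OPTIONS --safe #-}
module Submission where

-- Write out(A), in(A) for the numbers of dice that A beats and that beat A. The triples with A > B > C
-- number Σ out·in, and those with also A > C number Σ out²/2 up to ties, so the theorem follows once
-- ties are rare and |out(A) - in(A)| is small on average. For fixed A the margin of A against B is a sum
-- Σ h(bᵢ), where h has mean 0 and typical size √n, conditioned on Σ bᵢ being balanced; it must be shown to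
-- have an almost symmetric sign. The sign is smoothed by box kernels, which is harmless because by
-- Littlewood–Offord (applied to B for the margin, and to A for the oscillation of h) the margin is rarely
-- small, and the contribution of the last k ≪ n coordinates to the margin is dropped, which is harmless by
-- a second moment bound. Those k coordinates then smooth the constraint on the sum, because the sum of
-- independent faces has a unimodal law. The resulting function of the walk (margin, sum) has
-- three small differences in each direction, so reversing the steps of the walk two at a time changes
-- its mean little; but the total reversal changes its sign, so its mean is small.

-- The usual route is a joint local limit theorem for margin and sum. It is avoided: only the
-- antisymmetry of the margin is needed, never its limit law, and everything is counted in integers
-- with denominators cleared. `G` is a large constant chosen from ε; `y` grows with `n`, and σ = G³
-- y is about √n. The kernels have width of order V = G⁴ y², a fraction G⁻² of the typical margin
-- σ², and near ties have probability O(1/G). The dropped coordinates, of order y² many, move the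
-- margin by about σ y = V / G and spread the sum over about n y. Three differences are what these
-- scales demand. Swapping two steps costs about y⁻³, there are about n swaps, and the smoothed law
-- of the sum may exceed the density of balanced dice by a factor σ / y. The total is of order σ³ /
-- y⁴ = G⁹ / y, which vanishes for fixed `G`, whereas second differences would leave G⁹. Steps are
-- reversed in pairs for integrality: with faces numbered from 0 to p = n - 1, two faces have mean
-- sum p, while one has mean p / 2, possibly not an integer.

module ConditionalProbability where
  open import Algebra.Structures using (IsCommutativeSemiring)
  open import Data.Empty using (⊥; ⊥-elim)
  open import Data.Integer as ℤ using (ℤ; +_; -[1+_]) renaming (_+_ to _+ᶻ_; _*_ to _*ᶻ_; _-_ to _-ᶻ_; -_ to -ᶻ_; _≤_ to _≤ᶻ_; ∣_∣ to abs)
  open import Data.List using (List; []; _∷_; map; _++_; concatMap; downFrom; upTo; applyUpTo; filter; length; cartesianProduct)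
  open import Data.List.Membership.Propositional using (_∈_)
  open import Data.List.Membership.Propositional.Properties using (∈-filter⁻)
  open import Data.List.Properties using (length-map)
  open import Data.List.Relation.Unary.Any using (here; there)
  open import Data.Nat using (ℕ; zero; suc; _+_; _*_; _^_; _≤_; _<_; z≤n; s≤s; _∸_; _≤?_; ⌊_/2⌋; _<?_; ⌈_/2⌉; s≤s⁻¹; NonZero; >-nonZero)
  open import Data.Nat.DivMod using (_/_; m/n*n≤m; m*n/n≡m; /-monoˡ-≤; m≡m%n+[m/n]*n; m%n<n; _%_)
  open import Data.Nat.Properties
  open import Data.Product using (_×_; _,_; proj₁; proj₂; ∃-syntax)
  open import Data.Rational as ℚ using (ℚ; 0ℚ; ½)
  open import Data.Sum using (_⊎_; inj₁; inj₂)
  open import Data.Unit using (⊤; tt)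
  open import Data.Vec as Vec using (Vec; toList)
  open import Defs
  open import Relation.Binary.Definitions using (tri<; tri≈; tri>)
  open import Relation.Binary.PropositionalEquality hiding (J)
  open import Relation.Nullary using (Dec; yes; no; ¬_)
  open import Relation.Nullary.Decidable using (_×-dec_)
  import Data.Integer.Properties as ℤₚ
  import Data.Integer.Tactic.RingSolver as ZS
  import Data.Nat.Tactic.RingSolver as NS
  import Data.Rational.Properties as ℚₚ
  import Data.Rational.Unnormalised as ℚᵘ
  import Data.Rational.Unnormalised.Properties as ℚᵘₚ

  -- Finite sums and sums over walks

  -- Kept over an arbitrary commutative semiring because the same identities serve for counts in ℕ
  -- and for signed sums in ℤ.
  module Sum {C : Set} {_⊕_ _⊛_ : C → C → C} {0# 1# : C}
             (isCS : IsCommutativeSemiring _≡_ _⊕_ _⊛_ 0# 1#) where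
    private module S = IsCommutativeSemiring isCS

    ∑ : {A : Set} → List A → (A → C) → C
    ∑ []       f = 0#
    ∑ (x ∷ xs) f = f x ⊕ ∑ xs f

    ∑-cong∈ : {A : Set} (xs : List A) {f g : A → C} → (∀ x → x ∈ xs → f x ≡ g x) → ∑ xs f ≡ ∑ xs g
    ∑-cong∈ []       h = refl
    ∑-cong∈ (x ∷ xs) h = cong₂ _⊕_ (h x (here refl)) (∑-cong∈ xs (λ y m → h y (there m)))

    ∑-cong : {A : Set} (xs : List A) {f g : A → C} → (∀ x → f x ≡ g x) → ∑ xs f ≡ ∑ xs g
    ∑-cong xs h = ∑-cong∈ xs (λ x _ → h x)

    ∑-zero : {A : Set} (xs : List A) → ∑ xs (λ _ → 0#) ≡ 0#
    ∑-zero []       = refl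
    ∑-zero (x ∷ xs) = trans (S.+-identityˡ _) (∑-zero xs)

    private
      interchange : ∀ a b c d → (a ⊕ b) ⊕ (c ⊕ d) ≡ (a ⊕ c) ⊕ (b ⊕ d)
      interchange a b c d = trans (S.+-assoc a b _) (trans (cong (a ⊕_)
        (trans (sym (S.+-assoc b c d)) (trans (cong (_⊕ d) (S.+-comm b c)) (S.+-assoc c b d)))) (sym (S.+-assoc a c _)))

    ∑-+ : {A : Set} (xs : List A) (f g : A → C) → ∑ xs (λ x → f x ⊕ g x) ≡ ∑ xs f ⊕ ∑ xs g
    ∑-+ []       f g = sym (S.+-identityˡ _)
    ∑-+ (x ∷ xs) f g = trans (cong ((f x ⊕ g x) ⊕_) (∑-+ xs f g)) (interchange _ _ _ _)

    ∑-*ˡ : {A : Set} (xs : List A) (c : C) (f : A → C) → ∑ xs (λ x → c ⊛ f x) ≡ c ⊛ ∑ xs f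
    ∑-*ˡ []       c f = sym (S.zeroʳ c)
    ∑-*ˡ (x ∷ xs) c f = trans (cong ((c ⊛ f x) ⊕_) (∑-*ˡ xs c f)) (sym (S.distribˡ c _ _))

    ∑-*ʳ : {A : Set} (xs : List A) (c : C) (f : A → C) → ∑ xs (λ x → f x ⊛ c) ≡ ∑ xs f ⊛ c
    ∑-*ʳ xs c f = trans (∑-cong xs (λ x → S.*-comm (f x) c)) (trans (∑-*ˡ xs c f) (S.*-comm c _))

    ∑-swap : {A B : Set} (xs : List A) (ys : List B) (f : A → B → C) →
             ∑ xs (λ x → ∑ ys (f x)) ≡ ∑ ys (λ y → ∑ xs (λ x → f x y))
    ∑-swap []       ys f = sym (∑-zero ys)
    ∑-swap (x ∷ xs) ys f = trans (cong (∑ ys (f x) ⊕_) (∑-swap xs ys f)) (sym (∑-+ ys (f x) _))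

    ∑-++ : {A : Set} (xs ys : List A) (f : A → C) → ∑ (xs ++ ys) f ≡ ∑ xs f ⊕ ∑ ys f
    ∑-++ []       ys f = sym (S.+-identityˡ _)
    ∑-++ (x ∷ xs) ys f = trans (cong (f x ⊕_) (∑-++ xs ys f)) (sym (S.+-assoc _ _ _))

    ∑-map : {A B : Set} (g : A → B) (xs : List A) (f : B → C) → ∑ (map g xs) f ≡ ∑ xs (λ x → f (g x))
    ∑-map g []       f = refl
    ∑-map g (x ∷ xs) f = cong (f (g x) ⊕_) (∑-map g xs f)

    ∑-concatMap : {A B : Set} (g : A → List B) (xs : List A) (f : B → C) →
                  ∑ (concatMap g xs) f ≡ ∑ xs (λ x → ∑ (g x) f)
    ∑-concatMap g []       f = refl
    ∑-concatMap g (x ∷ xs) f = trans (∑-++ (g x) _ f) (cong (∑ (g x) f ⊕_) (∑-concatMap g xs f))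

    ∑-downFrom-suc : ∀ n (f : ℕ → C) → ∑ (downFrom (suc n)) f ≡ f 0 ⊕ ∑ (downFrom n) (λ x → f (suc x))
    ∑-downFrom-suc zero    f = refl
    ∑-downFrom-suc (suc n) f = trans (cong (f (suc n) ⊕_) (∑-downFrom-suc n f))
      (trans (sym (S.+-assoc _ _ _)) (trans (cong (_⊕ ∑ (downFrom n) (λ x → f (suc x))) (S.+-comm _ _)) (S.+-assoc _ _ _)))

    ∑-upTo : ∀ n (f : ℕ → C) → ∑ (upTo n) f ≡ ∑ (downFrom n) f
    ∑-upTo n f = go n (λ x → x) f
      where
      go : ∀ n (h : ℕ → ℕ) (f : ℕ → C) → ∑ (applyUpTo h n) f ≡ ∑ (downFrom n) (λ x → f (h x))
      go zero    h f = refl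
      go (suc n) h f = trans (cong (f (h 0) ⊕_) (go n (λ x → h (suc x)) f)) (sym (∑-downFrom-suc n (λ x → f (h x))))

    -- Additive form, as a semiring has no subtraction. Both the unimodality of sums of faces and
    -- the bound on differences of box averages rest on this exchange of the two end points.
    ∑-slide : ∀ n (g : ℤ → C) d → ∑ (downFrom n) (λ i → g (d +ᶻ + 1 +ᶻ + i)) ⊕ g d ≡ ∑ (downFrom n) (λ i → g (d +ᶻ + i)) ⊕ g (d +ᶻ + n)
    ∑-slide n g d = trans (S.+-comm _ _) (trans (cong₂ _⊕_ (cong g (sym (ℤₚ.+-identityʳ d))) (∑-cong (downFrom n) (λ i → cong g (ℤₚ.+-assoc d (+ 1) (+ i)))))
      (trans (sym (∑-downFrom-suc n (λ i → g (d +ᶻ + i)))) (S.+-comm _ _)))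

    ∑-reverse : ∀ p (g : ℤ → C) → ∑ (downFrom (suc p)) (λ i → g (+ p -ᶻ + i)) ≡ ∑ (downFrom (suc p)) (λ i → g (+ i))
    ∑-reverse zero    g = refl
    ∑-reverse (suc p) g = trans (cong₂ _⊕_ (cong g (ℤₚ.+-inverseʳ (+ suc p)))
        (trans (∑-cong (downFrom (suc p)) (λ i → cong g (ℤₚ.+-assoc (+ 1) (+ p) (-ᶻ + i)))) (∑-reverse p (λ z → g (+ 1 +ᶻ z)))))
      (sym (∑-downFrom-suc (suc p) (λ i → g (+ i))))

    -- E is st k F y sums F over the end points of all k-step walks from y, with steps st i, i ∈ is.
    E : {I Y : Set} → List I → (I → Y → Y) → ℕ → (Y → C) → Y → C
    E is st zero    F y = F y
    E is st (suc k) F y = ∑ is (λ i → E is st k F (st i y))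

    module _ {I Y : Set} (is : List I) (st : I → Y → Y) where
      E-cong : ∀ k {F G : Y → C} → (∀ y → F y ≡ G y) → ∀ y → E is st k F y ≡ E is st k G y
      E-cong zero    h y = h y
      E-cong (suc k) h y = ∑-cong is (λ i → E-cong k h (st i y))

      E-+ : ∀ k (F G : Y → C) y → E is st k (λ y → F y ⊕ G y) y ≡ E is st k F y ⊕ E is st k G y
      E-+ zero    F G y = refl
      E-+ (suc k) F G y = trans (∑-cong is (λ i → E-+ k F G (st i y))) (∑-+ is _ _)

      E-*ˡ : ∀ k c (F : Y → C) y → E is st k (λ y → c ⊛ F y) y ≡ c ⊛ E is st k F y
      E-*ˡ zero    c F y = refl
      E-*ˡ (suc k) c F y = trans (∑-cong is (λ i → E-*ˡ k c F (st i y))) (∑-*ˡ is c _)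

      E-∑ : {A : Set} (xs : List A) → ∀ k (F : A → Y → C) y →
            E is st k (λ y → ∑ xs (λ x → F x y)) y ≡ ∑ xs (λ x → E is st k (F x) y)
      E-∑ xs zero    F y = refl
      E-∑ xs (suc k) F y = trans (∑-cong is (λ i → E-∑ xs k F (st i y))) (∑-swap is xs _)

      E-add : ∀ k m (F : Y → C) y → E is st (k + m) F y ≡ E is st k (E is st m F) y
      E-add zero    m F y = refl
      E-add (suc k) m F y = ∑-cong is (λ i → E-add k m F (st i y))

      -- Transport along a map that intertwines the steps. Translations of the start, the forgetting
      -- of a coordinate and the commutation of smoothing with shifts are all instances.
      E-project : {Y′ : Set} (st′ : I → Y′ → Y′) (p : Y → Y′) → (∀ i y → p (st i y) ≡ st′ i (p y)) →
                  ∀ k (F : Y′ → C) y → E is st k (λ y → F (p y)) y ≡ E is st′ k F (p y)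
      E-project st′ p h zero    F y = refl
      E-project st′ p h (suc k) F y =
        ∑-cong is (λ i → trans (E-project st′ p h k F (st i y)) (cong (E is st′ k F) (h i y)))

    E-fubini : {I Y J Z : Set} (is : List I) (st : I → Y → Y) (js : List J) (st′ : J → Z → Z) →
               ∀ k m (F : Y → Z → C) y z →
               E is st k (λ y → E js st′ m (F y) z) y ≡ E js st′ m (λ z → E is st k (λ y → F y z) y) z
    E-fubini is st js st′ k zero    F y z = refl
    E-fubini is st js st′ k (suc m) F y z =
      trans (E-∑ is st js k _ y) (∑-cong js (λ j → E-fubini is st js st′ k m F y (st′ j z)))

  open Sum +-*-isCommutativeSemiring public
  module Z = Sum ℤₚ.+-*-isCommutativeSemiring

  ∑-mono∈ : {A : Set} (xs : List A) {f g : A → ℕ} → (∀ x → x ∈ xs → f x ≤ g x) → ∑ xs f ≤ ∑ xs g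
  ∑-mono∈ []       h = z≤n
  ∑-mono∈ (x ∷ xs) h = +-mono-≤ (h x (here refl)) (∑-mono∈ xs (λ y m → h y (there m)))

  ∑-mono : {A : Set} (xs : List A) {f g : A → ℕ} → (∀ x → f x ≤ g x) → ∑ xs f ≤ ∑ xs g
  ∑-mono xs h = ∑-mono∈ xs (λ x _ → h x)

  ∑-const : {A : Set} (xs : List A) (c : ℕ) → ∑ xs (λ _ → c) ≡ length xs * c
  ∑-const []       c = refl
  ∑-const (x ∷ xs) c = cong (_+_ c) (∑-const xs c)

  module _ {I Y : Set} (is : List I) (st : I → Y → Y) where
    E-mono : ∀ k {F G : Y → ℕ} → (∀ y → F y ≤ G y) → ∀ y → E is st k F y ≤ E is st k G y
    E-mono zero    h y = h y
    E-mono (suc k) h y = ∑-mono is (λ i → E-mono k h (st i y))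

    E-const : ∀ k c y → E is st k (λ _ → c) y ≡ length is ^ k * c
    E-const zero    c y = sym (+-identityʳ c)
    E-const (suc k) c y = trans (∑-cong is (λ i → E-const k c (st i y)))
      (trans (∑-const is _) (sym (*-assoc (length is) (length is ^ k) c)))

    E-bound : ∀ k {F : Y → ℕ} {c} → (∀ y → F y ≤ c) → ∀ y → E is st k F y ≤ length is ^ k * c
    E-bound k {c = c} h y = ≤-trans (E-mono k h y) (≤-reflexive (E-const k c y))

  abs-∑ : {A : Set} (xs : List A) (f : A → ℤ) → abs (Z.∑ xs f) ≤ ∑ xs (λ x → abs (f x))
  abs-∑ []       f = z≤n
  abs-∑ (x ∷ xs) f = ≤-trans (ℤₚ.∣i+j∣≤∣i∣+∣j∣ (f x) _) (+-monoʳ-≤ (abs (f x)) (abs-∑ xs f))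

  abs-E : {I Y : Set} (is : List I) (st : I → Y → Y) → ∀ k (F : Y → ℤ) y →
          abs (Z.E is st k F y) ≤ E is st k (λ y → abs (F y)) y
  abs-E is st zero    F y = ≤-refl
  abs-E is st (suc k) F y = ≤-trans (abs-∑ is _) (∑-mono is (λ i → abs-E is st k F (st i y)))

  +-∑ : {A : Set} (xs : List A) (f : A → ℕ) → + ∑ xs f ≡ Z.∑ xs (λ x → + f x)
  +-∑ []       f = refl
  +-∑ (x ∷ xs) f = trans (ℤₚ.pos-+ (f x) _) (cong (+ f x +ᶻ_) (+-∑ xs f))

  +-E : {I Y : Set} (is : List I) (st : I → Y → Y) → ∀ k (F : Y → ℕ) y →
        + E is st k F y ≡ Z.E is st k (λ y → + F y) y
  +-E is st zero    F y = refl
  +-E is st (suc k) F y = trans (+-∑ is _) (Z.∑-cong is (λ i → +-E is st k F (st i y)))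

  ∑ᶻ-mono∈ : {A : Set} (xs : List A) {f g : A → ℤ} → (∀ x → x ∈ xs → f x ≤ᶻ g x) → Z.∑ xs f ≤ᶻ Z.∑ xs g
  ∑ᶻ-mono∈ []       h = ℤₚ.≤-refl
  ∑ᶻ-mono∈ (x ∷ xs) h = ℤₚ.+-mono-≤ (h x (here refl)) (∑ᶻ-mono∈ xs (λ y m → h y (there m)))

  ∑ᶻ-neg : {A : Set} (xs : List A) (f : A → ℤ) → Z.∑ xs (λ x → -ᶻ f x) ≡ -ᶻ Z.∑ xs f
  ∑ᶻ-neg []       f = refl
  ∑ᶻ-neg (x ∷ xs) f = trans (cong (-ᶻ f x +ᶻ_) (∑ᶻ-neg xs f)) (sym (ℤₚ.neg-distrib-+ (f x) _))

  ∑ᶻ-const : {A : Set} (xs : List A) (c : ℤ) → Z.∑ xs (λ _ → c) ≡ + length xs *ᶻ c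
  ∑ᶻ-const []       c = refl
  ∑ᶻ-const (x ∷ xs) c = trans (cong (c +ᶻ_) (∑ᶻ-const xs c)) (trans (lem c (+ length xs)) (cong (_*ᶻ c) (sym (ℤₚ.pos-+ 1 (length xs)))))
    where
    lem : ∀ c l → c +ᶻ l *ᶻ c ≡ (+ 1 +ᶻ l) *ᶻ c
    lem = ZS.solve-∀

  ind : {P : Set} → Dec P → ℕ
  ind (yes _) = 1
  ind (no _)  = 0

  ind≤1 : {P : Set} (d : Dec P) → ind d ≤ 1
  ind≤1 (yes _) = ≤-refl
  ind≤1 (no _)  = z≤n

  ind-cong : {P Q : Set} (d : Dec P) (e : Dec Q) → (P → Q) → (Q → P) → ind d ≡ ind e
  ind-cong (yes p) (yes q) f g = refl
  ind-cong (yes p) (no ¬q) f g = ⊥-elim (¬q (f p))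
  ind-cong (no ¬p) (yes q) f g = ⊥-elim (¬p (g q))
  ind-cong (no ¬p) (no ¬q) f g = refl

  ind-mono : {P Q : Set} (d : Dec P) (e : Dec Q) → (P → Q) → ind d ≤ ind e
  ind-mono (yes p) (yes q) f = ≤-refl
  ind-mono (yes p) (no ¬q) f = ⊥-elim (¬q (f p))
  ind-mono (no ¬p) e       f = z≤n

  ind-yes : {P : Set} (d : Dec P) → P → ind d ≡ 1
  ind-yes (yes _) p = refl
  ind-yes (no ¬p) p = ⊥-elim (¬p p)

  ind-no : {P : Set} (d : Dec P) → ¬ P → ind d ≡ 0
  ind-no (yes p) ¬p = ⊥-elim (¬p p)
  ind-no (no _)  ¬p = refl

  ∑-filter : {A : Set} {P : A → Set} (P? : ∀ x → Dec (P x)) (xs : List A) (f : A → ℕ) →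
             ∑ (filter P? xs) f ≡ ∑ xs (λ x → ind (P? x) * f x)
  ∑-filter P? []       f = refl
  ∑-filter P? (x ∷ xs) f with P? x
  ... | yes _ = cong₂ _+_ (sym (+-identityʳ (f x))) (∑-filter P? xs f)
  ... | no  _ = ∑-filter P? xs f

  length-filter : {A : Set} {P : A → Set} (P? : ∀ x → Dec (P x)) (xs : List A) →
                  length (filter P? xs) ≡ ∑ xs (λ x → ind (P? x))
  length-filter P? []       = refl
  length-filter P? (x ∷ xs) with P? x
  ... | yes _ = cong suc (length-filter P? xs)
  ... | no  _ = length-filter P? xs

  -- Littlewood–Offord

  -- Index `i` stands for the face `suc i`; numbering from 0 makes the reversal of a face the map
  -- from `i` to `p - i`.
  rng : ℕ → List ℕ
  rng = downFrom

  length-rng : ∀ n → length (rng n) ≡ n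
  length-rng zero    = refl
  length-rng (suc n) = cong suc (length-rng n)

  ∑-rng-const : ∀ n c → ∑ (rng n) (λ _ → c) ≡ n * c
  ∑-rng-const n c = trans (∑-const (rng n) c) (cong (_* c) (length-rng n))

  ∑-rng-+ : ∀ a b (f : ℕ → ℕ) → ∑ (rng (a + b)) f ≡ ∑ (rng a) f + ∑ (rng b) (λ x → f (a + x))
  ∑-rng-+ a zero    f rewrite +-identityʳ a = sym (+-identityʳ _)
  ∑-rng-+ a (suc b) f rewrite +-suc a b | ∑-rng-+ a b f = lem (f (a + b)) (∑ (rng a) f) _
    where
    lem : ∀ x y z → x + (y + z) ≡ y + (x + z)
    lem = NS.solve-∀

  ∑-block : ∀ {o e n} (f : ℕ → ℕ) → o + e ≤ n → ∑ (rng e) (λ x → f (o + x)) ≤ ∑ (rng n) f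
  ∑-block {o} {e} {n} f h = begin
    ∑ (rng e) (λ x → f (o + x))                  ≤⟨ m≤n+m _ _ ⟩
    ∑ (rng o) f + ∑ (rng e) (λ x → f (o + x))    ≡⟨ ∑-rng-+ o e f ⟨
    ∑ (rng (o + e)) f                            ≤⟨ m≤m+n _ _ ⟩
    ∑ (rng (o + e)) f + _                        ≡⟨ ∑-rng-+ (o + e) (n ∸ (o + e)) f ⟨
    ∑ (rng (o + e + (n ∸ (o + e)))) f            ≡⟨ cong (λ m → ∑ (rng m) f) (m+[n∸m]≡n h) ⟩
    ∑ (rng n) f                                  ∎
    where open ≤-Reasoning

  -- Disjointness of the two blocks of first indices is what later keeps the two halves of a couple
  -- from being counted twice.
  ∑-two-blocks : ∀ {o₁ o₃ e n} (f : ℕ → ℕ) → o₁ + e ≤ o₃ → o₃ + e ≤ n →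
    ∑ (rng e) (λ x → f (o₁ + x)) + ∑ (rng e) (λ x → f (o₃ + x)) ≤ ∑ (rng n) f
  ∑-two-blocks {o₁} {o₃} {e} {n} f h₁ h₃ = begin
    ∑ (rng e) (λ x → f (o₁ + x)) + ∑ (rng e) (λ x → f (o₃ + x))
      ≤⟨ +-mono-≤ (∑-block {o₁} f h₁) (∑-block {0} {e} {n ∸ o₃} (λ x → f (o₃ + x)) (m+n≤o⇒n≤o∸m o₃ h₃)) ⟩
    ∑ (rng o₃) f + ∑ (rng (n ∸ o₃)) (λ x → f (o₃ + x))   ≡⟨ ∑-rng-+ o₃ (n ∸ o₃) f ⟨
    ∑ (rng (o₃ + (n ∸ o₃))) f   ≡⟨ cong (λ m → ∑ (rng m) f) (m+[n∸m]≡n (≤-trans (m≤m+n o₃ e) h₃)) ⟩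
    ∑ (rng n) f ∎
    where
    open ≤-Reasoning
    m+n≤o⇒n≤o∸m : ∀ m {n o} → m + n ≤ o → n ≤ o ∸ m
    m+n≤o⇒n≤o∸m m {n} {o} p = subst (_≤ o ∸ m) (m+n∸m≡n m n) (∸-monoˡ-≤ m p)

  -- The first coordinate accumulates a margin, the second the sum of the faces relative to its
  -- target, so conditioning on balance means ending at 0 in the second.
  step : (ℕ → ℤ) → (ℕ → ℤ) → ℕ → ℤ × ℤ → ℤ × ℤ
  step v s i (t , d) = t +ᶻ v i , d +ᶻ s i

  data Sep (w : ℕ) : List ℤ → Set where
    []  : Sep w []
    [_] : ∀ x → Sep w (x ∷ [])
    _∷_ : ∀ {x y J} → y +ᶻ + w ≤ᶻ x → Sep w (y ∷ J) → Sep w (x ∷ y ∷ J)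

  Sep-tail : ∀ {w x J} → Sep w (x ∷ J) → Sep w J
  Sep-tail [ x ]   = []
  Sep-tail (_ ∷ p) = p

  Sep-shift : ∀ {w J} c → Sep w J → Sep w (map (_+ᶻ c) J)
  Sep-shift c []      = []
  Sep-shift c [ x ]   = [ x +ᶻ c ]
  Sep-shift {w} c (_∷_ {x} {y} h p) = subst (_≤ᶻ x +ᶻ c) (lem y (+ w) c) (ℤₚ.+-monoˡ-≤ c h) ∷ Sep-shift c p
    where
    lem : ∀ y w c → (y +ᶻ w) +ᶻ c ≡ (y +ᶻ c) +ᶻ w
    lem = ZS.solve-∀

  -- The Littlewood-Offord induction needs whole families of separated translates: the exchange
  -- turns two families of size r into families of sizes r + 1 and r - 1, so a bound for a single
  -- window would not reproduce itself. The second coordinate is common to the family, since only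
  -- walks with equal sums may be compared.
  Bounded : ℕ → (ℕ → ℕ) → (ℤ × ℤ → ℕ) → Set
  Bounded w Φ c = ∀ d {J} → Sep w J → ∑ J (λ t → c (t , d)) ≤ Φ (length J)

  module _ {w Φ c} (bd : Bounded w Φ c) where

    shift-bound : ∀ d v {J} → Sep w J → ∑ J (λ t → c (t +ᶻ v , d)) ≤ Φ (length J)
    shift-bound d v {J} p = subst₂ _≤_ (∑-map (_+ᶻ v) J _) (cong Φ (length-map (_+ᶻ v) J)) (bd d (Sep-shift v p))

    -- Kleitman's exchange: the top point of the translate by v′ is moved to the translate by v.
    couple-ordered : ∀ d {v v′ x J} → v +ᶻ + w ≤ᶻ v′ → Sep w (x ∷ J) →
      ∑ (x ∷ J) (λ t → c (t +ᶻ v , d)) + ∑ (x ∷ J) (λ t → c (t +ᶻ v′ , d)) ≤ Φ (2 + length J) + Φ (length J)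
    couple-ordered d {v} {v′} {x} {J} h p = subst (_≤ Φ (2 + length J) + Φ (length J))
        (lem (c (x +ᶻ v′ , d)) (∑ (x ∷ J) (λ t → c (t +ᶻ v , d))) (∑ J (λ t → c (t +ᶻ v′ , d))))
        (+-mono-≤ (subst₂ _≤_ (cong (_+_ (c (x +ᶻ v′ , d))) (∑-map (_+ᶻ v) (x ∷ J) _))
                              (cong (λ l → Φ (2 + l)) (length-map (_+ᶻ v) J))
                              (bd d (top ∷ Sep-shift v p)))
                  (shift-bound d v′ (Sep-tail p)))
      where
      top : (x +ᶻ v) +ᶻ + w ≤ᶻ x +ᶻ v′
      top = subst (_≤ᶻ x +ᶻ v′) (sym (ℤₚ.+-assoc x v (+ w))) (ℤₚ.+-monoʳ-≤ x h)
      lem : ∀ a b e → (a + b) + e ≡ b + (a + e)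
      lem = NS.solve-∀

  abs-split : ∀ {w} p q → w ≤ abs (p -ᶻ q) → (q +ᶻ + w ≤ᶻ p) ⊎ (p +ᶻ + w ≤ᶻ q)
  abs-split {w} p q h with p -ᶻ q in eq
  ... | + m      = inj₁ (subst (q +ᶻ + w ≤ᶻ_) (trans (cong (q +ᶻ_) (sym eq)) (lem q p)) (ℤₚ.+-monoʳ-≤ q (ℤ.+≤+ h)))
    where
    lem : ∀ q p → q +ᶻ (p -ᶻ q) ≡ p
    lem = ZS.solve-∀
  ... | -[1+ m ] = inj₂ (subst (p +ᶻ + w ≤ᶻ_) (trans (cong (λ z → p -ᶻ z) (sym eq)) (lem q p)) (ℤₚ.+-monoʳ-≤ p (ℤ.+≤+ h)))
    where
    lem : ∀ q p → p -ᶻ (p -ᶻ q) ≡ q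
    lem = ZS.solve-∀

  -- Counts lazy walks on family sizes, killed at 0: each of the `g` good couples contributes one
  -- move up and one move down, and the remaining `β` pairs of steps leave the size alone. The
  -- weight `Q` is independent of the size because separated windows are disjoint.
  Φ : (g β Q : ℕ) → ℕ → ℕ → ℕ
  Φ g β Q zero    zero    = 0
  Φ g β Q zero    (suc r) = Q
  Φ g β Q (suc k) zero    = 0
  Φ g β Q (suc k) (suc r) = g * (Φ g β Q k (2 + r) + Φ g β Q k r) + β * Φ g β Q k (suc r)

  -- A couple is a pair of two-step walks (o₁+x, o₂+y) and (o₃+x, o₄+y) with the same displacement in
  -- the second coordinate; it is good when the first coordinates differ by at least w.
  module Couples (n e : ℕ) (v s : ℕ → ℤ) (o₁ o₂ o₃ o₄ w : ℕ)
                 (h₁ : o₁ + e ≤ o₃) (h₃ : o₃ + e ≤ n) (h₂ : o₂ + e ≤ n) (h₄ : o₄ + e ≤ n)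
                 (same : ∀ x y → s (o₁ + x) +ᶻ s (o₂ + y) ≡ s (o₃ + x) +ᶻ s (o₄ + y)) where

    gap : ℕ → ℕ → ℕ
    gap x y = abs ((v (o₁ + x) +ᶻ v (o₂ + y)) -ᶻ (v (o₃ + x) +ᶻ v (o₄ + y)))

    good : ℕ
    good = ∑ (rng e) (λ x → ∑ (rng e) (λ y → ind (w ≤? gap x y)))

    private
      st = step v s
      is = rng n

    module _ {β : ℕ} (total : n * n ≡ 2 * good + β) where

      -- Argued through the deficits `b`, the amounts by which the translates fall short of the
      -- trivial bound `P`. Deficits are nonnegative, so all pairs of steps outside good couples can
      -- be discarded, and each good couple has joint deficit at least `2 * P - (P₊ + P₋)` by
      -- Kleitman's exchange.
      Bounded-step : ∀ {Φ c} → Bounded w Φ c → ∀ d {x J} → Sep w (x ∷ J) →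
        ∑ (x ∷ J) (λ t → E is st 2 c (t , d)) ≤ good * (Φ (2 + length J) + Φ (length J)) + β * Φ (suc (length J))
      Bounded-step {Φ} {c} bd d {x₀} {J₀} p = +-cancelʳ-≤ (2 * good * P) _ _ (begin
          ∑ J (λ t → E is st 2 c (t , d)) + 2 * good * P   ≡⟨ cong (_+ 2 * good * P) flip ⟩
          ∑∑ a + 2 * good * P                               ≤⟨ +-monoʳ-≤ (∑∑ a) deficit ⟩
          ∑∑ a + (∑∑ b + good * (P₊ + P₋))                  ≡⟨ +-assoc (∑∑ a) (∑∑ b) _ ⟨
          ∑∑ a + ∑∑ b + good * (P₊ + P₋)                    ≡⟨ cong (_+ good * (P₊ + P₋)) all ⟩
          n * n * P + good * (P₊ + P₋)                      ≡⟨ cong (λ m → m * P + good * (P₊ + P₋)) total ⟩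
          (2 * good + β) * P + good * (P₊ + P₋)             ≡⟨ arith good β P (P₊ + P₋) ⟩
          good * (P₊ + P₋) + β * P + 2 * good * P           ∎)
        where
        open ≤-Reasoning
        J = x₀ ∷ J₀
        P = Φ (length J)
        P₊ = Φ (2 + length J₀)
        P₋ = Φ (length J₀)
        ∑∑ : (ℕ → ℕ → ℕ) → ℕ
        ∑∑ f = ∑ is (λ i → ∑ is (f i))
        ∑e : (ℕ → ℕ → ℕ) → ℕ
        ∑e f = ∑ (rng e) (λ x → ∑ (rng e) (f x))
        V : ℕ → ℕ → ℤ
        V i j = v i +ᶻ v j
        D : ℕ → ℕ → ℤ
        D i j = d +ᶻ (s i +ᶻ s j)
        a b : ℕ → ℕ → ℕ
        a i j = ∑ J (λ t → c (t +ᶻ V i j , D i j))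
        b i j = P ∸ a i j
        a≤ : ∀ i j → a i j ≤ P
        a≤ i j = shift-bound {w} {Φ} {c} bd (D i j) (V i j) p
        arith : ∀ g β P Q → (2 * g + β) * P + g * Q ≡ g * Q + β * P + 2 * g * P
        arith = NS.solve-∀
        flip : ∑ J (λ t → E is st 2 c (t , d)) ≡ ∑∑ a
        flip = trans (∑-swap J is _) (∑-cong is (λ i → trans (∑-swap J is _) (∑-cong is (λ j → ∑-cong J (λ t →
                 cong c (cong₂ _,_ (ℤₚ.+-assoc t (v i) (v j)) (ℤₚ.+-assoc d (s i) (s j))))))))
        all : ∑∑ a + ∑∑ b ≡ n * n * P
        all = begin-equality
          ∑∑ a + ∑∑ b                    ≡⟨ ∑-+ is _ _ ⟨
          ∑ is (λ i → ∑ is (a i) + ∑ is (b i)) ≡⟨ ∑-cong is (λ i → trans (sym (∑-+ is _ _)) (trans (∑-cong is (λ j → m+[n∸m]≡n (a≤ i j))) (∑-rng-const n P))) ⟩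
          ∑ is (λ i → n * P)             ≡⟨ ∑-rng-const n (n * P) ⟩
          n * (n * P)                    ≡⟨ *-assoc n n P ⟨
          n * n * P                      ∎
        couple : ∀ x y → ind (w ≤? gap x y) * (2 * P) ≤ b (o₁ + x) (o₂ + y) + b (o₃ + x) (o₄ + y) + ind (w ≤? gap x y) * (P₊ + P₋)
        couple x y with w ≤? gap x y
        ... | no  _ = z≤n
        ... | yes q = begin
            1 * (2 * P) ≡⟨ ar1 P ⟩
            P + P ≡⟨ cong₂ _+_ (m∸n+n≡m (a≤ (o₁ + x) (o₂ + y))) (m∸n+n≡m (a≤ (o₃ + x) (o₄ + y))) ⟨
            b₁ + a₁ + (b₃ + a₃) ≡⟨ ar2 b₁ a₁ b₃ a₃ ⟩
            b₁ + b₃ + (a₁ + a₃) ≤⟨ +-monoʳ-≤ (b₁ + b₃) (main (abs-split _ _ q)) ⟩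
            b₁ + b₃ + (P₊ + P₋) ≡⟨ cong (_+_ (b₁ + b₃)) (sym (*-identityˡ _)) ⟩
            b₁ + b₃ + 1 * (P₊ + P₋) ∎
          where
          a₁ = a (o₁ + x) (o₂ + y)
          a₃ = a (o₃ + x) (o₄ + y)
          b₁ = b (o₁ + x) (o₂ + y)
          b₃ = b (o₃ + x) (o₄ + y)
          V₁ = V (o₁ + x) (o₂ + y)
          V₃ = V (o₃ + x) (o₄ + y)
          ar1 : ∀ P → 1 * (2 * P) ≡ P + P
          ar1 = NS.solve-∀
          ar2 : ∀ a b c d → a + b + (c + d) ≡ a + c + (b + d)
          ar2 = NS.solve-∀
          D₁₃ : ∀ t → (t +ᶻ V₃ , D (o₁ + x) (o₂ + y)) ≡ (t +ᶻ V₃ , D (o₃ + x) (o₄ + y))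
          D₁₃ t = cong (λ z → (t +ᶻ V₃ , d +ᶻ z)) (same x y)
          a₃′ : ∑ J (λ t → c (t +ᶻ V₃ , D (o₁ + x) (o₂ + y))) ≡ a₃
          a₃′ = ∑-cong J (λ t → cong c (D₁₃ t))
          main : (V₃ +ᶻ + w ≤ᶻ V₁) ⊎ (V₁ +ᶻ + w ≤ᶻ V₃) → a₁ + a₃ ≤ P₊ + P₋
          main (inj₁ le) = subst (_≤ P₊ + P₋) (trans (cong (_+ a₁) a₃′) (+-comm a₃ a₁)) (couple-ordered {w} {Φ} {c} bd (D (o₁ + x) (o₂ + y)) le p)
          main (inj₂ le) = subst (_≤ P₊ + P₋) (cong (_+_ a₁) a₃′) (couple-ordered {w} {Φ} {c} bd (D (o₁ + x) (o₂ + y)) le p)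
        -- The two members of a couple have first indices in disjoint blocks, so the blocks of
        -- second indices may overlap.
        blocks : ∑e (λ x y → b (o₁ + x) (o₂ + y) + b (o₃ + x) (o₄ + y)) ≤ ∑∑ b
        blocks = begin
          ∑e (λ x y → b (o₁ + x) (o₂ + y) + b (o₃ + x) (o₄ + y))
            ≡⟨ trans (∑-cong (rng e) (λ x → ∑-+ (rng e) _ _)) (∑-+ (rng e) _ _) ⟩
          ∑e (λ x y → b (o₁ + x) (o₂ + y)) + ∑e (λ x y → b (o₃ + x) (o₄ + y))
            ≤⟨ +-mono-≤ (∑-mono (rng e) (λ x → ∑-block {o₂} (b (o₁ + x)) h₂)) (∑-mono (rng e) (λ x → ∑-block {o₄} (b (o₃ + x)) h₄)) ⟩
          ∑ (rng e) (λ x → ∑ is (b (o₁ + x))) + ∑ (rng e) (λ x → ∑ is (b (o₃ + x)))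
            ≤⟨ ∑-two-blocks {o₁} {o₃} (λ i → ∑ is (b i)) h₁ h₃ ⟩
          ∑∑ b ∎
        pull : ∀ c → ∑e (λ x y → ind (w ≤? gap x y) * c) ≡ good * c
        pull c = trans (∑-cong (rng e) (λ x → ∑-*ʳ (rng e) c _)) (∑-*ʳ (rng e) c _)
        deficit : 2 * good * P ≤ ∑∑ b + good * (P₊ + P₋)
        deficit = begin
          2 * good * P   ≡⟨ ar good P ⟩
          good * (2 * P) ≡⟨ pull (2 * P) ⟨
          ∑e (λ x y → ind (w ≤? gap x y) * (2 * P)) ≤⟨ ∑-mono (rng e) (λ x → ∑-mono (rng e) (λ y → couple x y)) ⟩
          ∑e (λ x y → b (o₁ + x) (o₂ + y) + b (o₃ + x) (o₄ + y) + ind (w ≤? gap x y) * (P₊ + P₋))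
            ≡⟨ trans (∑-cong (rng e) (λ x → ∑-+ (rng e) _ _)) (∑-+ (rng e) _ _) ⟩
          ∑e (λ x y → b (o₁ + x) (o₂ + y) + b (o₃ + x) (o₄ + y)) + ∑e (λ x y → ind (w ≤? gap x y) * (P₊ + P₋))
            ≤⟨ +-mono-≤ blocks (≤-reflexive (pull (P₊ + P₋))) ⟩
          ∑∑ b + good * (P₊ + P₋) ∎
          where
          ar : ∀ g P → 2 * g * P ≡ g * (2 * P)
          ar = NS.solve-∀

      Bounded-walk : ∀ {Q c} → Bounded w (Φ good β Q 0) c → ∀ k → Bounded w (Φ good β Q k) (E is st (k * 2) c)
      Bounded-walk bd zero    d p = bd d p
      Bounded-walk bd (suc k) d {[]}    p = z≤n
      Bounded-walk {Q} bd (suc k) d {x ∷ J} p = Bounded-step {Φ good β Q k} (Bounded-walk bd k) d p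

  module _ (g β Q : ℕ) where
    private
      V = 2 * g + β
      F = Φ g β Q

    Φ-trivial : ∀ k r → F k r ≤ Q * V ^ k
    Φ-trivial zero    zero    = z≤n
    Φ-trivial zero    (suc r) = ≤-reflexive (sym (*-identityʳ Q))
    Φ-trivial (suc k) zero    = z≤n
    Φ-trivial (suc k) (suc r) = begin
      g * (F k (2 + r) + F k r) + β * F k (suc r)
        ≤⟨ +-mono-≤ (*-monoʳ-≤ g (+-mono-≤ (Φ-trivial k (2 + r)) (Φ-trivial k r))) (*-monoʳ-≤ β (Φ-trivial k (suc r))) ⟩
      g * (Q * V ^ k + Q * V ^ k) + β * (Q * V ^ k) ≡⟨ ar g β Q (V ^ k) ⟩
      Q * ((2 * g + β) * V ^ k) ∎
      where
      open ≤-Reasoning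
      ar : ∀ g β Q X → g * (Q * X + Q * X) + β * (Q * X) ≡ Q * ((2 * g + β) * X)
      ar = NS.solve-∀

    -- Φ k r / (Q V^k) is the probability that a lazy walk from r stays positive for k steps; the
    -- supermartingale r (R - r) bounds it.
    Φ-martingale : ∀ R k r r′ → r + r′ ≡ R → k * (2 * g) * R * F k r ≤ Q * V ^ k * (2 * g * k * r + V * R * (r * r′))
    Φ-martingale R zero    r r′ eq = z≤n
    Φ-martingale R (suc k) zero r′ eq rewrite *-zeroʳ (suc k * (2 * g) * R) = z≤n
    Φ-martingale R (suc k) (suc r) zero eq = begin
      suc k * (2 * g) * R * F (suc k) (suc r)     ≤⟨ *-monoʳ-≤ (suc k * (2 * g) * R) (Φ-trivial (suc k) (suc r)) ⟩
      suc k * (2 * g) * R * (Q * V ^ suc k)       ≡⟨ cong (λ R → suc k * (2 * g) * R * (Q * V ^ suc k)) (trans (sym eq) (+-identityʳ _)) ⟩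
      suc k * (2 * g) * suc r * (Q * V ^ suc k)   ≡⟨ ar (suc k) g (suc r) Q (V ^ suc k) ⟩
      Q * V ^ suc k * (2 * g * suc k * suc r)     ≤⟨ *-monoʳ-≤ (Q * V ^ suc k) (m≤m+n _ _) ⟩
      Q * V ^ suc k * (2 * g * suc k * suc r + V * R * (suc r * 0)) ∎
      where
      open ≤-Reasoning
      ar : ∀ k g r Q X → k * (2 * g) * r * (Q * X) ≡ Q * X * (2 * g * k * r)
      ar = NS.solve-∀
    Φ-martingale R (suc k) (suc r) (suc r′) eq = begin
      suc k * (2 * g) * R * F (suc k) (suc r) ≡⟨ ar1 k g R (F k (2 + r)) (F k r) β (F k (suc r)) ⟩
      g * (k * (2 * g) * R * F k (2 + r) + k * (2 * g) * R * F k r) + β * (k * (2 * g) * R * F k (suc r)) + 2 * g * R * F (suc k) (suc r)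
        ≤⟨ +-mono-≤ (+-mono-≤ (*-monoʳ-≤ g (+-mono-≤ (Φ-martingale R k (2 + r) r′ (trans (e1 r r′) eq))
                                                     (Φ-martingale R k r (2 + r′) (trans (e2 r r′) eq))))
                              (*-monoʳ-≤ β (Φ-martingale R k (suc r) (suc r′) eq)))
                    (*-monoʳ-≤ (2 * g * R) (Φ-trivial (suc k) (suc r))) ⟩
      g * (Q * V ^ k * X (2 + r) r′ + Q * V ^ k * X r (2 + r′)) + β * (Q * V ^ k * X (suc r) (suc r′)) + 2 * g * R * (Q * (V * V ^ k))
        -- The drift of `r * r′` under the walk pays exactly for the new term
        -- `2 * g * R * F (suc k) (suc r)`; the slack added here is the growth of the linear term
        -- from `k` to `suc k`.
        ≤⟨ m≤m+n _ (Q * V ^ k * (V * (2 * g) * suc r)) ⟩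
      g * (Q * V ^ k * X (2 + r) r′ + Q * V ^ k * X r (2 + r′)) + β * (Q * V ^ k * X (suc r) (suc r′)) + 2 * g * R * (Q * (V * V ^ k)) + Q * V ^ k * (V * (2 * g) * suc r)
        ≡⟨ ar2 (V ^ k) Q g β R k r r′ ⟩
      Q * (V * V ^ k) * (2 * g * suc k * suc r + V * R * (suc r * suc r′)) ∎
      where
      open ≤-Reasoning
      X : ℕ → ℕ → ℕ
      X r r′ = 2 * g * k * r + V * R * (r * r′)
      e1 : ∀ r r′ → 2 + r + r′ ≡ suc r + suc r′
      e1 = NS.solve-∀
      e2 : ∀ r r′ → r + (2 + r′) ≡ suc r + suc r′
      e2 = NS.solve-∀
      ar1 : ∀ k g R A B β C → suc k * (2 * g) * R * (g * (A + B) + β * C) ≡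
            g * (k * (2 * g) * R * A + k * (2 * g) * R * B) + β * (k * (2 * g) * R * C) + 2 * g * R * (g * (A + B) + β * C)
      ar1 = NS.solve-∀
      ar2 : ∀ Y Q g β R k r r′ → let V = 2 * g + β in
            g * (Q * Y * (2 * g * k * (2 + r) + V * R * ((2 + r) * r′)) + Q * Y * (2 * g * k * r + V * R * (r * (2 + r′))))
            + β * (Q * Y * (2 * g * k * suc r + V * R * (suc r * suc r′))) + 2 * g * R * (Q * (V * Y)) + Q * Y * (V * (2 * g) * suc r)
            ≡ Q * (V * Y) * (2 * g * suc k * suc r + V * R * (suc r * suc r′))
      ar2 = NS.solve-∀

    -- Above `R` the trivial bound is enough. `R` is a free parameter: with `g` comparable to `V`
    -- and `R` of order √k both terms balance, and the survival probability is O(r / √k).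
    Φ-bound : ∀ R k r → k * (2 * g) * R * F k r ≤ Q * V ^ k * (2 * g * k * r + V * R * R * r)
    Φ-bound R k r with ≤-total r R
    ... | inj₁ r≤R = begin
      k * (2 * g) * R * F k r ≤⟨ Φ-martingale R k r (R ∸ r) (m+[n∸m]≡n r≤R) ⟩
      Q * V ^ k * (2 * g * k * r + V * R * (r * (R ∸ r))) ≤⟨ *-monoʳ-≤ (Q * V ^ k) (+-monoʳ-≤ (2 * g * k * r) (*-monoʳ-≤ (V * R) (*-monoʳ-≤ r (m∸n≤m R r)))) ⟩
      Q * V ^ k * (2 * g * k * r + V * R * (r * R)) ≡⟨ cong (λ z → Q * V ^ k * (2 * g * k * r + z)) (ar V R r) ⟩
      Q * V ^ k * (2 * g * k * r + V * R * R * r) ∎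
      where
      open ≤-Reasoning
      ar : ∀ V R r → V * R * (r * R) ≡ V * R * R * r
      ar = NS.solve-∀
    ... | inj₂ R≤r = begin
      k * (2 * g) * R * F k r ≤⟨ *-mono-≤ (*-monoʳ-≤ (k * (2 * g)) R≤r) (Φ-trivial k r) ⟩
      k * (2 * g) * r * (Q * V ^ k) ≡⟨ ar k g r (Q * V ^ k) ⟩
      Q * V ^ k * (2 * g * k * r) ≤⟨ *-monoʳ-≤ (Q * V ^ k) (m≤m+n _ _) ⟩
      Q * V ^ k * (2 * g * k * r + V * R * R * r) ∎
      where
      open ≤-Reasoning
      ar : ∀ k g r Y → k * (2 * g) * r * Y ≡ Y * (2 * g * k * r)
      ar = NS.solve-∀

  -- Unimodality and smoothness of the sum of independent faces

  ∈-rng : ∀ {n i} → i ∈ rng n → i < n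
  ∈-rng {suc n} (here refl) = ≤-refl
  ∈-rng {suc n} (there m)   = m≤n⇒m≤1+n (∈-rng m)

  ≤ᶻ-from : ∀ {a b x y} k → a ≤ᶻ b → y -ᶻ x ≡ (b -ᶻ a) +ᶻ + k → x ≤ᶻ y
  ≤ᶻ-from {a} {b} k h eq = ℤₚ.0≤i-j⇒j≤i (subst (+ 0 ≤ᶻ_) (sym eq) (ℤₚ.+-mono-≤ (ℤₚ.i≤j⇒0≤j-i h) (ℤ.+≤+ (z≤n {k}))))

  δ : ℤ → ℕ
  δ d = ind (d ℤₚ.≟ + 0)

  st₁ : ℕ → ℤ → ℤ
  st₁ i d = d +ᶻ + i

  -- number of sequences of m numbers below n with sum - d (not d): walks start at d and end at 0
  r : (n m : ℕ) → ℤ → ℕ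
  r n m d = E (rng n) st₁ m δ d

  module Unimodal (p : ℕ) where
    private
      n = suc p
      R : ℕ → ℤ → ℕ
      R = r n

    -- Twice the centre of symmetry of `R m`, doubled to remain an integer.
    c : ℕ → ℤ
    c m = -ᶻ + (m * p)

    c-suc : ∀ m → c (suc m) ≡ c m -ᶻ + p
    c-suc m = trans (cong -ᶻ_ (ℤₚ.pos-+ p (m * p))) (lem (+ p) (+ (m * p)))
      where
      lem : ∀ p q → -ᶻ (p +ᶻ q) ≡ -ᶻ q -ᶻ p
      lem = ZS.solve-∀

    δ-sym : ∀ d → δ (-ᶻ d) ≡ δ d
    δ-sym (+ zero)  = refl
    δ-sym (+ suc n) = refl
    δ-sym -[1+ n ]  = refl

    r-sym : ∀ m d → R m (c m -ᶻ d) ≡ R m d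
    r-sym zero    d = trans (cong δ (ℤₚ.+-identityˡ (-ᶻ d))) (δ-sym d)
    r-sym (suc m) d = trans (∑-cong (rng n) (λ i → trans (cong (R m) (lem i)) (r-sym m (d +ᶻ (+ p -ᶻ + i)))))
                            (∑-reverse p (λ z → R m (d +ᶻ z)))
      where
      lem′ : ∀ c p d i → ((c -ᶻ p) -ᶻ d) +ᶻ i ≡ c -ᶻ (d +ᶻ (p -ᶻ i))
      lem′ = ZS.solve-∀
      lem : ∀ i → (c (suc m) -ᶻ d) +ᶻ + i ≡ c m -ᶻ (d +ᶻ (+ p -ᶻ + i))
      lem i = trans (cong (λ z → (z -ᶻ d) +ᶻ + i) (c-suc m)) (lem′ (c m) (+ p) d (+ i))

    Increasing : ℕ → Set
    Increasing m = ∀ d → d +ᶻ d +ᶻ + 1 ≤ᶻ c m → R m d ≤ R m (d +ᶻ + 1)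

    -- The last unit step needs its midpoint, not its end point, to lie left of the centre; hence
    -- the `+ 1` on the right, which lets the end point pass the centre by one half.
    chain : ∀ m → Increasing m → ∀ k d → (d +ᶻ + k) +ᶻ (d +ᶻ + k) ≤ᶻ c m +ᶻ + 1 → R m d ≤ R m (d +ᶻ + k)
    chain m inc zero    d h = ≤-reflexive (cong (R m) (sym (ℤₚ.+-identityʳ d)))
    chain m inc (suc k) d h = ≤-trans (chain m inc k d (≤ᶻ-from 2 h (lem₁ (c m) d (+ k))))
        (subst (λ z → R m (d +ᶻ + k) ≤ R m z) (lem₂ d (+ k)) (inc (d +ᶻ + k) (≤ᶻ-from 0 h (lem₃ (c m) d (+ k)))))
      where
      lem₁ : ∀ c d k → (c +ᶻ + 1) -ᶻ ((d +ᶻ k) +ᶻ (d +ᶻ k)) ≡ ((c +ᶻ + 1) -ᶻ ((d +ᶻ (+ 1 +ᶻ k)) +ᶻ (d +ᶻ (+ 1 +ᶻ k)))) +ᶻ + 2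
      lem₁ = ZS.solve-∀
      lem₂ : ∀ d k → (d +ᶻ k) +ᶻ + 1 ≡ d +ᶻ (+ 1 +ᶻ k)
      lem₂ = ZS.solve-∀
      lem₃ : ∀ c d k → c -ᶻ ((d +ᶻ k) +ᶻ (d +ᶻ k) +ᶻ + 1) ≡ ((c +ᶻ + 1) -ᶻ ((d +ᶻ (+ 1 +ᶻ k)) +ᶻ (d +ᶻ (+ 1 +ᶻ k)))) +ᶻ + 0
      lem₃ = ZS.solve-∀

    chain′ : ∀ m → Increasing m → ∀ {d d′} → d ≤ᶻ d′ → d′ +ᶻ d′ ≤ᶻ c m +ᶻ + 1 → R m d ≤ R m d′
    chain′ m inc {d} {d′} h h′ with d′ -ᶻ d in eq | ℤₚ.i≤j⇒0≤j-i h
    ... | + k | _ = subst (λ z → R m d ≤ R m z) d+k≡d′ (chain m inc k d (subst (λ z → z +ᶻ z ≤ᶻ c m +ᶻ + 1) (sym d+k≡d′) h′))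
      where
      lem : ∀ d d′ → d +ᶻ (d′ -ᶻ d) ≡ d′
      lem = ZS.solve-∀
      d+k≡d′ : d +ᶻ + k ≡ d′
      d+k≡d′ = trans (cong (d +ᶻ_) (sym eq)) (lem d d′)

    -- By `∑-slide`, the next law grows from `d` to `d + 1` exactly when `R m d ≤ R m (d + n)`. The
    -- hypothesis says that the midpoint of `d` and `d + n` is left of the centre of `R m`, so
    -- `d + n` is the nearer of the two; if it lies beyond the centre it is reflected first.
    increasing : ∀ m → Increasing m
    increasing zero d h = subst (_≤ R 0 (d +ᶻ + 1)) (sym (ind-no (d ℤₚ.≟ + 0) (λ eq → absurd (subst (λ z → z +ᶻ z +ᶻ + 1 ≤ᶻ + 0) eq h)))) z≤n
      where
      absurd : + 1 ≤ᶻ + 0 → ⊥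
      absurd (ℤ.+≤+ ())
    increasing (suc m) d h = +-cancelʳ-≤ (R m d) _ _ (begin
        R (suc m) d + R m d                 ≤⟨ +-monoʳ-≤ (R (suc m) d) far ⟩
        R (suc m) d + R m (d +ᶻ + n)        ≡⟨ ∑-slide n (R m) d ⟨
        R (suc m) (d +ᶻ + 1) + R m d        ∎)
      where
      open ≤-Reasoning
      h′ : d +ᶻ d +ᶻ + 1 ≤ᶻ c m -ᶻ + p
      h′ = subst (d +ᶻ d +ᶻ + 1 ≤ᶻ_) (c-suc m) h
      n≡ : + n ≡ + 1 +ᶻ + p
      n≡ = ℤₚ.pos-+ 1 p
      far : R m d ≤ R m (d +ᶻ + n)
      far with ℤₚ.≤-total ((d +ᶻ + n) +ᶻ (d +ᶻ + n)) (c m)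
      ... | inj₁ le = chain m (increasing m) n d (≤ᶻ-from 1 le (lem (c m) ((d +ᶻ + n) +ᶻ (d +ᶻ + n))))
        where
        lem : ∀ a b → (a +ᶻ + 1) -ᶻ b ≡ (a -ᶻ b) +ᶻ + 1
        lem = ZS.solve-∀
      ... | inj₂ ge = subst (R m d ≤_) (r-sym m (d +ᶻ + n))
                        (chain′ m (increasing m) (≤ᶻ-from 0 h′ (trans (cong (λ z → (c m -ᶻ (d +ᶻ z)) -ᶻ d) n≡) (lem₁ (c m) d (+ p))))
                                               (≤ᶻ-from 1 ge (lem₂ (c m) (d +ᶻ + n))))
        where
        lem₁ : ∀ c d p → (c -ᶻ (d +ᶻ (+ 1 +ᶻ p))) -ᶻ d ≡ ((c -ᶻ p) -ᶻ (d +ᶻ d +ᶻ + 1)) +ᶻ + 0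
        lem₁ = ZS.solve-∀
        lem₂ : ∀ c x → (c +ᶻ + 1) -ᶻ ((c -ᶻ x) +ᶻ (c -ᶻ x)) ≡ ((x +ᶻ x) -ᶻ c) +ᶻ + 1
        lem₂ = ZS.solve-∀

    decreasing : ∀ m d → c m ≤ᶻ d +ᶻ d +ᶻ + 1 → R m (d +ᶻ + 1) ≤ R m d
    decreasing m d h = subst₂ _≤_ (r-sym m (d +ᶻ + 1)) (trans (cong (R m) (lem₁ (c m) d)) (r-sym m d))
                         (increasing m (c m -ᶻ (d +ᶻ + 1)) (≤ᶻ-from 0 h (lem₂ (c m) d)))
      where
      lem₁ : ∀ c d → (c -ᶻ (d +ᶻ + 1)) +ᶻ + 1 ≡ c -ᶻ d
      lem₁ = ZS.solve-∀
      lem₂ : ∀ c d → c -ᶻ ((c -ᶻ (d +ᶻ + 1)) +ᶻ (c -ᶻ (d +ᶻ + 1)) +ᶻ + 1) ≡ ((d +ᶻ d +ᶻ + 1) -ᶻ c) +ᶻ + 0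
      lem₂ = ZS.solve-∀

    -- For balanced dice the target sum is the centre of the law, so no other total is attained by
    -- more sequences.
    r-max : ∀ m d₀ → d₀ +ᶻ d₀ ≡ c m → ∀ d → R m d ≤ R m d₀
    r-max m d₀ eq d with ℤₚ.≤-total d d₀
    ... | inj₁ le = chain′ m (increasing m) le top
      where
      top : d₀ +ᶻ d₀ ≤ᶻ c m +ᶻ + 1
      top = subst (_≤ᶻ c m +ᶻ + 1) (sym eq) (ℤₚ.i≤i+j (c m) (+ 1))
    ... | inj₂ ge = subst (_≤ R m d₀) (r-sym m d) (chain′ m (increasing m) (≤ᶻ-from 0 ge (trans (cong (λ z → d₀ -ᶻ (z -ᶻ d)) (sym eq)) (lem d₀ d)))
                      (subst (_≤ᶻ c m +ᶻ + 1) (sym eq) (ℤₚ.i≤i+j (c m) (+ 1))))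
      where
      lem : ∀ d₀ d → d₀ -ᶻ ((d₀ +ᶻ d₀) -ᶻ d) ≡ (d -ᶻ d₀) +ᶻ + 0
      lem = ZS.solve-∀

  abs-pos-diff : ∀ {a b} → a ≤ b → abs (+ a -ᶻ + b) + a ≡ b
  abs-pos-diff {a} {b} h = trans (cong (_+ a) (trans (cong abs (ℤₚ.m-n≡m⊖n a b)) (trans (ℤₚ.∣m⊖n∣≡∣n⊖m∣ a b) (cong abs (ℤₚ.⊖-≥ h))))) (m∸n+n≡m h)

  abs-sym : ∀ x y → abs (x -ᶻ y) ≡ abs (y -ᶻ x)
  abs-sym x y = trans (sym (ℤₚ.∣-i∣≡∣i∣ (x -ᶻ y))) (cong abs (lem x y))
    where
    lem : ∀ x y → -ᶻ (x -ᶻ y) ≡ y -ᶻ x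
    lem = ZS.solve-∀

  variation : (ℕ → ℕ) → ℕ → ℕ
  variation f k = ∑ (rng k) (λ x → abs (+ f x -ᶻ + f (suc x)))

  variation-rising : ∀ (f : ℕ → ℕ) k → (∀ x → x < k → f x ≤ f (suc x)) → variation f k + f 0 ≡ f k
  variation-rising f zero    h = refl
  variation-rising f (suc k) h = begin
    abs (+ f k -ᶻ + f (suc k)) + variation f k + f 0   ≡⟨ +-assoc (abs (+ f k -ᶻ + f (suc k))) _ _ ⟩
    abs (+ f k -ᶻ + f (suc k)) + (variation f k + f 0) ≡⟨ cong (_+_ (abs (+ f k -ᶻ + f (suc k)))) (variation-rising f k (λ x x<k → h x (m≤n⇒m≤1+n x<k))) ⟩
    abs (+ f k -ᶻ + f (suc k)) + f k                   ≡⟨ abs-pos-diff (h k ≤-refl) ⟩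
    f (suc k) ∎
    where open ≡-Reasoning

  variation-falling : ∀ (f : ℕ → ℕ) k → (∀ x → x < k → f (suc x) ≤ f x) → variation f k + f k ≡ f 0
  variation-falling f zero    h = refl
  variation-falling f (suc k) h = begin
    abs (+ f k -ᶻ + f (suc k)) + variation f k + f (suc k)   ≡⟨ cong (λ z → z + variation f k + f (suc k)) (abs-sym (+ f k) (+ f (suc k))) ⟩
    abs (+ f (suc k) -ᶻ + f k) + variation f k + f (suc k)   ≡⟨ lem _ (variation f k) (f (suc k)) ⟩
    variation f k + (abs (+ f (suc k) -ᶻ + f k) + f (suc k)) ≡⟨ cong (_+_ (variation f k)) (abs-pos-diff (h k ≤-refl)) ⟩
    variation f k + f k                                      ≡⟨ variation-falling f k (λ x x<k → h x (m≤n⇒m≤1+n x<k)) ⟩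
    f 0 ∎
    where
    open ≡-Reasoning
    lem : ∀ a b c → a + b + c ≡ b + (a + c)
    lem = NS.solve-∀

  δ-off : ∀ {z x} → ¬ z ≡ x → δ (+ z -ᶻ + x) ≡ 0
  δ-off {z} {x} ne = ind-no ((+ z -ᶻ + x) ℤₚ.≟ + 0) (λ eq → ne (ℤₚ.+-injective (ℤₚ.i-j≡0⇒i≡j (+ z) (+ x) eq)))

  δ-on : ∀ z → δ (+ z -ᶻ + z) ≡ 1
  δ-on z = ind-yes ((+ z -ᶻ + z) ℤₚ.≟ + 0) (ℤₚ.+-inverseʳ (+ z))

  pick-zero : ∀ X (g : ℕ → ℤ) z → X ≤ z → Z.∑ (rng X) (λ x → g x *ᶻ + δ (+ z -ᶻ + x)) ≡ + 0
  pick-zero zero    g z h = refl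
  pick-zero (suc X) g z h = trans (cong₂ _+ᶻ_ (trans (cong (λ u → g X *ᶻ + u) (δ-off {z} {X} (λ eq → <⇒≢ h (sym eq)))) (ℤₚ.*-zeroʳ (g X)))
                                              (pick-zero X g z (≤-trans (n≤1+n X) h))) refl

  pick : ∀ X (g : ℕ → ℤ) z → z < X → Z.∑ (rng X) (λ x → g x *ᶻ + δ (+ z -ᶻ + x)) ≡ g z
  pick (suc X) g z (s≤s h) with z ≟ X
  ... | yes refl = trans (cong₂ _+ᶻ_ (trans (cong (λ u → g z *ᶻ + u) (δ-on z)) (ℤₚ.*-identityʳ (g z))) (pick-zero z g z ≤-refl)) (ℤₚ.+-identityʳ (g z))
  ... | no  ne   = trans (cong₂ _+ᶻ_ (trans (cong (λ u → g X *ᶻ + u) (δ-off {z} {X} ne)) (ℤₚ.*-zeroʳ (g X)))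
                                     (pick X g z (≤∧≢⇒< h ne))) (ℤₚ.+-identityˡ (g z))

  -- The head start `a` absorbs the steps during the induction. The cutoff `X` only has to be large
  -- enough, so that the expansions from `a = 1` and `a = 0` can share it and be subtracted term by
  -- term.
  pushforward : ∀ p m (g : ℤ → ℤ) y a X → a + m * p < X →
    Z.E (rng (suc p)) st₁ m g (y +ᶻ + a) ≡ Z.∑ (rng X) (λ x → g (y +ᶻ + x) *ᶻ + r (suc p) m (+ a -ᶻ + x))
  pushforward p zero    g y a X h = sym (pick X (λ x → g (y +ᶻ + x)) a (subst (_< X) (+-identityʳ a) h))
  pushforward p (suc m) g y a X h = begin
    Z.∑ is (λ i → Z.E is st₁ m g ((y +ᶻ + a) +ᶻ + i))
      ≡⟨ Z.∑-cong∈ is (λ i i∈ → trans (cong (Z.E is st₁ m g) (trans (ℤₚ.+-assoc y (+ a) (+ i)) (cong (y +ᶻ_) (sym (ℤₚ.pos-+ a i)))))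
                                     (pushforward p m g y (a + i) X (≤-<-trans (bnd i (s≤s⁻¹ (∈-rng i∈))) h))) ⟩
    Z.∑ is (λ i → Z.∑ (rng X) (λ x → g (y +ᶻ + x) *ᶻ + R m (+ (a + i) -ᶻ + x)))
      ≡⟨ Z.∑-swap is (rng X) _ ⟩
    Z.∑ (rng X) (λ x → Z.∑ is (λ i → g (y +ᶻ + x) *ᶻ + R m (+ (a + i) -ᶻ + x)))
      ≡⟨ Z.∑-cong (rng X) (λ x → trans (Z.∑-*ˡ is (g (y +ᶻ + x)) _) (cong (g (y +ᶻ + x) *ᶻ_)
           (trans (Z.∑-cong is (λ i → cong (λ z → + R m z) (lem i x))) (sym (+-∑ is _))))) ⟩
    Z.∑ (rng X) (λ x → g (y +ᶻ + x) *ᶻ + R (suc m) (+ a -ᶻ + x)) ∎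
    where
    open ≡-Reasoning
    is = rng (suc p)
    R = r (suc p)
    bnd : ∀ i → i ≤ p → a + i + m * p ≤ a + suc m * p
    bnd i i≤p = subst (_≤ a + suc m * p) (sym (+-assoc a i (m * p))) (+-monoʳ-≤ a (+-monoˡ-≤ (m * p) i≤p))
    lem′ : ∀ a i x → (a +ᶻ i) -ᶻ x ≡ (a -ᶻ x) +ᶻ i
    lem′ = ZS.solve-∀
    lem : ∀ i x → + (a + i) -ᶻ + x ≡ (+ a -ᶻ + x) +ᶻ + i
    lem i x = trans (cong (_-ᶻ + x) (ℤₚ.pos-+ a i)) (lem′ (+ a) (+ i) (+ x))

  ⌊/2⌋-double : ∀ q → ⌊ q /2⌋ + ⌊ q /2⌋ ≤ q × q ≤ suc (⌊ q /2⌋ + ⌊ q /2⌋)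
  ⌊/2⌋-double zero          = z≤n , z≤n
  ⌊/2⌋-double (suc zero)    = z≤n , ≤-refl
  ⌊/2⌋-double (suc (suc q)) with ⌊/2⌋-double q
  ... | l , u rewrite +-suc ⌊ q /2⌋ ⌊ q /2⌋ = s≤s (s≤s l) , s≤s (s≤s u)

  module _ (p m : ℕ) where
    private
      R = r (suc p) m
      X = m * p + 2
      f : ℕ → ℕ
      f x = R (+ 1 -ᶻ + x)
      -- The peak of `f`: the law is centred at `- (m * p) / 2` and `f x` is its value at `1 - x`.
      k = suc ⌊ m * p /2⌋
    open Unimodal p

    private
      f-suc : ∀ x → R (-ᶻ + x) ≡ f (suc x)
      f-suc x = cong R (lem (+ x))
        where
        lem : ∀ x → -ᶻ x ≡ + 1 -ᶻ (+ 1 +ᶻ x)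
        lem = ZS.solve-∀
      f-pred : ∀ x → R (-ᶻ + x +ᶻ + 1) ≡ f x
      f-pred x = cong R (ℤₚ.+-comm (-ᶻ + x) (+ 1))

      k≤X : k ≤ X
      k≤X = ≤-trans (s≤s (≤-trans (m≤m+n ⌊ m * p /2⌋ ⌊ m * p /2⌋) (proj₁ (⌊/2⌋-double (m * p))))) (≤-trans (n≤1+n _) (≤-reflexive (+-comm 2 (m * p))))

      rising : ∀ x → x < k → f x ≤ f (suc x)
      rising x (s≤s x<k) = subst₂ _≤_ (f-pred x) (f-suc x) (decreasing m (-ᶻ + x)
          (≤ᶻ-from 1 (ℤ.+≤+ (≤-trans (+-mono-≤ x<k x<k) (proj₁ (⌊/2⌋-double (m * p)))))
            (trans (lem (+ x) (+ (m * p))) (cong (λ z → (+ (m * p) -ᶻ z) +ᶻ + 1) (sym (ℤₚ.pos-+ x x))))))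
        where
        lem : ∀ x q → ((-ᶻ x +ᶻ -ᶻ x) +ᶻ + 1) -ᶻ (-ᶻ q) ≡ (q -ᶻ (x +ᶻ x)) +ᶻ + 1
        lem = ZS.solve-∀

      falling : ∀ x → k ≤ x → f (suc x) ≤ f x
      falling x k≤x = subst₂ _≤_ (f-suc x) (f-pred x) (increasing m (-ᶻ + x)
          (≤ᶻ-from 0 (ℤ.+≤+ {suc (m * p)} {x + x} (≤-trans (s≤s (proj₂ (⌊/2⌋-double (m * p)))) (≤-trans (≤-reflexive (cong suc (sym (+-suc ⌊ m * p /2⌋ ⌊ m * p /2⌋)))) (+-mono-≤ k≤x k≤x))))
            (trans (lem (+ x) (+ (m * p))) (cong (λ z → (z -ᶻ (+ 1 +ᶻ + (m * p))) +ᶻ + 0) (sym (ℤₚ.pos-+ x x))))))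
        where
        lem : ∀ x q → (-ᶻ q) -ᶻ ((-ᶻ x +ᶻ -ᶻ x) +ᶻ + 1) ≡ ((x +ᶻ x) -ᶻ (+ 1 +ᶻ q)) +ᶻ + 0
        lem = ZS.solve-∀

    -- A unimodal sequence climbs to its maximum and descends once, so its variation is at most
    -- twice that maximum.
    total-variation : ∀ {ρ} → (∀ d → R d ≤ ρ) → variation f X ≤ 2 * ρ
    total-variation {ρ} h = begin
      variation f X            ≡⟨ cong (variation f) (m+[n∸m]≡n k≤X) ⟨
      variation f (k + (X ∸ k)) ≡⟨ ∑-rng-+ k (X ∸ k) _ ⟩
      variation f k + ∑ (rng (X ∸ k)) (λ x → abs (+ f (k + x) -ᶻ + f (suc (k + x))))
        ≡⟨ cong (_+_ (variation f k)) (∑-cong (rng (X ∸ k)) (λ x → cong (λ y → abs (+ f (k + x) -ᶻ + f y)) (sym (+-suc k x)))) ⟩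
      variation f k + variation (λ x → f (k + x)) (X ∸ k)
        ≤⟨ +-mono-≤ {variation f k} (≤-trans (m≤m+n (variation f k) (f 0)) (≤-reflexive (variation-rising f k rising)))
                    (≤-trans (m≤m+n (variation (λ x → f (k + x)) (X ∸ k)) (f (k + (X ∸ k)))) (≤-reflexive (variation-falling (λ x → f (k + x)) (X ∸ k)
                        (λ x _ → subst (λ y → f y ≤ f (k + x)) (sym (+-suc k x)) (falling (k + x) (m≤m+n k x)))))) ⟩
      f k + f (k + 0)          ≤⟨ +-mono-≤ (h _) (h _) ⟩
      ρ + ρ                    ≡⟨ cong (_+_ ρ) (sym (+-identityʳ ρ)) ⟩
      2 * ρ ∎
      where open ≤-Reasoning

    -- Summation by parts moves the difference from `g` onto the law of the sum. Hence `g` needs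
    -- only to be bounded, and the gain is the small maximum `ρ` of the law.
    E-difference : ∀ {ρ M} (g : ℤ → ℤ) → (∀ d → R d ≤ ρ) → (∀ z → abs (g z) ≤ M) → ∀ y →
      abs (Z.E (rng (suc p)) st₁ m g (y +ᶻ + 1) -ᶻ Z.E (rng (suc p)) st₁ m g y) ≤ 2 * ρ * M
    E-difference {ρ} {M} g hρ hM y = begin
      abs (Z.E is st₁ m g (y +ᶻ + 1) -ᶻ Z.E is st₁ m g y)
        ≡⟨ cong₂ (λ a b → abs (a -ᶻ b)) (pushforward p m g y 1 X (≤-reflexive (+-comm 2 (m * p))))
             (trans (cong (Z.E is st₁ m g) (sym (ℤₚ.+-identityʳ y))) (pushforward p m g y 0 X (≤-trans (n≤1+n _) (≤-reflexive (+-comm 2 (m * p)))))) ⟩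
      abs (Z.∑ (rng X) (λ x → g (y +ᶻ + x) *ᶻ + f x) -ᶻ Z.∑ (rng X) (λ x → g (y +ᶻ + x) *ᶻ + R (+ 0 -ᶻ + x)))
        ≡⟨ cong abs (trans (cong (Z.∑ (rng X) (λ x → g (y +ᶻ + x) *ᶻ + f x) +ᶻ_) (sym (∑ᶻ-neg (rng X) _))) (sym (Z.∑-+ (rng X) _ _))) ⟩
      abs (Z.∑ (rng X) (λ x → g (y +ᶻ + x) *ᶻ + f x +ᶻ -ᶻ (g (y +ᶻ + x) *ᶻ + R (+ 0 -ᶻ + x))))
        ≡⟨ cong abs (Z.∑-cong (rng X) (λ x → trans (cong (λ z → g (y +ᶻ + x) *ᶻ + f x +ᶻ -ᶻ (g (y +ᶻ + x) *ᶻ + z)) (trans (cong R (ℤₚ.+-identityˡ (-ᶻ + x))) (f-suc x)))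
                                                   (lem (g (y +ᶻ + x)) (+ f x) (+ f (suc x))))) ⟩
      abs (Z.∑ (rng X) (λ x → g (y +ᶻ + x) *ᶻ (+ f x -ᶻ + f (suc x))))
        ≤⟨ abs-∑ (rng X) _ ⟩
      ∑ (rng X) (λ x → abs (g (y +ᶻ + x) *ᶻ (+ f x -ᶻ + f (suc x))))
        ≤⟨ ∑-mono (rng X) (λ x → ≤-trans (≤-reflexive (ℤₚ.abs-* (g (y +ᶻ + x)) _)) (*-monoˡ-≤ _ (hM (y +ᶻ + x)))) ⟩
      ∑ (rng X) (λ x → M * abs (+ f x -ᶻ + f (suc x)))
        ≡⟨ ∑-*ˡ (rng X) M _ ⟩
      M * variation f X   ≤⟨ *-monoʳ-≤ M (total-variation hρ) ⟩
      M * (2 * ρ)         ≡⟨ *-comm M (2 * ρ) ⟩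
      2 * ρ * M ∎
      where
      open ≤-Reasoning
      is = rng (suc p)
      lem : ∀ g a b → g *ᶻ a +ᶻ -ᶻ (g *ᶻ b) ≡ g *ᶻ (a -ᶻ b)
      lem = ZS.solve-∀

  -- Concentration of the sum of independent faces

  win : ℕ → ℤ → ℕ
  win w (+ a)    = ind (a <? w)
  win w -[1+ _ ] = 0

  private
    drop-w : ∀ {x y w} → y +ᶻ + w ≤ᶻ x → x ≤ᶻ + w -ᶻ + 1 → y ≤ᶻ -[1+ 0 ]
    drop-w {x} {y} {w} h h′ = ≤ᶻ-from 0 (ℤₚ.≤-trans h h′) (lem y (+ w))
      where
      lem : ∀ y w → -[1+ 0 ] -ᶻ y ≡ ((w -ᶻ + 1) -ᶻ (y +ᶻ w)) +ᶻ + 0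
      lem = ZS.solve-∀

    win-neg : ∀ w y → y ≤ᶻ -[1+ 0 ] → win w y ≡ 0
    win-neg w -[1+ _ ] h = refl
    win-neg w (+ _) ()

    win-below : ∀ {w x J} → Sep w (x ∷ J) → x ≤ᶻ + w -ᶻ + 1 → ∑ J (win w) ≡ 0
    win-below [ x ] h = refl
    win-below {w} (_∷_ {x} {y} h′ p) h = cong₂ _+_ (win-neg w y (drop-w h′ h)) (win-below p (ℤₚ.≤-trans (drop-w {x} {y} h′ h) (neg≤ w)))
      where
      neg≤ : ∀ w → -[1+ 0 ] ≤ᶻ + w -ᶻ + 1
      neg≤ w = ≤ᶻ-from {+ 0} {+ 0} w ℤₚ.≤-refl (lem (+ w))
        where
        lem : ∀ w → (w -ᶻ + 1) -ᶻ -[1+ 0 ] ≡ (+ 0 -ᶻ + 0) +ᶻ w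
        lem = ZS.solve-∀

  ∑-win≤1 : ∀ {w J} → Sep w J → ∑ J (win w) ≤ 1
  ∑-win≤1 {w} {[]} p = z≤n
  ∑-win≤1 {w} { -[1+ a ] ∷ J} p = ∑-win≤1 (Sep-tail p)
  ∑-win≤1 {w} {+ a ∷ J} p with a <? w
  ... | no  _   = ∑-win≤1 (Sep-tail p)
  ... | yes a<w = ≤-reflexive (cong suc (win-below p (≤ᶻ-from 0 (ℤ.+≤+ a<w) (lem (+ a) (+ w)))))
    where
    lem : ∀ a w → (w -ᶻ + 1) -ᶻ a ≡ (w -ᶻ (+ 1 +ᶻ a)) +ᶻ + 0
    lem = ZS.solve-∀

  grid : ℕ → ℤ → ℕ → List ℤ
  grid w x zero    = []
  grid w x (suc r) = x ∷ grid w (x -ᶻ + w) r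

  length-grid : ∀ w x r → length (grid w x r) ≡ r
  length-grid w x zero    = refl
  length-grid w x (suc r) = cong suc (length-grid w _ r)

  Sep-grid : ∀ w x r → Sep w (grid w x r)
  Sep-grid w x zero          = []
  Sep-grid w x (suc zero)    = [ x ]
  Sep-grid w x (suc (suc r)) = ℤₚ.≤-reflexive (lem x (+ w)) ∷ Sep-grid w (x -ᶻ + w) (suc r)
    where
    lem : ∀ x w → (x -ᶻ w) +ᶻ w ≡ x
    lem = ZS.solve-∀

  grid-cover : ∀ w x r {t a} → t +ᶻ x ≡ + a → a < r * w → 1 ≤ ∑ (grid w x r) (λ y → win w (t +ᶻ y))
  grid-cover w x (suc r) {t} {a} eq h with a <? w
  ... | yes a<w = ≤-trans (≤-reflexive (sym (trans (cong (win w) eq) (ind-yes (a <? w) a<w)))) (m≤m+n _ _)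
  ... | no  a≮w = ≤-trans (grid-cover w (x -ᶻ + w) r {t} {a ∸ w}
        (trans (lem t x (+ w)) (trans (cong (_-ᶻ + w) eq) (trans (ℤₚ.m-n≡m⊖n a w) (ℤₚ.⊖-≥ (≮⇒≥ a≮w)))))
        (subst (a ∸ w <_) (m+n∸m≡n w (r * w)) (∸-monoˡ-< h (≮⇒≥ a≮w)))) (m≤n+m _ _)
    where
    lem : ∀ t x w → t +ᶻ (x -ᶻ w) ≡ (t +ᶻ x) -ᶻ w
    lem = ZS.solve-∀

  module _ (is : List ℕ) (v s : ℕ → ℤ) where
    private
      st = step v s

    E-shift-t : ∀ k (F : ℤ × ℤ → ℕ) t d → E is st k F (t , d) ≡ E is st k (λ y → F (t +ᶻ proj₁ y , proj₂ y)) (+ 0 , d)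
    E-shift-t k F t d = sym (trans (E-project is st st (λ y → t +ᶻ proj₁ y , proj₂ y)
        (λ i y → cong (_, proj₂ y +ᶻ s i) (sym (ℤₚ.+-assoc t (proj₁ y) (v i)))) k F (+ 0 , d))
        (cong (λ z → E is st k F (z , d)) (ℤₚ.+-identityʳ t)))

    E-shift-d : ∀ k (F : ℤ × ℤ → ℕ) t d → E is st k F (t , d) ≡ E is st k (λ y → F (proj₁ y , d +ᶻ proj₂ y)) (t , + 0)
    E-shift-d k F t d = sym (trans (E-project is st st (λ y → proj₁ y , d +ᶻ proj₂ y)
        (λ i y → cong (proj₁ y +ᶻ v i ,_) (sym (ℤₚ.+-assoc d (proj₂ y) (s i)))) k F (t , + 0))
        (cong (λ z → E is st k F (t , z)) (ℤₚ.+-identityʳ d)))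

    -- Windows translated by separated amounts are disjoint, so together they see each end point at
    -- most once. The weight `χ` is constant for plain sums and `δ` for balanced dice.
    Bounded-base : ∀ {w} g β {Q} m (χ : ℤ → ℕ) → (∀ d → E is st m (λ y → χ (proj₂ y)) (+ 0 , d) ≤ Q) →
      Bounded w (Φ g β Q 0) (E is st m (λ y → win w (proj₁ y) * χ (proj₂ y)))
    Bounded-base g β m χ h d {[]} p = z≤n
    Bounded-base {w} g β {Q} m χ h d {x ∷ J} p = begin
      ∑ (x ∷ J) (λ t → E is st m (λ y → win w (proj₁ y) * χ (proj₂ y)) (t , d))
        ≡⟨ ∑-cong (x ∷ J) (λ t → E-shift-t m _ t d) ⟩
      ∑ (x ∷ J) (λ t → E is st m (λ y → win w (t +ᶻ proj₁ y) * χ (proj₂ y)) (+ 0 , d))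
        ≡⟨ E-∑ is st (x ∷ J) m _ (+ 0 , d) ⟨
      E is st m (λ y → ∑ (x ∷ J) (λ t → win w (t +ᶻ proj₁ y) * χ (proj₂ y))) (+ 0 , d)
        ≤⟨ E-mono is st m (λ y → weight (proj₁ y) (χ (proj₂ y))) (+ 0 , d) ⟩
      E is st m (λ y → χ (proj₂ y)) (+ 0 , d) ≤⟨ h d ⟩
      Q ∎
      where
      open ≤-Reasoning
      weight : ∀ z q → ∑ (x ∷ J) (λ t → win w (t +ᶻ z) * q) ≤ q
      weight z q = begin
        ∑ (x ∷ J) (λ t → win w (t +ᶻ z) * q) ≡⟨ ∑-*ʳ (x ∷ J) q (λ t → win w (t +ᶻ z)) ⟩
        ∑ (x ∷ J) (λ t → win w (t +ᶻ z)) * q ≤⟨ *-monoˡ-≤ q one ⟩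
        1 * q ≡⟨ *-identityˡ q ⟩
        q ∎
        where
        one : ∑ (x ∷ J) (λ t → win w (t +ᶻ z)) ≤ 1
        one = ≤-trans (≤-reflexive (sym (∑-map (_+ᶻ z) (x ∷ J) (win w)))) (∑-win≤1 (Sep-shift z p))

  factor-pos : ∀ a b → 1 ≤ a * b → 1 ≤ b
  factor-pos a zero    h = subst (1 ≤_) (*-zeroʳ a) h
  factor-pos a (suc b) h = s≤s z≤n

  n^2k : ∀ n k → (n * n) ^ k ≡ n ^ (k * 2)
  n^2k n zero    = refl
  n^2k n (suc k) = trans (cong (n * n *_) (n^2k n k)) (*-assoc n n _)

  ∑∑-const : ∀ n m c → ∑ (rng n) (λ _ → ∑ (rng m) (λ _ → c)) ≡ n * (m * c)
  ∑∑-const n m c = trans (∑-cong (rng n) (λ _ → ∑-rng-const m c)) (∑-rng-const n (m * c))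

  module _ {n e : ℕ} (8e≤n : 8 * e ≤ n) where
    octant : ∀ a → a + 1 ≤ 8 → a * e + e ≤ n
    octant a h = ≤-trans (≤-trans (≤-reflexive (lem a e)) (*-monoˡ-≤ e h)) 8e≤n
      where
      lem : ∀ a e → a * e + e ≡ (a + 1) * e
      lem = NS.solve-∀

    good-total : ∀ {g} → g ≤ e * e → n * n ≡ 2 * g + (n * n ∸ 2 * g)
    good-total {g} h = sym (m+[n∸m]≡n (begin
        2 * g            ≤⟨ *-monoʳ-≤ 2 h ⟩
        2 * (e * e)      ≤⟨ *-monoˡ-≤ (e * e) {2} {64} (s≤s (s≤s z≤n)) ⟩
        64 * (e * e)     ≡⟨ lem e ⟩
        8 * e * (8 * e)  ≤⟨ *-mono-≤ 8e≤n 8e≤n ⟩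
        n * n ∎))
      where
      open ≤-Reasoning
      lem : ∀ e → 64 * (e * e) ≡ 8 * e * (8 * e)
      lem = NS.solve-∀


  ∑e-ind≤ : ∀ e {P : ℕ → ℕ → Set} (d : ∀ x y → Dec (P x y)) → ∑ (rng e) (λ x → ∑ (rng e) (λ y → ind (d x y))) ≤ e * e
  ∑e-ind≤ e d = ≤-trans (∑-mono (rng e) (λ x → ∑-mono (rng e) (λ y → ind≤1 (d x y))))
                        (≤-reflexive (trans (∑∑-const e e 1) (cong (e *_) (*-identityʳ e))))

  +ᶻ-cancelˡ : ∀ x i j → x +ᶻ i ≡ x +ᶻ j → i ≡ j
  +ᶻ-cancelˡ x i j eq = trans (sym (lem x i)) (trans (cong (_-ᶻ x) eq) (lem x j))
    where
    lem : ∀ x i → (x +ᶻ i) -ᶻ x ≡ i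
    lem = ZS.solve-∀

  ∑-δ : ∀ X x → (∑ (rng X) (λ i → δ (x +ᶻ + i)) ≡ 0) ⊎ (∃[ i ] i < X × x +ᶻ + i ≡ + 0 × ∑ (rng X) (λ i → δ (x +ᶻ + i)) ≡ 1)
  ∑-δ zero    x = inj₁ refl
  ∑-δ (suc X) x with (x +ᶻ + X) ℤₚ.≟ + 0 | ∑-δ X x
  ... | yes eq | inj₁ z = inj₂ (X , ≤-refl , eq , cong suc z)
  ... | yes eq | inj₂ (i , i<X , eq′ , _) = ⊥-elim (<⇒≢ i<X (ℤₚ.+-injective (+ᶻ-cancelˡ x (+ i) (+ X) (trans eq′ (sym eq)))))
  ... | no  _  | inj₁ z = inj₁ z
  ... | no  _  | inj₂ (i , i<X , eq′ , o) = inj₂ (i , m≤n⇒m≤1+n i<X , eq′ , o)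

  -- Littlewood–Offord for the plain sums: a window of n consecutive values is covered by four of width 4e.
  module Concentration (p e : ℕ) (8e≤n : 8 * e ≤ suc p) (n≤16e : suc p ≤ 16 * e) where
    private
      n = suc p
      w = 4 * e
      V S : ℕ → ℤ
      V i = + i
      S i = + 0
      is = rng n
      open Couples n e V S 0 0 w 0 w (m≤m+n e _) (octant {n} {e} 8e≤n 4 (m≤m+n 5 3))
        (octant {n} {e} 8e≤n 0 (m≤m+n 1 7)) (octant {n} {e} 8e≤n 0 (m≤m+n 1 7)) (λ _ _ → refl)

      gap≡ : ∀ x y → gap x y ≡ w
      gap≡ x y = trans (cong (λ z → abs ((+ x +ᶻ + y) -ᶻ (z +ᶻ + y))) (ℤₚ.pos-+ w x))
                       (trans (cong abs (lem (+ x) (+ y) (+ w))) (ℤₚ.∣-i∣≡∣i∣ (+ w)))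
        where
        lem : ∀ x y w → (x +ᶻ y) -ᶻ ((w +ᶻ x) +ᶻ y) ≡ -ᶻ w
        lem = ZS.solve-∀

      good≡ : good ≡ e * e
      good≡ = trans (∑-cong (rng e) (λ x → ∑-cong (rng e) (λ y → ind-yes (w ≤? gap x y) (≤-reflexive (sym (gap≡ x y))))))
                    (trans (∑∑-const e e 1) (cong (e *_) (*-identityʳ e)))

      β = n * n ∸ 2 * good
      total : n * n ≡ 2 * good + β
      total = good-total {n} {e} 8e≤n (≤-reflexive good≡)

      F : ℤ × ℤ → ℕ
      F y = win w (proj₁ y) * 1

      cover : ∀ d z → ∑ is (λ i → δ ((z +ᶻ d) +ᶻ + i)) ≤ ∑ (grid w (d +ᶻ + p) 4) (λ t → win w (z +ᶻ t) * 1)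
      cover d z with ∑-δ n (z +ᶻ d)
      ... | inj₁ z≡0 rewrite z≡0 = z≤n
      ... | inj₂ (i , s≤s i≤p , eq , o) = ≤-trans (≤-reflexive o) (≤-trans
          (grid-cover w (d +ᶻ + p) 4 {z} {p ∸ i}
            (trans (lem z d (+ p) (+ i)) (trans (cong (_+ᶻ (+ p -ᶻ + i)) eq) (trans (ℤₚ.+-identityˡ _) (trans (ℤₚ.m-n≡m⊖n p i) (ℤₚ.⊖-≥ i≤p)))))
            (≤-trans (s≤s (m∸n≤m p i)) (≤-trans n≤16e (≤-reflexive (ar e)))))
          (≤-reflexive (∑-cong (grid w (d +ᶻ + p) 4) {λ t → win w (z +ᶻ t)} (λ t → sym (*-identityʳ _)))))
        where
        lem : ∀ z d p i → z +ᶻ (d +ᶻ p) ≡ ((z +ᶻ d) +ᶻ i) +ᶻ (p -ᶻ i)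
        lem = ZS.solve-∀
        ar : ∀ e → 16 * e ≡ 4 * (4 * e)
        ar = NS.solve-∀

    module _ (k m : ℕ) where
      private
        st = step V S

      -- One step is set aside: it spreads the target point over `n` consecutive values, which
      -- supplies the factor 1 / n. Littlewood-Offord for the other steps then works at the scale of
      -- `n` and supplies the factor 1 / √k.
      r≤Φ : ∀ d → r n (suc (k * 2 + m)) d ≤ Φ good β (n ^ m) k 4
      r≤Φ d = begin
        ∑ is (λ i → E is st₁ M δ (d +ᶻ + i))
          ≡⟨ ∑-cong is (λ i → trans (cong (E is st₁ M δ) (ar₁ d (+ i))) (sym (E-project is st st₁ (λ y → (proj₁ y +ᶻ d) +ᶻ + i)
               (λ j y → ar₂ (proj₁ y) d (+ i) (+ j)) M δ (+ 0 , + 0)))) ⟩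
        ∑ is (λ i → E is st M (λ y → δ ((proj₁ y +ᶻ d) +ᶻ + i)) (+ 0 , + 0))
          ≡⟨ E-∑ is st is M (λ i y → δ ((proj₁ y +ᶻ d) +ᶻ + i)) (+ 0 , + 0) ⟨
        E is st M (λ y → ∑ is (λ i → δ ((proj₁ y +ᶻ d) +ᶻ + i))) (+ 0 , + 0)
          ≤⟨ E-mono is st M (λ y → cover d (proj₁ y)) (+ 0 , + 0) ⟩
        E is st M (λ y → ∑ (grid w (d +ᶻ + p) 4) (λ t → win w (proj₁ y +ᶻ t) * 1)) (+ 0 , + 0)
          ≡⟨ E-∑ is st (grid w (d +ᶻ + p) 4) M (λ t y → win w (proj₁ y +ᶻ t) * 1) (+ 0 , + 0) ⟩
        ∑ (grid w (d +ᶻ + p) 4) (λ t → E is st M (λ y → win w (proj₁ y +ᶻ t) * 1) (+ 0 , + 0))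
          ≡⟨ ∑-cong (grid w (d +ᶻ + p) 4) (λ t → trans (E-cong is st M (λ y → cong (λ z → win w z * 1) (ℤₚ.+-comm (proj₁ y) t)) (+ 0 , + 0))
               (sym (E-shift-t is V S M F t (+ 0)))) ⟩
        ∑ (grid w (d +ᶻ + p) 4) (λ t → E is st M F (t , + 0))
          ≡⟨ ∑-cong (grid w (d +ᶻ + p) 4) (λ t → E-add is st (k * 2) m F (t , + 0)) ⟩
        ∑ (grid w (d +ᶻ + p) 4) (λ t → E is st (k * 2) (E is st m F) (t , + 0))
          ≤⟨ Bounded-walk total {n ^ m} (Bounded-base is V S good β m (λ _ → 1) base) k (+ 0) (Sep-grid w (d +ᶻ + p) 4) ⟩
        Φ good β (n ^ m) k 4 ∎
        where
        open ≤-Reasoning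
        M = k * 2 + m
        ar₁ : ∀ d i → d +ᶻ i ≡ (+ 0 +ᶻ d) +ᶻ i
        ar₁ = ZS.solve-∀
        ar₂ : ∀ t d i j → ((t +ᶻ j) +ᶻ d) +ᶻ i ≡ ((t +ᶻ d) +ᶻ i) +ᶻ j
        ar₂ = ZS.solve-∀
        base : ∀ d → E is st m (λ _ → 1) (+ 0 , d) ≤ n ^ m
        base d = ≤-reflexive (trans (E-const is st m 1 (+ 0 , d)) (trans (*-identityʳ _) (cong (_^ m) (length-rng n))))

      -- `Φ-bound` with `R` of order √k. The factor 512 is 4 · 16² / 2: four windows, `n ≤ 16 * e`
      -- squared, and the 2 of `2 * good`.
      r-bound : ∀ {R c} → R * R ≤ c * k → ∀ d → R * r n (suc (k * 2 + m)) d ≤ (4 + 512 * c) * n ^ (k * 2 + m)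
      r-bound {zero}      h d = z≤n
      r-bound {R@(suc _)} {c} h d = *-cancelˡ-≤ (2 * (e * e) * k) {{nz}} (begin
          2 * (e * e) * k * (R * r n (suc (k * 2 + m)) d)   ≤⟨ *-monoʳ-≤ (2 * (e * e) * k) (*-monoʳ-≤ R (r≤Φ d)) ⟩
          2 * (e * e) * k * (R * Φ good β Q k 4)            ≡⟨ cong (λ g → 2 * g * k * (R * Φ good β Q k 4)) (sym good≡) ⟩
          2 * good * k * (R * Φ good β Q k 4)               ≡⟨ ar₁ good k R (Φ good β Q k 4) ⟩
          k * (2 * good) * R * Φ good β Q k 4               ≤⟨ Φ-bound good β Q R k 4 ⟩
          Q * (2 * good + β) ^ k * (2 * good * k * 4 + (2 * good + β) * R * R * 4)
            ≡⟨ cong₂ (λ a b → Q * a ^ k * (2 * b * k * 4 + a * R * R * 4)) (sym total) good≡ ⟩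
          Q * (n * n) ^ k * (2 * (e * e) * k * 4 + n * n * R * R * 4)
            ≡⟨ cong₂ (λ a b → a * (2 * (e * e) * k * 4 + b)) powers (ar₂ n R) ⟩
          n ^ (k * 2 + m) * (2 * (e * e) * k * 4 + 4 * (n * n * (R * R)))
            ≤⟨ *-monoʳ-≤ (n ^ (k * 2 + m)) (+-monoʳ-≤ (2 * (e * e) * k * 4) (*-monoʳ-≤ 4 (*-mono-≤ (*-mono-≤ n≤16e n≤16e) h))) ⟩
          n ^ (k * 2 + m) * (2 * (e * e) * k * 4 + 4 * (16 * e * (16 * e) * (c * k)))
            ≡⟨ ar₃ (n ^ (k * 2 + m)) e k c ⟩
          2 * (e * e) * k * ((4 + 512 * c) * n ^ (k * 2 + m)) ∎)
        where
        open ≤-Reasoning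
        Q = n ^ m
        ar₁ : ∀ g k R F → 2 * g * k * (R * F) ≡ k * (2 * g) * R * F
        ar₁ = NS.solve-∀
        ar₂ : ∀ n R → n * n * R * R * 4 ≡ 4 * (n * n * (R * R))
        ar₂ = NS.solve-∀
        ar₃ : ∀ Y e k c → Y * (2 * (e * e) * k * 4 + 4 * (16 * e * (16 * e) * (c * k))) ≡ 2 * (e * e) * k * ((4 + 512 * c) * Y)
        ar₃ = NS.solve-∀
        powers : Q * (n * n) ^ k ≡ n ^ (k * 2 + m)
        powers = trans (cong (Q *_) (n^2k n k)) (trans (*-comm Q _) (sym (^-distribˡ-+-* n (k * 2) m)))
        k≢0 : 1 ≤ k
        k≢0 = factor-pos c k (≤-trans (s≤s z≤n) h)
        e≢0 : 1 ≤ e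
        e≢0 = factor-pos 16 e (≤-trans (s≤s z≤n) n≤16e)
        nz : NonZero (2 * (e * e) * k)
        nz = >-nonZero (*-mono-≤ {1} {2 * (e * e)} {1} {k} (*-mono-≤ {1} {2} {1} {e * e} (s≤s z≤n) (*-mono-≤ e≢0 e≢0)) k≢0)

  -- Moments and the number of balanced dice

  sq q4 : ℤ → ℕ
  sq z = abs z * abs z
  q4 z = sq z * sq z

  +sq : ∀ z → + sq z ≡ z *ᶻ z
  +sq (+ n)    = ℤₚ.pos-* n n
  +sq -[1+ n ] = refl

  sq≥0 : ∀ x → + 0 ≤ᶻ x *ᶻ x
  sq≥0 x = subst (+ 0 ≤ᶻ_) (+sq x) (ℤ.+≤+ z≤n)

  +q4 : ∀ z → + q4 z ≡ (z *ᶻ z) *ᶻ (z *ᶻ z)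
  +q4 z = trans (ℤₚ.pos-* (sq z) (sq z)) (cong₂ _*ᶻ_ (+sq z) (+sq z))

  *-nonneg : ∀ {x y} → + 0 ≤ᶻ x → + 0 ≤ᶻ y → + 0 ≤ᶻ x *ᶻ y
  *-nonneg {+ a} {+ b} _ _ = subst (+ 0 ≤ᶻ_) (ℤₚ.pos-* a b) (ℤ.+≤+ z≤n)

  +-nonneg : ∀ {x y} → + 0 ≤ᶻ x → + 0 ≤ᶻ y → + 0 ≤ᶻ x +ᶻ y
  +-nonneg = ℤₚ.+-mono-≤

  ≤ᶻ-by : ∀ {x y} z → + 0 ≤ᶻ z → y -ᶻ x ≡ z → x ≤ᶻ y
  ≤ᶻ-by z h eq = ℤₚ.0≤i-j⇒j≤i (subst (+ 0 ≤ᶻ_) (sym eq) h)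

  module _ (is : List ℕ) (v : ℕ → ℤ) where
    private
      n = length is
      st : ℕ → ℤ → ℤ
      st i t = t +ᶻ v i

      pow-suc : ∀ k x → + (n ^ k) *ᶻ (+ n *ᶻ x) ≡ + (n ^ suc k) *ᶻ x
      pow-suc k x = trans (sym (ℤₚ.*-assoc (+ (n ^ k)) (+ n) x)) (cong (_*ᶻ x) (trans (ℤₚ.*-comm (+ (n ^ k)) (+ n)) (sym (ℤₚ.pos-* n (n ^ k)))))

      -- Comparison principle: a supersolution `H` of the averaging recursion dominates the moments
      -- of the walk, so each moment bound reduces to one step.
      E-step : (H : ℕ → ℤ → ℤ) (F : ℤ → ℤ) → (∀ t → F t ≤ᶻ H 0 t) →
               (∀ k t → Z.∑ is (λ i → H k (t +ᶻ v i)) ≤ᶻ + n *ᶻ H (suc k) t) →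
               ∀ k t → Z.E is st k F t ≤ᶻ + (n ^ k) *ᶻ H k t
      E-step H F h₀ h zero    t = subst (F t ≤ᶻ_) (sym (ℤₚ.*-identityˡ (H 0 t))) (h₀ t)
      E-step H F h₀ h (suc k) t = begin
        Z.∑ is (λ i → Z.E is st k F (t +ᶻ v i))        ≤⟨ ∑ᶻ-mono∈ is (λ i _ → E-step H F h₀ h k (t +ᶻ v i)) ⟩
        Z.∑ is (λ i → + (n ^ k) *ᶻ H k (t +ᶻ v i))     ≡⟨ Z.∑-*ˡ is (+ (n ^ k)) _ ⟩
        + (n ^ k) *ᶻ Z.∑ is (λ i → H k (t +ᶻ v i))     ≤⟨ ℤₚ.*-monoˡ-≤-nonNeg (+ (n ^ k)) (h k t) ⟩
        + (n ^ k) *ᶻ (+ n *ᶻ H (suc k) t)              ≡⟨ pow-suc k _ ⟩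
        + (n ^ suc k) *ᶻ H (suc k) t ∎
        where open ℤₚ.≤-Reasoning

      affine : ∀ a b (f : ℕ → ℤ) → Z.∑ is (λ i → a +ᶻ b *ᶻ f i) ≡ + n *ᶻ a +ᶻ b *ᶻ Z.∑ is f
      affine a b f = trans (Z.∑-+ is (λ _ → a) (λ i → b *ᶻ f i)) (cong₂ _+ᶻ_ (∑ᶻ-const is a) (Z.∑-*ˡ is b f))

    second-moment : ∀ μ B → Z.∑ is (λ i → v i -ᶻ μ) ≡ + 0 → Z.∑ is (λ i → (v i -ᶻ μ) *ᶻ (v i -ᶻ μ)) ≤ᶻ + n *ᶻ + B →
      ∀ k t → t +ᶻ + k *ᶻ μ ≡ + 0 → E is st k sq t ≤ n ^ k * (k * B)
    second-moment μ B h₁ h₂ k t t≡ = ℤₚ.drop‿+≤+ (begin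
        + E is st k sq t            ≡⟨ trans (+-E is st k sq t) (Z.E-cong is st k +sq t) ⟩
        Z.E is st k (λ t → t *ᶻ t) t ≤⟨ E-step H (λ t → t *ᶻ t) base stepH k t ⟩
        + (n ^ k) *ᶻ H k t          ≡⟨ cong (λ z → + (n ^ k) *ᶻ (z *ᶻ z +ᶻ + k *ᶻ + B)) t≡ ⟩
        + (n ^ k) *ᶻ (+ 0 +ᶻ + k *ᶻ + B) ≡⟨ cong (+ (n ^ k) *ᶻ_) (trans (ℤₚ.+-identityˡ _) (sym (ℤₚ.pos-* k B))) ⟩
        + (n ^ k) *ᶻ + (k * B)      ≡⟨ ℤₚ.pos-* (n ^ k) (k * B) ⟨
        + (n ^ k * (k * B)) ∎)
      where
      open ℤₚ.≤-Reasoning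
      H : ℕ → ℤ → ℤ
      H k t = (t +ᶻ + k *ᶻ μ) *ᶻ (t +ᶻ + k *ᶻ μ) +ᶻ + k *ᶻ + B
      base : ∀ t → t *ᶻ t ≤ᶻ H 0 t
      base t = ℤₚ.≤-reflexive (lem t μ (+ B))
        where
        lem : ∀ t μ B → t *ᶻ t ≡ (t +ᶻ + 0 *ᶻ μ) *ᶻ (t +ᶻ + 0 *ᶻ μ) +ᶻ + 0 *ᶻ B
        lem = ZS.solve-∀
      stepH : ∀ k t → Z.∑ is (λ i → H k (t +ᶻ v i)) ≤ᶻ + n *ᶻ H (suc k) t
      stepH k t = begin
        Z.∑ is (λ i → H k (t +ᶻ v i))
          ≡⟨ Z.∑-cong is (λ i → lem t (v i) (+ k) μ (+ B)) ⟩
        Z.∑ is (λ i → (u *ᶻ u +ᶻ + k *ᶻ + B +ᶻ + 2 *ᶻ u *ᶻ (v i -ᶻ μ)) +ᶻ (v i -ᶻ μ) *ᶻ (v i -ᶻ μ))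
          ≡⟨ trans (Z.∑-+ is _ _) (cong (_+ᶻ Z.∑ is (λ i → (v i -ᶻ μ) *ᶻ (v i -ᶻ μ))) (affine (u *ᶻ u +ᶻ + k *ᶻ + B) (+ 2 *ᶻ u) (λ i → v i -ᶻ μ))) ⟩
        + n *ᶻ (u *ᶻ u +ᶻ + k *ᶻ + B) +ᶻ + 2 *ᶻ u *ᶻ Z.∑ is (λ i → v i -ᶻ μ) +ᶻ Z.∑ is (λ i → (v i -ᶻ μ) *ᶻ (v i -ᶻ μ))
          ≤⟨ ℤₚ.+-mono-≤ (ℤₚ.≤-reflexive (cong (λ z → + n *ᶻ (u *ᶻ u +ᶻ + k *ᶻ + B) +ᶻ + 2 *ᶻ u *ᶻ z) h₁)) h₂ ⟩
        + n *ᶻ (u *ᶻ u +ᶻ + k *ᶻ + B) +ᶻ + 2 *ᶻ u *ᶻ + 0 +ᶻ + n *ᶻ + B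
          ≡⟨ lem₂ (+ n) u (+ k) (+ B) ⟩
        + n *ᶻ (u *ᶻ u +ᶻ (+ 1 +ᶻ + k) *ᶻ + B) ∎
        where
        u = t +ᶻ + suc k *ᶻ μ
        lem : ∀ t v k μ B → ((t +ᶻ v) +ᶻ k *ᶻ μ) *ᶻ ((t +ᶻ v) +ᶻ k *ᶻ μ) +ᶻ k *ᶻ B ≡
          ((t +ᶻ (+ 1 +ᶻ k) *ᶻ μ) *ᶻ (t +ᶻ (+ 1 +ᶻ k) *ᶻ μ) +ᶻ k *ᶻ B +ᶻ + 2 *ᶻ (t +ᶻ (+ 1 +ᶻ k) *ᶻ μ) *ᶻ (v -ᶻ μ)) +ᶻ (v -ᶻ μ) *ᶻ (v -ᶻ μ)
        lem = ZS.solve-∀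
        lem₂ : ∀ n u k B → n *ᶻ (u *ᶻ u +ᶻ k *ᶻ B) +ᶻ + 2 *ᶻ u *ᶻ + 0 +ᶻ n *ᶻ B ≡ n *ᶻ (u *ᶻ u +ᶻ (+ 1 +ᶻ k) *ᶻ B)
        lem₂ = ZS.solve-∀

    fourth-moment : ∀ c → Z.∑ is v ≡ + 0 → (∀ i → i ∈ is → abs (v i) ≤ c) → ∀ k → E is st k q4 (+ 0) ≤ n ^ k * (4 * (k * k) * (c * c * (c * c)))
    fourth-moment c h₁ h₂ k = ℤₚ.drop‿+≤+ (begin
        + E is st k q4 (+ 0)            ≡⟨ trans (+-E is st k q4 (+ 0)) (Z.E-cong is st k +q4 (+ 0)) ⟩
        Z.E is st k quart (+ 0)         ≤⟨ E-step H quart (λ t → ℤₚ.≤-reflexive (lem₀ t C)) stepH k (+ 0) ⟩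
        + (n ^ k) *ᶻ H k (+ 0)          ≡⟨ cong (+ (n ^ k) *ᶻ_) (lem₁ (+ k) (+ c)) ⟩
        + (n ^ k) *ᶻ (+ 4 *ᶻ (+ k *ᶻ + k) *ᶻ (+ c *ᶻ + c *ᶻ (+ c *ᶻ + c))) ≡⟨ cong (+ (n ^ k) *ᶻ_) casts ⟩
        + (n ^ k) *ᶻ + (4 * (k * k) * (c * c * (c * c)))  ≡⟨ ℤₚ.pos-* (n ^ k) _ ⟨
        + (n ^ k * (4 * (k * k) * (c * c * (c * c)))) ∎)
      where
      open ℤₚ.≤-Reasoning
      C = + c *ᶻ + c
      quart : ℤ → ℤ
      quart t = (t *ᶻ t) *ᶻ (t *ᶻ t)
      H : ℕ → ℤ → ℤ
      H k t = (t *ᶻ t) *ᶻ (t *ᶻ t) +ᶻ + 8 *ᶻ + k *ᶻ C *ᶻ (t *ᶻ t) +ᶻ + 4 *ᶻ (+ k *ᶻ + k) *ᶻ (C *ᶻ C)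
      -- The 8 and the 4 in `H` come from `4tv³ ≤ 2t²v² + 2v⁴`: apart from terms linear in `v`, a
      -- step costs at most `8Ct² + 3C² + 8kC²`, and the increments of `8kCt²` and `4k²C²` are
      -- `8Ct²` and `(8k + 4)C²`.
      lem₀ : ∀ t C → (t *ᶻ t) *ᶻ (t *ᶻ t) ≡ (t *ᶻ t) *ᶻ (t *ᶻ t) +ᶻ + 8 *ᶻ + 0 *ᶻ C *ᶻ (t *ᶻ t) +ᶻ + 4 *ᶻ (+ 0 *ᶻ + 0) *ᶻ (C *ᶻ C)
      lem₀ = ZS.solve-∀
      lem₁ : ∀ k c → + 0 +ᶻ + 8 *ᶻ k *ᶻ (c *ᶻ c) *ᶻ + 0 +ᶻ + 4 *ᶻ (k *ᶻ k) *ᶻ ((c *ᶻ c) *ᶻ (c *ᶻ c)) ≡ + 4 *ᶻ (k *ᶻ k) *ᶻ (c *ᶻ c *ᶻ (c *ᶻ c))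
      lem₁ = ZS.solve-∀
      casts : + 4 *ᶻ (+ k *ᶻ + k) *ᶻ (+ c *ᶻ + c *ᶻ (+ c *ᶻ + c)) ≡ + (4 * (k * k) * (c * c * (c * c)))
      casts = sym (trans (ℤₚ.pos-* (4 * (k * k)) _) (cong₂ _*ᶻ_ (trans (ℤₚ.pos-* 4 (k * k)) (cong (+ 4 *ᶻ_) (ℤₚ.pos-* k k)))
                (trans (ℤₚ.pos-* (c * c) (c * c)) (cong₂ _*ᶻ_ (ℤₚ.pos-* c c) (ℤₚ.pos-* c c)))))
      v²≤ : ∀ i → i ∈ is → + 0 ≤ᶻ C -ᶻ v i *ᶻ v i
      v²≤ i i∈ = ℤₚ.i≤j⇒0≤j-i (subst₂ _≤ᶻ_ (+sq (v i)) (ℤₚ.pos-* c c) (ℤ.+≤+ (*-mono-≤ (h₂ i i∈) (h₂ i i∈))))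
      stepH : ∀ k t → Z.∑ is (λ i → H k (t +ᶻ v i)) ≤ᶻ + n *ᶻ H (suc k) t
      stepH k t = begin
        Z.∑ is (λ i → H k (t +ᶻ v i)) ≤⟨ ∑ᶻ-mono∈ is pointwise ⟩
        Z.∑ is (λ i → H (suc k) t +ᶻ lin *ᶻ v i) ≡⟨ affine (H (suc k) t) lin v ⟩
        + n *ᶻ H (suc k) t +ᶻ lin *ᶻ Z.∑ is v ≡⟨ cong (λ z → + n *ᶻ H (suc k) t +ᶻ lin *ᶻ z) h₁ ⟩
        + n *ᶻ H (suc k) t +ᶻ lin *ᶻ + 0 ≡⟨ trans (cong (+ n *ᶻ H (suc k) t +ᶻ_) (ℤₚ.*-zeroʳ lin)) (ℤₚ.+-identityʳ _) ⟩
        + n *ᶻ H (suc k) t ∎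
        where
        lin = + 4 *ᶻ (t *ᶻ t *ᶻ t) +ᶻ + 16 *ᶻ + k *ᶻ C *ᶻ t
        -- A positivity certificate: each term on the right is nonnegative once `v² ≤ C`. The part
        -- linear in `v` stays on the left, as it disappears on summation over the steps.
        ident : ∀ t v k C →
          ((t *ᶻ t) *ᶻ (t *ᶻ t) +ᶻ + 8 *ᶻ (+ 1 +ᶻ k) *ᶻ C *ᶻ (t *ᶻ t) +ᶻ + 4 *ᶻ ((+ 1 +ᶻ k) *ᶻ (+ 1 +ᶻ k)) *ᶻ (C *ᶻ C)
            +ᶻ (+ 4 *ᶻ (t *ᶻ t *ᶻ t) +ᶻ + 16 *ᶻ k *ᶻ C *ᶻ t) *ᶻ v)
          -ᶻ (((t +ᶻ v) *ᶻ (t +ᶻ v)) *ᶻ ((t +ᶻ v) *ᶻ (t +ᶻ v)) +ᶻ + 8 *ᶻ k *ᶻ C *ᶻ ((t +ᶻ v) *ᶻ (t +ᶻ v)) +ᶻ + 4 *ᶻ (k *ᶻ k) *ᶻ (C *ᶻ C))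
          ≡ (C -ᶻ v *ᶻ v) *ᶻ (+ 8 *ᶻ (t *ᶻ t) +ᶻ + 3 *ᶻ C +ᶻ + 3 *ᶻ (v *ᶻ v) +ᶻ + 8 *ᶻ (k *ᶻ C))
            +ᶻ + 2 *ᶻ ((v *ᶻ v) *ᶻ ((t -ᶻ v) *ᶻ (t -ᶻ v))) +ᶻ C *ᶻ C
        ident = ZS.solve-∀
        C≥0 : + 0 ≤ᶻ C
        C≥0 = sq≥0 (+ c)
        pos : ∀ m {x} → + 0 ≤ᶻ x → + 0 ≤ᶻ + m *ᶻ x
        pos m h = *-nonneg {+ m} (ℤ.+≤+ (z≤n {m})) h
        pointwise : ∀ i → i ∈ is → H k (t +ᶻ v i) ≤ᶻ H (suc k) t +ᶻ lin *ᶻ v i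
        pointwise i i∈ = ≤ᶻ-by _ (+-nonneg (+-nonneg (*-nonneg (v²≤ i i∈)
            (+-nonneg (+-nonneg (+-nonneg (pos 8 (sq≥0 t)) (pos 3 C≥0)) (pos 3 (sq≥0 (v i)))) (pos 8 (pos k C≥0))))
            (pos 2 (*-nonneg (sq≥0 (v i)) (sq≥0 (t -ᶻ v i))))) (*-nonneg C≥0 C≥0))
          (ident t (v i) (+ k) C)

  δ-hit : ∀ {X i} y → i < X → y +ᶻ + i ≡ + 0 → 1 ≤ ∑ (rng X) (λ i → δ (y +ᶻ + i))
  δ-hit {suc X} {i} y (s≤s h) eq with i ≟ X
  ... | yes refl = ≤-trans (≤-reflexive (sym (ind-yes ((y +ᶻ + i) ℤₚ.≟ + 0) eq))) (m≤m+n _ _)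
  ... | no  ne   = ≤-trans (δ-hit y (≤∧≢⇒< h ne) eq) (m≤n+m _ _)

  two-ab : ∀ a b → 2 * (a * b) ≤ a * a + b * b
  two-ab a b with ≤-total a b
  ... | inj₁ h = subst (λ b → 2 * (a * b) ≤ a * a + b * b) (m+[n∸m]≡n h) (≤-trans (m≤m+n _ ((b ∸ a) * (b ∸ a))) (≤-reflexive (lem a (b ∸ a))))
    where
    lem : ∀ a k → 2 * (a * (a + k)) + k * k ≡ a * a + (a + k) * (a + k)
    lem = NS.solve-∀
  ... | inj₂ h = subst (λ a → 2 * (a * b) ≤ a * a + b * b) (m+[n∸m]≡n h) (≤-trans (m≤m+n _ ((a ∸ b) * (a ∸ b))) (≤-reflexive (lem b (a ∸ b))))
    where
    lem : ∀ b k → 2 * ((b + k) * b) + k * k ≡ (b + k) * (b + k) + b * b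
    lem = NS.solve-∀

  sq-sum : ∀ a b → (a + b) * (a + b) ≤ 2 * (a * a + b * b)
  sq-sum a b = begin
    (a + b) * (a + b)                  ≡⟨ lem₁ a b ⟩
    2 * (a * b) + (a * a + b * b)      ≤⟨ +-monoˡ-≤ _ (two-ab a b) ⟩
    a * a + b * b + (a * a + b * b)    ≡⟨ cong (_+_ (a * a + b * b)) (sym (+-identityʳ _)) ⟩
    2 * (a * a + b * b) ∎
    where
    open ≤-Reasoning
    lem₁ : ∀ a b → (a + b) * (a + b) ≡ 2 * (a * b) + (a * a + b * b)
    lem₁ = NS.solve-∀

  sq-+ : ∀ x y → sq (x +ᶻ y) ≤ 2 * (sq x + sq y)
  sq-+ x y = ≤-trans (*-mono-≤ (ℤₚ.∣i+j∣≤∣i∣+∣j∣ x y) (ℤₚ.∣i+j∣≤∣i∣+∣j∣ x y)) (sq-sum (abs x) (abs y))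

  q4-+ : ∀ x y → q4 (x +ᶻ y) ≤ 8 * (q4 x + q4 y)
  q4-+ x y = begin
    q4 (x +ᶻ y)                                 ≤⟨ *-mono-≤ (sq-+ x y) (sq-+ x y) ⟩
    2 * (sq x + sq y) * (2 * (sq x + sq y))     ≡⟨ lem₁ (sq x) (sq y) ⟩
    4 * ((sq x + sq y) * (sq x + sq y))         ≤⟨ *-monoʳ-≤ 4 (sq-sum (sq x) (sq y)) ⟩
    4 * (2 * (q4 x + q4 y))                     ≡⟨ *-assoc 4 2 (q4 x + q4 y) ⟨
    8 * (q4 x + q4 y) ∎
    where
    open ≤-Reasoning
    lem₁ : ∀ a b → 2 * (a + b) * (2 * (a + b)) ≡ 4 * ((a + b) * (a + b))
    lem₁ = NS.solve-∀

  halve : ∀ q → ∃[ k ] ∃[ m ] q ≡ k * 2 + m × m ≤ 1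
  halve zero          = 0 , 0 , refl , z≤n
  halve (suc zero)    = 0 , 1 , refl , ≤-refl
  halve (suc (suc q)) with halve q
  ... | k , m , refl , h = suc k , m , refl , h

  +s : ℕ → ℤ
  +s i = + i

  abstract
    -- The factor of `r-bound` at `c = 8`; a walk through at least half of the coordinates has `k`
    -- pairs with `n ≤ 8 * k`.
    C₀ : ℕ
    C₀ = 4 + 512 * 8

    r-bound₈ : ∀ p e → 8 * e ≤ suc p → suc p ≤ 16 * e → ∀ k m {R} → R * R ≤ 8 * k → ∀ d →
               R * r (suc p) (suc (k * 2 + m)) d ≤ C₀ * suc p ^ (k * 2 + m)
    r-bound₈ p e h₁ h₂ k m {R} = Concentration.r-bound p e h₁ h₂ k m {R} {8}

  -- The price of conditioning on balance: `C₀` bounds the most likely partial sum from above, and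
  -- 12 comes from the lower bound `many-dice`.
  K : ℕ
  K = 12 * C₀

  -- e ≈ n / 8 and σ ≈ √n; a walk of n faces started at d₀ ends at 0 exactly when the die is balanced.
  record Scale (p : ℕ) : Set where
    field
      e σ : ℕ
      8e≤n  : 8 * e ≤ suc p
      n≤16e : suc p ≤ 16 * e
      σ²≤n  : σ * σ ≤ suc p
      n≤4σ² : suc p ≤ 4 * (σ * σ)
      16≤n  : 16 ≤ suc p
      d₀    : ℤ
      d₀≡   : d₀ +ᶻ d₀ ≡ Unimodal.c p (suc p)

  module Density {p : ℕ} (S : Scale p) where
    open Scale S public
    open Unimodal p
    n = suc p
    is = rng n

    -- the number of balanced dice
    N : ℕ
    N = r n n d₀

    1≤σ : 1 ≤ σ
    1≤σ = factor-pos σ σ (factor-pos 4 (σ * σ) (≤-trans (s≤s z≤n) n≤4σ²))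

    -- The face centred at its mean and doubled, since the mean `p / 2` need not be an integer.
    u : ℕ → ℤ
    u i = (+ i +ᶻ + i) -ᶻ + p

    ∑u : Z.∑ is u ≡ + 0
    ∑u = self-neg (trans (sym (Z.∑-reverse p (λ z → (z +ᶻ z) -ᶻ + p))) (trans (Z.∑-cong is (λ i → lem (+ p) (+ i))) (∑ᶻ-neg is u)))
      where
      lem : ∀ p i → ((p -ᶻ i) +ᶻ (p -ᶻ i)) -ᶻ p ≡ -ᶻ ((i +ᶻ i) -ᶻ p)
      lem = ZS.solve-∀
      self-neg : ∀ {x} → x ≡ -ᶻ x → x ≡ + 0
      self-neg {+ zero} eq = refl

    private
      -- With `n ≤ 4σ²` the factor 3 gives `W² = 9n²σ² ≥ 2n³`, so Chebyshev's inequality leaves at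
      -- least half of the walks within `W`.
      W = n * (3 * σ)

      double : ∀ d → sq d ≤ sq (d +ᶻ d)
      double (+ a)    = *-mono-≤ (m≤m+n a a) (m≤m+n a a)
      double -[1+ a ] = *-mono-≤ h h
        where
        h : suc a ≤ suc (suc (a + a))
        h = s≤s (≤-trans (m≤m+n a a) (n≤1+n _))

      pointwise : ∀ d → W * W ≤ W * W * ∑ (rng (2 * W)) (λ x → δ ((d -ᶻ + W) +ᶻ + x)) + sq (d +ᶻ d)
      pointwise d with abs d <? W
      ... | no  ≥W = ≤-trans (≤-trans (*-mono-≤ (≮⇒≥ ≥W) (≮⇒≥ ≥W)) (double d)) (m≤n+m _ _)
      ... | yes <W = ≤-trans (≤-trans (≤-reflexive (sym (*-identityʳ (W * W)))) (*-monoʳ-≤ (W * W) (hit d <W))) (m≤m+n _ _)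
        where
        hit : ∀ d → abs d < W → 1 ≤ ∑ (rng (2 * W)) (λ x → δ ((d -ᶻ + W) +ᶻ + x))
        hit (+ a) h = δ-hit {i = W ∸ a} (+ a -ᶻ + W) (≤-<-trans (m∸n≤m W a) (≤-trans (m<m+n W (≤-trans (s≤s z≤n) h)) (≤-reflexive (cong (_+_ W) (sym (+-identityʳ W))))))
            (trans (cong ((+ a -ᶻ + W) +ᶻ_) (trans (sym (ℤₚ.⊖-≥ (<⇒≤ h))) (sym (ℤₚ.m-n≡m⊖n W a)))) (lem (+ a) (+ W)))
          where
          lem : ∀ a W → (a -ᶻ W) +ᶻ (W -ᶻ a) ≡ + 0
          lem = ZS.solve-∀
        hit -[1+ a ] h = δ-hit {i = W + suc a} (-[1+ a ] -ᶻ + W) (≤-trans (+-monoʳ-< W h) (≤-reflexive (cong (_+_ W) (sym (+-identityʳ W)))))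
            (trans (cong ((-[1+ a ] -ᶻ + W) +ᶻ_) (ℤₚ.pos-+ W (suc a))) (lem (+ suc a) (+ W)))
          where
          lem : ∀ a W → (-ᶻ a -ᶻ W) +ᶻ (W +ᶻ a) ≡ + 0
          lem = ZS.solve-∀

      u²≤ : ∀ i → i ∈ is → u i *ᶻ u i ≤ᶻ + (n * n)
      u²≤ i i∈ = ≤ᶻ-by _ (+-nonneg (*-nonneg {+ (4 * i)} (ℤ.+≤+ z≤n) (ℤₚ.i≤j⇒0≤j-i (ℤ.+≤+ (s≤s⁻¹ (∈-rng i∈))))) (ℤ.+≤+ (z≤n {suc (2 * p)})))
          (trans (cong (_-ᶻ u i *ᶻ u i) (trans (ℤₚ.pos-* n n) (cong₂ _*ᶻ_ (ℤₚ.pos-+ 1 p) (ℤₚ.pos-+ 1 p))))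
                 (trans (lem (+ i) (+ p)) (sym (cong₂ (λ a b → a *ᶻ (+ p -ᶻ + i) +ᶻ b) (ℤₚ.pos-* 4 i) (trans (ℤₚ.pos-+ 1 (2 * p)) (cong (+ 1 +ᶻ_) (ℤₚ.pos-* 2 p)))))))
        where
        lem : ∀ i p → (+ 1 +ᶻ p) *ᶻ (+ 1 +ᶻ p) -ᶻ ((i +ᶻ i) -ᶻ p) *ᶻ ((i +ᶻ i) -ᶻ p) ≡ (+ 4 *ᶻ i) *ᶻ (p -ᶻ i) +ᶻ (+ 1 +ᶻ + 2 *ᶻ p)
        lem = ZS.solve-∀

      spread : E is st₁ n (λ d → sq (d +ᶻ d)) d₀ ≤ n ^ n * (n * (n * n))
      spread = begin
        E is st₁ n (λ d → sq (d +ᶻ d)) d₀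
          ≡⟨ E-project is st₁ _ (λ d → d +ᶻ d) (λ i d → lem d (+ i)) n sq d₀ ⟩
        E is (λ i t → t +ᶻ (+ i +ᶻ + i)) n sq (d₀ +ᶻ d₀)
          ≤⟨ second-moment is (λ i → + i +ᶻ + i) (+ p) (n * n) ∑u
               (ℤₚ.≤-trans (∑ᶻ-mono∈ is u²≤) (ℤₚ.≤-reflexive (∑ᶻ-const is (+ (n * n))))) n (d₀ +ᶻ d₀)
               (trans (cong₂ _+ᶻ_ d₀≡ (sym (ℤₚ.pos-* n p))) (ℤₚ.+-inverseˡ (+ (n * p)))) ⟩
        length is ^ n * (n * (n * n)) ≡⟨ cong (λ l → l ^ n * (n * (n * n))) (length-rng n) ⟩
        n ^ n * (n * (n * n)) ∎
        where
        open ≤-Reasoning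
        lem : ∀ d i → (d +ᶻ i) +ᶻ (d +ᶻ i) ≡ (d +ᶻ d) +ᶻ (i +ᶻ i)
        lem = ZS.solve-∀

      chebyshev : n ^ n * (W * W) ≤ W * W * (2 * W * N) + n ^ n * (n * (n * n))
      chebyshev = begin
        n ^ n * (W * W)                      ≡⟨ cong (λ l → l ^ n * (W * W)) (length-rng n) ⟨
        length is ^ n * (W * W)              ≡⟨ E-const is st₁ n (W * W) d₀ ⟨
        E is st₁ n (λ _ → W * W) d₀          ≤⟨ E-mono is st₁ n pointwise d₀ ⟩
        E is st₁ n (λ d → W * W * ∑ (rng (2 * W)) (λ x → δ ((d -ᶻ + W) +ᶻ + x)) + sq (d +ᶻ d)) d₀
          ≡⟨ trans (E-+ is st₁ n (λ d → W * W * ∑ (rng (2 * W)) (λ x → δ ((d -ᶻ + W) +ᶻ + x))) (λ d → sq (d +ᶻ d)) d₀)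
                   (cong (_+ E is st₁ n (λ d → sq (d +ᶻ d)) d₀)
                     (trans (E-*ˡ is st₁ n (W * W) (λ d → ∑ (rng (2 * W)) (λ x → δ ((d -ᶻ + W) +ᶻ + x))) d₀)
                            (cong (W * W *_) (E-∑ is st₁ (rng (2 * W)) n (λ x d → δ ((d -ᶻ + W) +ᶻ + x)) d₀)))) ⟩
        W * W * ∑ (rng (2 * W)) (λ x → E is st₁ n (λ d → δ ((d -ᶻ + W) +ᶻ + x)) d₀) + E is st₁ n (λ d → sq (d +ᶻ d)) d₀
          ≤⟨ +-mono-≤ (*-monoʳ-≤ (W * W) (≤-trans (∑-mono (rng (2 * W)) (λ x → ≤-trans (≤-reflexive
                (E-project is st₁ st₁ (λ d → (d -ᶻ + W) +ᶻ + x) (λ i d → lem d (+ W) (+ x) (+ i)) n δ d₀)) (r-max n d₀ d₀≡ ((d₀ -ᶻ + W) +ᶻ + x))))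
                (≤-reflexive (∑-rng-const (2 * W) N)))) spread ⟩
        W * W * (2 * W * N) + n ^ n * (n * (n * n)) ∎
        where
        open ≤-Reasoning
        lem : ∀ d W x i → ((d +ᶻ i) -ᶻ W) +ᶻ x ≡ ((d -ᶻ W) +ᶻ x) +ᶻ i
        lem = ZS.solve-∀

      W-large : 2 * (n * (n * n)) ≤ W * W
      W-large = begin
        2 * (n * (n * n))                ≤⟨ *-monoʳ-≤ 2 (*-monoˡ-≤ (n * n) n≤4σ²) ⟩
        2 * (4 * (σ * σ) * (n * n))      ≤⟨ m≤m+n _ (σ * σ * (n * n)) ⟩
        2 * (4 * (σ * σ) * (n * n)) + σ * σ * (n * n) ≡⟨ lem n σ ⟩
        W * W ∎
        where
        open ≤-Reasoning
        lem : ∀ n σ → 2 * (4 * (σ * σ) * (n * n)) + σ * σ * (n * n) ≡ n * (3 * σ) * (n * (3 * σ))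
        lem = NS.solve-∀

    -- At least half of all walks end within distance `W` of the centre, by Chebyshev, and by
    -- unimodality none of the `2 * W` end points receives more than the central count `N`.
    many-dice : n ^ n ≤ 12 * (n * σ) * N
    many-dice = *-cancelˡ-≤ (W * W) {{>-nonZero (*-mono-≤ {1} {W} {1} {W} 1≤W 1≤W)}} (+-cancelʳ-≤ (W * W * n ^ n) _ _ (begin
        W * W * n ^ n + W * W * n ^ n      ≡⟨ lem₁ W (n ^ n) ⟩
        2 * (n ^ n * (W * W))              ≤⟨ *-monoʳ-≤ 2 chebyshev ⟩
        2 * (W * W * (2 * W * N) + n ^ n * (n * (n * n)))   ≡⟨ lem₂ (W * W) W N (n ^ n) (n * (n * n)) ⟩
        W * W * (4 * W * N) + n ^ n * (2 * (n * (n * n)))   ≤⟨ +-monoʳ-≤ (W * W * (4 * W * N)) (*-monoʳ-≤ (n ^ n) W-large) ⟩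
        W * W * (4 * W * N) + n ^ n * (W * W)               ≡⟨ cong₂ _+_ (cong (λ z → W * W * (z * N)) (lem₃ n σ)) (*-comm (n ^ n) (W * W)) ⟩
        W * W * (12 * (n * σ) * N) + W * W * n ^ n ∎))
      where
      open ≤-Reasoning
      1≤W : 1 ≤ W
      1≤W = *-mono-≤ {1} {n} {1} {3 * σ} (s≤s z≤n) (*-mono-≤ {1} {3} {1} {σ} (s≤s z≤n) 1≤σ)
      lem₁ : ∀ W X → W * W * X + W * W * X ≡ 2 * (X * (W * W))
      lem₁ = NS.solve-∀
      lem₂ : ∀ Q W N X Y → 2 * (Q * (2 * W * N) + X * Y) ≡ Q * (4 * W * N) + X * (2 * Y)
      lem₂ = NS.solve-∀
      lem₃ : ∀ n σ → 4 * (n * (3 * σ)) ≡ 12 * (n * σ)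
      lem₃ = NS.solve-∀

    -- Whatever the other faces are, they can be completed to a balanced die by at most `K` times
    -- the average number of ways. Hence the law of up to half of the coordinates of a balanced die
    -- has density at most `K` against independent faces.
    completions : ∀ n₁ n₂ → n₁ + n₂ ≡ n → n ≤ 2 * n₁ + 1 → ∀ d → r n n₁ d * n ^ n₂ ≤ K * N
    completions zero n₂ eq (s≤s p≤0) d = ⊥-elim (<⇒≱ 16≤n (≤-trans (s≤s p≤0) (s≤s z≤n)))
    completions (suc q) n₂ eq h d with halve q
    ... | k , m , refl , m≤1 = *-cancelˡ-≤ (σ * n) {{>-nonZero (*-mono-≤ {1} {σ} {1} {n} 1≤σ (s≤s z≤n))}} (begin
        σ * n * (r n (suc (k * 2 + m)) d * n ^ n₂)   ≡⟨ lem₁ σ n (r n (suc (k * 2 + m)) d) (n ^ n₂) ⟩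
        σ * r n (suc (k * 2 + m)) d * (n * n ^ n₂)   ≤⟨ *-monoˡ-≤ (n * n ^ n₂) (r-bound₈ p e 8e≤n n≤16e k m {σ} (≤-trans σ²≤n n≤8k) d) ⟩
        C * n ^ (k * 2 + m) * (n * n ^ n₂)           ≡⟨ lem₂ C (n ^ (k * 2 + m)) n (n ^ n₂) ⟩
        C * (n * n ^ (k * 2 + m) * n ^ n₂)           ≡⟨ cong (C *_) (trans (sym (^-distribˡ-+-* n (suc (k * 2 + m)) n₂)) (cong (n ^_) eq)) ⟩
        C * n ^ n                                    ≤⟨ *-monoʳ-≤ C many-dice ⟩
        C * (12 * (n * σ) * N)                       ≡⟨ lem₃ C n σ N ⟩
        σ * n * (12 * C * N) ∎)
      where
      open ≤-Reasoning
      C = C₀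
      lem₁ : ∀ σ n r x → σ * n * (r * x) ≡ σ * r * (n * x)
      lem₁ = NS.solve-∀
      lem₂ : ∀ C x n y → C * x * (n * y) ≡ C * (n * x * y)
      lem₂ = NS.solve-∀
      lem₃ : ∀ C n σ N → C * (12 * (n * σ) * N) ≡ σ * n * (12 * C * N)
      lem₃ = NS.solve-∀
      n≤4k+5 : n ≤ 4 * k + 5
      n≤4k+5 = ≤-trans h (≤-trans (+-monoˡ-≤ 1 (*-monoʳ-≤ 2 (s≤s (+-monoʳ-≤ (k * 2) m≤1)))) (≤-reflexive (lem k)))
        where
        lem : ∀ k → 2 * suc (k * 2 + 1) + 1 ≡ 4 * k + 5
        lem = NS.solve-∀
      2≤k : ∀ k → 16 ≤ 4 * k + 5 → 2 ≤ k
      2≤k zero          (s≤s (s≤s (s≤s (s≤s (s≤s ())))))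
      2≤k (suc zero)    (s≤s (s≤s (s≤s (s≤s (s≤s (s≤s (s≤s (s≤s (s≤s ())))))))))
      2≤k (suc (suc k)) _ = s≤s (s≤s z≤n)
      n≤8k : n ≤ 8 * k
      n≤8k = ≤-trans n≤4k+5 (≤-trans (+-monoʳ-≤ (4 * k) (≤-trans (m≤m+n 5 3) (*-monoʳ-≤ 4 (2≤k k (≤-trans 16≤n n≤4k+5))))) (≤-reflexive (lem k)))
        where
        lem : ∀ k → 4 * k + 4 * k ≡ 8 * k
        lem = NS.solve-∀

    module _ (v : ℕ → ℤ) (f : ℤ → ℕ) where
      private
        st = step v +s
        stᵥ : ℕ → ℤ → ℤ
        stᵥ i t = t +ᶻ v i

      -- A nonnegative statistic of the first `n₁` coordinates is averaged over balanced dice at the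
      -- cost of a factor `K`, as the completing half only enters through its number of completions.
      E-density-first : ∀ n₁ n₂ {b} → n₂ + n₁ ≡ n → n ≤ 2 * n₂ + 1 → E is stᵥ n₁ f (+ 0) ≤ n ^ n₁ * b →
        E is st n₁ (λ y → f (proj₁ y) * r n n₂ (proj₂ y)) (+ 0 , d₀) ≤ K * N * b
      E-density-first n₁ n₂ {b} eq h fb = *-cancelˡ-≤ (n ^ n₁) {{m^n≢0 n n₁}} (begin
          n ^ n₁ * E is st n₁ (λ y → f (proj₁ y) * r n n₂ (proj₂ y)) (+ 0 , d₀)
            ≡⟨ E-*ˡ is st n₁ (n ^ n₁) _ (+ 0 , d₀) ⟨
          E is st n₁ (λ y → n ^ n₁ * (f (proj₁ y) * r n n₂ (proj₂ y))) (+ 0 , d₀)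
            ≤⟨ E-mono is st n₁ (λ y → ≤-trans (≤-reflexive (lem (n ^ n₁) (f (proj₁ y)) (r n n₂ (proj₂ y)))) (*-monoˡ-≤ (f (proj₁ y)) (completions n₂ n₁ eq h (proj₂ y)))) (+ 0 , d₀) ⟩
          E is st n₁ (λ y → K * N * f (proj₁ y)) (+ 0 , d₀)
            ≡⟨ E-*ˡ is st n₁ (K * N) (λ y → f (proj₁ y)) (+ 0 , d₀) ⟩
          K * N * E is st n₁ (λ y → f (proj₁ y)) (+ 0 , d₀)
            ≡⟨ cong (K * N *_) (E-project is st stᵥ proj₁ (λ _ _ → refl) n₁ f (+ 0 , d₀)) ⟩
          K * N * E is stᵥ n₁ f (+ 0) ≤⟨ *-monoʳ-≤ (K * N) fb ⟩
          K * N * (n ^ n₁ * b) ≡⟨ lem₂ (K * N) (n ^ n₁) b ⟩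
          n ^ n₁ * (K * N * b) ∎)
        where
        open ≤-Reasoning
        lem : ∀ x f r → x * (f * r) ≡ r * x * f
        lem = NS.solve-∀
        lem₂ : ∀ k x b → k * (x * b) ≡ x * (k * b)
        lem₂ = NS.solve-∀

      -- The order of the coordinates is immaterial: Fubini lets the first `n₁` faces play the
      -- completing half.
      E-density-second : ∀ n₁ n₂ {b} → n₁ + n₂ ≡ n → n ≤ 2 * n₁ + 1 → E is stᵥ n₂ f (+ 0) ≤ n ^ n₂ * b →
        E is st n₁ (λ y → E is st n₂ (λ y → f (proj₁ y) * δ (proj₂ y)) (+ 0 , proj₂ y)) (+ 0 , d₀) ≤ K * N * b
      E-density-second n₁ n₂ {b} eq h fb = begin
        E is st n₁ (λ y → E is st n₂ (λ y → f (proj₁ y) * δ (proj₂ y)) (+ 0 , proj₂ y)) (+ 0 , d₀)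
          ≡⟨ E-project is st st₁ proj₂ (λ _ _ → refl) n₁ (λ d → E is st n₂ (λ y → f (proj₁ y) * δ (proj₂ y)) (+ 0 , d)) (+ 0 , d₀) ⟩
        E is st₁ n₁ (λ d → E is st n₂ (λ y → f (proj₁ y) * δ (proj₂ y)) (+ 0 , d)) d₀
          ≡⟨ E-cong is st₁ n₁ (λ d → E-shift-d is v +s n₂ _ (+ 0) d) d₀ ⟩
        E is st₁ n₁ (λ d → E is st n₂ (λ y → f (proj₁ y) * δ (d +ᶻ proj₂ y)) (+ 0 , + 0)) d₀
          ≡⟨ E-fubini is st₁ is st n₁ n₂ (λ d y → f (proj₁ y) * δ (d +ᶻ proj₂ y)) d₀ (+ 0 , + 0) ⟩
        E is st n₂ (λ y → E is st₁ n₁ (λ d → f (proj₁ y) * δ (d +ᶻ proj₂ y)) d₀) (+ 0 , + 0)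
          ≡⟨ E-cong is st n₂ (λ y → trans (E-*ˡ is st₁ n₁ (f (proj₁ y)) _ d₀) (cong (f (proj₁ y) *_)
               (E-project is st₁ st₁ (_+ᶻ proj₂ y) (λ i d → lem d (+ i) (proj₂ y)) n₁ δ d₀))) (+ 0 , + 0) ⟩
        E is st n₂ (λ y → f (proj₁ y) * r n n₁ (d₀ +ᶻ proj₂ y)) (+ 0 , + 0)
          ≡⟨ E-shift-d is v +s n₂ (λ y → f (proj₁ y) * r n n₁ (proj₂ y)) (+ 0) d₀ ⟨
        E is st n₂ (λ y → f (proj₁ y) * r n n₁ (proj₂ y)) (+ 0 , d₀)
          ≤⟨ E-density-first n₂ n₁ eq h fb ⟩
        K * N * b ∎
        where
        open ≤-Reasoning
        lem : ∀ d i x → (d +ᶻ i) +ᶻ x ≡ (d +ᶻ x) +ᶻ i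
        lem = ZS.solve-∀

    -- The density bound covers only half of the coordinates at a time, so the sum is cut in two and
    -- `(x + y)⁴ ≤ 8(x⁴ + y⁴)` is used; 64 is 8 for this, 2 halves and the 4 of `fourth-moment`.
    balanced-fourth-moment : ∀ (v : ℕ → ℤ) c → Z.∑ is v ≡ + 0 → (∀ i → i ∈ is → abs (v i) ≤ c) →
      E is (step v +s) n (λ y → q4 (proj₁ y) * δ (proj₂ y)) (+ 0 , d₀) ≤ 64 * K * (N * (n * n * (c * c * (c * c))))
    balanced-fourth-moment v c h₁ h₂ = begin
        E is st n F (+ 0 , d₀)         ≡⟨ cong (λ l → E is st l F (+ 0 , d₀)) n≡ ⟨
        E is st (a + b) F (+ 0 , d₀)   ≡⟨ E-add is st a b F (+ 0 , d₀) ⟩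
        E is st a (E is st b F) (+ 0 , d₀) ≤⟨ E-mono is st a (λ y → split (proj₁ y) (proj₂ y)) (+ 0 , d₀) ⟩
        E is st a (λ y → 8 * (q4 (proj₁ y) * r n b (proj₂ y) + E is st b F (+ 0 , proj₂ y))) (+ 0 , d₀)
          ≡⟨ trans (E-*ˡ is st a 8 _ (+ 0 , d₀)) (cong (8 *_) (E-+ is st a (λ y → q4 (proj₁ y) * r n b (proj₂ y)) (λ y → E is st b F (+ 0 , proj₂ y)) (+ 0 , d₀))) ⟩
        8 * (E is st a (λ y → q4 (proj₁ y) * r n b (proj₂ y)) (+ 0 , d₀) + E is st a (λ y → E is st b F (+ 0 , proj₂ y)) (+ 0 , d₀))
          ≤⟨ *-monoʳ-≤ 8 (+-mono-≤ (E-density-first v q4 a b (trans (+-comm b a) n≡) b-large (moment a (m+n≤o⇒m≤o a (≤-reflexive n≡))))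
                                   (E-density-second v q4 a b n≡ a-large (moment b (m+n≤o⇒n≤o a (≤-reflexive n≡))))) ⟩
        8 * (K * N * X + K * N * X) ≡⟨ lem K N (n * n) (c * c * (c * c)) ⟩
        64 * K * (N * (n * n * (c * c * (c * c)))) ∎
      where
      open ≤-Reasoning
      st = step v +s
      F : ℤ × ℤ → ℕ
      F y = q4 (proj₁ y) * δ (proj₂ y)
      X = 4 * (n * n) * (c * c * (c * c))
      a = ⌊ n /2⌋
      b = ⌈ n /2⌉
      n≡ : a + b ≡ n
      n≡ = ⌊n/2⌋+⌈n/2⌉≡n n
      a≤b : a ≤ b
      a≤b = ⌊n/2⌋≤⌈n/2⌉ n
      a-large : n ≤ 2 * a + 1
      a-large = ≤-trans (proj₂ (⌊/2⌋-double n)) (≤-reflexive (trans (+-comm 1 (a + a)) (cong (λ z → a + z + 1) (sym (+-identityʳ a)))))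
      b-large : n ≤ 2 * b + 1
      b-large = ≤-trans a-large (+-monoˡ-≤ 1 (*-monoʳ-≤ 2 a≤b))
      moment : ∀ k → k ≤ n → E is (λ i t → t +ᶻ v i) k q4 (+ 0) ≤ n ^ k * X
      moment k k≤n = ≤-trans (fourth-moment is v c h₁ h₂ k) (subst (λ l → l ^ k * (4 * (k * k) * (c * c * (c * c))) ≤ n ^ k * X) (sym (length-rng n))
        (*-monoʳ-≤ (n ^ k) (*-monoˡ-≤ (c * c * (c * c)) (*-monoʳ-≤ 4 (*-mono-≤ k≤n k≤n)))))
      lem : ∀ K N m x → 8 * (K * N * (4 * m * x) + K * N * (4 * m * x)) ≡ 64 * K * (N * (m * x))
      lem = NS.solve-∀
      split : ∀ t d → E is st b F (t , d) ≤ 8 * (q4 t * r n b d + E is st b F (+ 0 , d))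
      split t d = begin
        E is st b F (t , d) ≡⟨ E-shift-t is v +s b F t d ⟩
        E is st b (λ y → q4 (t +ᶻ proj₁ y) * δ (proj₂ y)) (+ 0 , d)
          ≤⟨ E-mono is st b (λ y → ≤-trans (*-monoˡ-≤ (δ (proj₂ y)) (q4-+ t (proj₁ y))) (≤-reflexive (lem′ (q4 t) (q4 (proj₁ y)) (δ (proj₂ y))))) (+ 0 , d) ⟩
        E is st b (λ y → 8 * (q4 t * δ (proj₂ y) + F y)) (+ 0 , d)
          ≡⟨ trans (E-*ˡ is st b 8 _ (+ 0 , d)) (cong (8 *_) (trans (E-+ is st b (λ y → q4 t * δ (proj₂ y)) F (+ 0 , d))
               (cong (_+ E is st b F (+ 0 , d)) (trans (E-*ˡ is st b (q4 t) (λ y → δ (proj₂ y)) (+ 0 , d)) (cong (q4 t *_) (E-project is st st₁ proj₂ (λ _ _ → refl) b δ (+ 0 , d))))))) ⟩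
        8 * (q4 t * r n b d + E is st b F (+ 0 , d)) ∎
        where
        lem′ : ∀ x y z → 8 * (x + y) * z ≡ 8 * (x * z + y * z)
        lem′ = NS.solve-∀

  -- Symmetric Taylor expansion and smoothing

  Δ : (ℤ → ℤ) → ℤ → ℤ
  Δ f x = f (x +ᶻ + 1) -ᶻ f x

  _≼_ : (ℤ → ℤ) → ℕ → Set
  f ≼ M = ∀ x → abs (f x) ≤ M

  infix 4 _≼_

  abs-+ : ∀ {x y z a b} → z ≡ x +ᶻ y → abs x ≤ a → abs y ≤ b → abs z ≤ a + b
  abs-+ {x} {y} refl h₁ h₂ = ≤-trans (ℤₚ.∣i+j∣≤∣i∣+∣j∣ x y) (+-mono-≤ h₁ h₂)

  abs-* : ∀ x y {a b} → abs x ≤ a → abs y ≤ b → abs (x *ᶻ y) ≤ a * b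
  abs-* x y h₁ h₂ = ≤-trans (≤-reflexive (ℤₚ.abs-* x y)) (*-mono-≤ h₁ h₂)

  lipschitz : ∀ f {M} → Δ f ≼ M → ∀ x s → abs (f (x +ᶻ + s) -ᶻ f x) ≤ s * M
  lipschitz f h x zero    = ≤-reflexive (cong abs (trans (cong (λ z → f z -ᶻ f x) (ℤₚ.+-identityʳ x)) (ℤₚ.+-inverseʳ (f x))))
  lipschitz f {M} h x (suc s) = abs-+ {Δ f (x +ᶻ + s)} {f (x +ᶻ + s) -ᶻ f x} (trans (cong (λ z → f z -ᶻ f x) (pt x (+ s))) (lem (f ((x +ᶻ + s) +ᶻ + 1)) (f (x +ᶻ + s)) (f x)))
                                    (h (x +ᶻ + s)) (lipschitz f h x s)
    where
    pt : ∀ x s → x +ᶻ (+ 1 +ᶻ s) ≡ (x +ᶻ s) +ᶻ + 1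
    pt = ZS.solve-∀
    lem : ∀ a b c → a -ᶻ c ≡ (a -ᶻ b) +ᶻ (b -ᶻ c)
    lem = ZS.solve-∀

  lipschitz-at : ∀ f {M} → Δ f ≼ M → ∀ x {z} s → z ≡ x +ᶻ + s → abs (f z -ᶻ f x) ≤ s * M
  lipschitz-at f h x s refl = lipschitz f h x s

  -- Widening `s` by one compares two first differences at distance `2 * s + 1`, and these odd
  -- numbers add up to a square.
  symmetric-sum : ∀ f {M} → Δ (Δ f) ≼ M → ∀ a s → abs (f (a +ᶻ + s) +ᶻ f (a -ᶻ + s) -ᶻ + 2 *ᶻ f a) ≤ s * s * M
  symmetric-sum f h a zero = ≤-reflexive (cong abs (trans (cong₂ (λ u v → f u +ᶻ f v -ᶻ + 2 *ᶻ f a) (ℤₚ.+-identityʳ a) (ℤₚ.+-identityʳ a)) (lem (f a))))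
    where
    lem : ∀ x → x +ᶻ x -ᶻ + 2 *ᶻ x ≡ + 0
    lem = ZS.solve-∀
  symmetric-sum f {M} h a (suc s) = ≤-trans
      (abs-+ {f (a +ᶻ + s) +ᶻ f (a -ᶻ + s) -ᶻ + 2 *ᶻ f a} {Δ f (a +ᶻ + s) -ᶻ Δ f (a -ᶻ + suc s)} (trans (cong (λ z → f z +ᶻ f (a -ᶻ + suc s) -ᶻ + 2 *ᶻ f a) (pt a (+ s)))
                    (trans (lem (f ((a +ᶻ + s) +ᶻ + 1)) (f (a -ᶻ + suc s)) (f a) (f (a +ᶻ + s)) (f (a -ᶻ + s)))
                           (cong (λ z → f (a +ᶻ + s) +ᶻ f (a -ᶻ + s) -ᶻ + 2 *ᶻ f a +ᶻ (Δ f (a +ᶻ + s) -ᶻ (f z -ᶻ f (a -ᶻ + suc s)))) (pt₂ a (+ s)))))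
             (symmetric-sum f h a s) (lipschitz-at (Δ f) h (a -ᶻ + suc s) (suc (2 * s)) (trans (pt₃ a (+ s)) (cong (λ z → (a -ᶻ + suc s) +ᶻ (+ 1 +ᶻ z)) (sym (ℤₚ.pos-* 2 s))))))
      (≤-reflexive (ar s M))
    where
    pt : ∀ x s → x +ᶻ (+ 1 +ᶻ s) ≡ (x +ᶻ s) +ᶻ + 1
    pt = ZS.solve-∀
    pt₂ : ∀ x s → x -ᶻ s ≡ (x -ᶻ (+ 1 +ᶻ s)) +ᶻ + 1
    pt₂ = ZS.solve-∀
    pt₃ : ∀ x s → x +ᶻ s ≡ (x -ᶻ (+ 1 +ᶻ s)) +ᶻ (+ 1 +ᶻ + 2 *ᶻ s)
    pt₃ = ZS.solve-∀
    lem : ∀ a b c d e → a +ᶻ b -ᶻ + 2 *ᶻ c ≡ d +ᶻ e -ᶻ + 2 *ᶻ c +ᶻ ((a -ᶻ d) -ᶻ (e -ᶻ b))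
    lem = ZS.solve-∀
    ar : ∀ s M → s * s * M + suc (2 * s) * M ≡ suc s * suc s * M
    ar = NS.solve-∀

  -- The centre is `a - 1/2`: the two first differences at the ends of a symmetric difference about
  -- `a` start at `a + s` and `a - 1 - s`.
  half-symmetric-sum : ∀ g {M} → Δ (Δ g) ≼ M → ∀ a s →
    abs ((g (a +ᶻ + s) +ᶻ g (a -ᶻ + 1 -ᶻ + s)) -ᶻ (g a +ᶻ g (a -ᶻ + 1))) ≤ s * suc s * M
  half-symmetric-sum g h a zero = ≤-reflexive (cong abs (trans (cong₂ (λ u v → (g u +ᶻ g v) -ᶻ (g a +ᶻ g (a -ᶻ + 1))) (ℤₚ.+-identityʳ a) (ℤₚ.+-identityʳ (a -ᶻ + 1))) (ℤₚ.+-inverseʳ (g a +ᶻ g (a -ᶻ + 1)))))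
  half-symmetric-sum g {M} h a (suc s) = ≤-trans
      (abs-+ {(g (a +ᶻ + s) +ᶻ g (a -ᶻ + 1 -ᶻ + s)) -ᶻ (g a +ᶻ g (a -ᶻ + 1))} {Δ g (a +ᶻ + s) -ᶻ Δ g (a -ᶻ + 1 -ᶻ + suc s)} (trans (cong (λ z → (g z +ᶻ g (a -ᶻ + 1 -ᶻ + suc s)) -ᶻ (g a +ᶻ g (a -ᶻ + 1))) (pt a (+ s)))
                    (trans (lem (g ((a +ᶻ + s) +ᶻ + 1)) (g (a -ᶻ + 1 -ᶻ + suc s)) (g a +ᶻ g (a -ᶻ + 1)) (g (a +ᶻ + s)) (g (a -ᶻ + 1 -ᶻ + s)))
                           (cong (λ z → ((g (a +ᶻ + s) +ᶻ g (a -ᶻ + 1 -ᶻ + s)) -ᶻ (g a +ᶻ g (a -ᶻ + 1))) +ᶻ (Δ g (a +ᶻ + s) -ᶻ (g z -ᶻ g (a -ᶻ + 1 -ᶻ + suc s)))) (pt₂ a (+ s)))))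
             (half-symmetric-sum g h a s) (lipschitz-at (Δ g) h (a -ᶻ + 1 -ᶻ + suc s) (2 * s + 2) (trans (pt₃ a (+ s)) (cong ((a -ᶻ + 1 -ᶻ + suc s) +ᶻ_) (sym (trans (ℤₚ.pos-+ (2 * s) 2) (cong (_+ᶻ + 2) (ℤₚ.pos-* 2 s))))))))
      (≤-reflexive (ar s M))
    where
    pt : ∀ x s → x +ᶻ (+ 1 +ᶻ s) ≡ (x +ᶻ s) +ᶻ + 1
    pt = ZS.solve-∀
    pt₂ : ∀ x s → x -ᶻ + 1 -ᶻ s ≡ (x -ᶻ + 1 -ᶻ (+ 1 +ᶻ s)) +ᶻ + 1
    pt₂ = ZS.solve-∀
    pt₃ : ∀ x s → x +ᶻ s ≡ (x -ᶻ + 1 -ᶻ (+ 1 +ᶻ s)) +ᶻ (+ 2 *ᶻ s +ᶻ + 2)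
    pt₃ = ZS.solve-∀
    lem : ∀ a b c d e → (a +ᶻ b) -ᶻ c ≡ ((d +ᶻ e) -ᶻ c) +ᶻ ((a -ᶻ d) -ᶻ (e -ᶻ b))
    lem = ZS.solve-∀
    ar : ∀ s M → s * suc s * M + (2 * s + 2) * M ≡ suc s * suc (suc s) * M
    ar = NS.solve-∀

  -- Each widening deviates from the central increment by a half-integer symmetric sum of `Δ f`, so
  -- the second differences of `Δ f` control it; the resulting sum of `s * suc s` is rounded up to a
  -- cube.
  symmetric-difference : ∀ f {M} → Δ (Δ (Δ f)) ≼ M → ∀ a s →
    abs (f (a +ᶻ + s) -ᶻ f (a -ᶻ + s) -ᶻ + s *ᶻ (f (a +ᶻ + 1) -ᶻ f (a -ᶻ + 1))) ≤ s * s * s * M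
  symmetric-difference f h a zero = ≤-reflexive (cong abs (trans (cong₂ (λ u v → f u -ᶻ f v -ᶻ + 0 *ᶻ D) (ℤₚ.+-identityʳ a) (ℤₚ.+-identityʳ a)) (lem (f a) D)))
    where
    D = f (a +ᶻ + 1) -ᶻ f (a -ᶻ + 1)
    lem : ∀ x D → x -ᶻ x -ᶻ + 0 *ᶻ D ≡ + 0
    lem = ZS.solve-∀
  symmetric-difference f {M} h a (suc s) = ≤-trans
      (abs-+ {f (a +ᶻ + s) -ᶻ f (a -ᶻ + s) -ᶻ + s *ᶻ o₁} {(Δ f (a +ᶻ + s) +ᶻ Δ f (a -ᶻ + 1 -ᶻ + s)) -ᶻ (Δ f a +ᶻ Δ f (a -ᶻ + 1))} eq (symmetric-difference f h a s) (half-symmetric-sum (Δ f) h a s))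
      (≤-trans (m≤m+n _ ((2 * (s * s) + 2 * s + 1) * M)) (≤-reflexive (ar s M)))
    where
    pt : ∀ x s → x +ᶻ (+ 1 +ᶻ s) ≡ (x +ᶻ s) +ᶻ + 1
    pt = ZS.solve-∀
    pt₂ : ∀ x s → x -ᶻ (+ 1 +ᶻ s) ≡ x -ᶻ + 1 -ᶻ s
    pt₂ = ZS.solve-∀
    pt₃ : ∀ x s → x -ᶻ s ≡ (x -ᶻ + 1 -ᶻ s) +ᶻ + 1
    pt₃ = ZS.solve-∀
    pt₄ : ∀ x → x ≡ (x -ᶻ + 1) +ᶻ + 1
    pt₄ = ZS.solve-∀
    lem : ∀ a b c d s D₁ D₂ m → a -ᶻ b -ᶻ (+ 1 +ᶻ s) *ᶻ (D₁ -ᶻ D₂) ≡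
          (c -ᶻ d -ᶻ s *ᶻ (D₁ -ᶻ D₂)) +ᶻ (((a -ᶻ c) +ᶻ (d -ᶻ b)) -ᶻ ((D₁ -ᶻ m) +ᶻ (m -ᶻ D₂)))
    lem = ZS.solve-∀
    o₁ = f (a +ᶻ + 1) -ᶻ f (a -ᶻ + 1)
    eq : f (a +ᶻ + suc s) -ᶻ f (a -ᶻ + suc s) -ᶻ + suc s *ᶻ o₁ ≡
         (f (a +ᶻ + s) -ᶻ f (a -ᶻ + s) -ᶻ + s *ᶻ o₁) +ᶻ ((Δ f (a +ᶻ + s) +ᶻ Δ f (a -ᶻ + 1 -ᶻ + s)) -ᶻ (Δ f a +ᶻ Δ f (a -ᶻ + 1)))
    eq = trans (cong₂ (λ u v → f u -ᶻ f v -ᶻ + suc s *ᶻ o₁) (pt a (+ s)) (pt₂ a (+ s)))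
         (trans (lem (f ((a +ᶻ + s) +ᶻ + 1)) (f (a -ᶻ + 1 -ᶻ + s)) (f (a +ᶻ + s)) (f (a -ᶻ + s)) (+ s) (f (a +ᶻ + 1)) (f (a -ᶻ + 1)) (f a))
         (cong₂ (λ u v → (f (a +ᶻ + s) -ᶻ f (a -ᶻ + s) -ᶻ + s *ᶻ o₁) +ᶻ ((Δ f (a +ᶻ + s) +ᶻ (f u -ᶻ f (a -ᶻ + 1 -ᶻ + s))) -ᶻ (Δ f a +ᶻ (f v -ᶻ f (a -ᶻ + 1)))))
                (pt₃ a (+ s)) (pt₄ a)))
    ar : ∀ s M → s * s * s * M + s * suc s * M + (2 * (s * s) + 2 * s + 1) * M ≡ suc s * suc s * suc s * M
    ar = NS.solve-∀

  symmetric-sumᶻ : ∀ f {M} → Δ (Δ f) ≼ M → ∀ a s → abs (f (a +ᶻ s) +ᶻ f (a -ᶻ s) -ᶻ + 2 *ᶻ f a) ≤ abs s * abs s * M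
  symmetric-sumᶻ f h a (+ s)    = symmetric-sum f h a s
  symmetric-sumᶻ f {M} h a -[1+ s ] = subst (λ z → abs (z -ᶻ + 2 *ᶻ f a) ≤ suc s * suc s * M) (ℤₚ.+-comm (f (a +ᶻ + suc s)) _) (symmetric-sum f h a (suc s))

  symmetric-differenceᶻ : ∀ f {M} → Δ (Δ (Δ f)) ≼ M → ∀ a s →
    abs (f (a +ᶻ s) -ᶻ f (a -ᶻ s) -ᶻ s *ᶻ (f (a +ᶻ + 1) -ᶻ f (a -ᶻ + 1))) ≤ abs s * abs s * abs s * M
  symmetric-differenceᶻ f h a (+ s)    = symmetric-difference f h a s
  symmetric-differenceᶻ f {M} h a -[1+ s ] = subst (_≤ suc s * suc s * suc s * M)
      (trans (sym (ℤₚ.∣-i∣≡∣i∣ (f (a +ᶻ + suc s) -ᶻ f (a -ᶻ + suc s) -ᶻ + suc s *ᶻ (f (a +ᶻ + 1) -ᶻ f (a -ᶻ + 1))))) (cong abs (lem (f (a +ᶻ + suc s)) (f (a -ᶻ + suc s)) (+ suc s) (f (a +ᶻ + 1) -ᶻ f (a -ᶻ + 1)))))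
      (symmetric-difference f h a (suc s))
    where
    lem : ∀ a b s d → -ᶻ (a -ᶻ b -ᶻ s *ᶻ d) ≡ b -ᶻ a -ᶻ (-ᶻ s) *ᶻ d
    lem = ZS.solve-∀

  record Smooth (f : ℤ → ℤ) (M₀ M₁ M₂ M₃ : ℕ) : Set where
    field
      bound₀ : f ≼ M₀
      bound₁ : Δ f ≼ M₁
      bound₂ : Δ (Δ f) ≼ M₂
      bound₃ : Δ (Δ (Δ f)) ≼ M₃

  -- Δ (B f) is controlled by f itself, so B³ f has three bounded differences.
  module Smoothing (B : (ℤ → ℤ) → ℤ → ℤ) (A D : ℕ)
                   (B-bound : ∀ {f M} → f ≼ M → B f ≼ A * M)
                   (ΔB-bound : ∀ {f M} → f ≼ M → Δ (B f) ≼ D * M)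
                   (ΔB : ∀ f x → Δ (B f) x ≡ B (Δ f) x)
                   (B-cong : ∀ {f g} → (∀ x → f x ≡ g x) → ∀ x → B f x ≡ B g x) where

    private
      _≼≡_ : ∀ {f g M} → g ≼ M → (∀ x → f x ≡ g x) → f ≼ M
      (h ≼≡ eq) x = subst (λ z → abs z ≤ _) (sym (eq x)) (h x)
      Δ-cong : ∀ {f g} → (∀ x → f x ≡ g x) → ∀ x → Δ f x ≡ Δ g x
      Δ-cong h x = cong₂ _-ᶻ_ (h (x +ᶻ + 1)) (h x)

    smooth : ∀ {f M} → f ≼ M → Smooth (B (B (B f))) (A * (A * (A * M))) (D * (A * (A * M))) (D * (D * (A * M))) (D * (D * (D * M)))
    smooth {f} h = record
      { bound₀ = B-bound (B-bound (B-bound h))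
      ; bound₁ = ΔB-bound (B-bound (B-bound h))
      ; bound₂ = ΔB-bound (ΔB-bound (B-bound h)) ≼≡ Δ-cong (ΔB (B (B f)))
      ; bound₃ = ΔB-bound (ΔB-bound (ΔB-bound h)) ≼≡ (λ x → trans (Δ-cong (Δ-cong (ΔB (B (B f)))) x)
                   (Δ-cong (λ x → trans (ΔB (Δ (B (B f))) x) (B-cong (Δ-cong (ΔB (B f))) x)) x))
      }

  module _ {φ q : ℤ → ℤ} {P₀ P₁ P₂ P₃ Q₀ Q₁ Q₂ Q₃ : ℕ} (Φs : Smooth φ P₀ P₁ P₂ P₃) (Qs : Smooth q Q₀ Q₁ Q₂ Q₃) (α β : ℤ) where
    private
      module F = Smooth Φs
      module Q = Smooth Qs
      φ₁ = φ (α +ᶻ + 1) -ᶻ φ (α -ᶻ + 1)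
      q₁ = q (β +ᶻ + 1) -ᶻ q (β -ᶻ + 1)
      central : ∀ f {M} → Δ f ≼ M → ∀ a → abs (f (a +ᶻ + 1) -ᶻ f (a -ᶻ + 1)) ≤ 2 * M
      central f h a = lipschitz-at f h (a -ᶻ + 1) 2 (lem a)
        where
        lem : ∀ a → a +ᶻ + 1 ≡ (a -ᶻ + 1) +ᶻ + 2
        lem = ZS.solve-∀
      sum₂ : ∀ f {M} → f ≼ M → ∀ a b → abs (f a +ᶻ f b) ≤ 2 * M
      sum₂ f {M} h a b = abs-+ {f a} {f b} refl (h a) (subst (abs (f b) ≤_) (sym (+-identityʳ M)) (h b))

    remainder : ℕ → ℕ → ℕ
    remainder s t = 2 * (s * (t * t) * (P₁ * Q₂) + s * s * s * (P₃ * Q₀) + s * s * t * (P₂ * Q₁) + t * t * t * (P₀ * Q₃))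

    -- Terms even in the displacement cancel between a point and its mirror image, so after the
    -- linear part only orders three and above remain. The linear part is isolated because it
    -- vanishes when summed over all pairs of steps.
    product-expansion : ∀ s t → abs (+ 2 *ᶻ (φ (α +ᶻ s) *ᶻ q (β +ᶻ t) -ᶻ φ (α -ᶻ s) *ᶻ q (β -ᶻ t))
        -ᶻ (s *ᶻ (+ 2 *ᶻ φ₁ *ᶻ q β) +ᶻ (+ 2 *ᶻ t) *ᶻ (q₁ *ᶻ φ α))) ≤ remainder (abs s) (abs t)
    product-expansion s t = ≤-trans
        (abs-+ {X₁ +ᶻ X₂} {X₃ +ᶻ X₄} (ident (φ (α +ᶻ s)) (φ (α -ᶻ s)) (q (β +ᶻ t)) (q (β -ᶻ t)) s t φ₁ q₁ (φ α) (q β))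
          (abs-+ {X₁} {X₂} refl (abs-* (s *ᶻ φ₁) q″ (abs-* s φ₁ ≤-refl (central φ F.bound₁ α)) (symmetric-sumᶻ q Q.bound₂ β t))
                      (abs-* φ‴ (q (β +ᶻ t) +ᶻ q (β -ᶻ t)) (symmetric-differenceᶻ φ F.bound₃ α s) (sum₂ q Q.bound₀ (β +ᶻ t) (β -ᶻ t))))
          (abs-+ {X₃} {X₄} refl (abs-* φ″ (t *ᶻ q₁) (symmetric-sumᶻ φ F.bound₂ α s) (abs-* t q₁ ≤-refl (central q Q.bound₁ β)))
                      (abs-* (φ (α +ᶻ s) +ᶻ φ (α -ᶻ s)) q‴ (sum₂ φ F.bound₀ (α +ᶻ s) (α -ᶻ s)) (symmetric-differenceᶻ q Q.bound₃ β t))))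
        (≤-reflexive (ar (abs s) (abs t) P₀ P₁ P₂ P₃ Q₀ Q₁ Q₂ Q₃))
      where
      q″ = q (β +ᶻ t) +ᶻ q (β -ᶻ t) -ᶻ + 2 *ᶻ q β
      q‴ = q (β +ᶻ t) -ᶻ q (β -ᶻ t) -ᶻ t *ᶻ q₁
      φ″ = φ (α +ᶻ s) +ᶻ φ (α -ᶻ s) -ᶻ + 2 *ᶻ φ α
      φ‴ = φ (α +ᶻ s) -ᶻ φ (α -ᶻ s) -ᶻ s *ᶻ φ₁
      X₁ = s *ᶻ φ₁ *ᶻ q″
      X₂ = φ‴ *ᶻ (q (β +ᶻ t) +ᶻ q (β -ᶻ t))
      X₃ = φ″ *ᶻ (t *ᶻ q₁)
      X₄ = (φ (α +ᶻ s) +ᶻ φ (α -ᶻ s)) *ᶻ q‴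
      -- The doubling permits `2(ac - bd) = (a - b)(c + d) + (a + b)(c - d)`, which reduces the
      -- product to symmetric sums and differences of each factor.
      ident : ∀ a b c d s t f₁ g₁ f₀ g₀ →
        + 2 *ᶻ (a *ᶻ c -ᶻ b *ᶻ d) -ᶻ (s *ᶻ (+ 2 *ᶻ f₁ *ᶻ g₀) +ᶻ (+ 2 *ᶻ t) *ᶻ (g₁ *ᶻ f₀)) ≡
        (s *ᶻ f₁ *ᶻ (c +ᶻ d -ᶻ + 2 *ᶻ g₀) +ᶻ (a -ᶻ b -ᶻ s *ᶻ f₁) *ᶻ (c +ᶻ d))
        +ᶻ ((a +ᶻ b -ᶻ + 2 *ᶻ f₀) *ᶻ (t *ᶻ g₁) +ᶻ (a +ᶻ b) *ᶻ (c -ᶻ d -ᶻ t *ᶻ g₁))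
      ident = ZS.solve-∀
      ar : ∀ s t P₀ P₁ P₂ P₃ Q₀ Q₁ Q₂ Q₃ →
        s * (2 * P₁) * (t * t * Q₂) + s * s * s * P₃ * (2 * Q₀) + (s * s * P₂ * (t * (2 * Q₁)) + 2 * P₀ * (t * t * t * Q₃)) ≡
        2 * (s * (t * t) * (P₁ * Q₂) + s * s * s * (P₃ * Q₀) + s * s * t * (P₂ * Q₁) + t * t * t * (P₀ * Q₃))
      ar = NS.solve-∀

  Eᶻ-neg : {I Y : Set} (is : List I) (st : I → Y → Y) → ∀ k (F : Y → ℤ) y → Z.E is st k (λ y → -ᶻ F y) y ≡ -ᶻ Z.E is st k F y
  Eᶻ-neg is st zero    F y = refl
  Eᶻ-neg is st (suc k) F y = trans (Z.∑-cong is (λ i → Eᶻ-neg is st k F (st i y))) (∑ᶻ-neg is _)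

  Eᶻ-minus : {I Y : Set} (is : List I) (st : I → Y → Y) → ∀ k (F G : Y → ℤ) y →
             Z.E is st k (λ y → F y -ᶻ G y) y ≡ Z.E is st k F y -ᶻ Z.E is st k G y
  Eᶻ-minus is st k F G y = trans (Z.E-+ is st k F (λ y → -ᶻ G y) y) (cong (Z.E is st k F y +ᶻ_) (Eᶻ-neg is st k G y))

  ∑ᶻ-minus : {A : Set} (xs : List A) (f g : A → ℤ) → Z.∑ xs (λ x → f x -ᶻ g x) ≡ Z.∑ xs f -ᶻ Z.∑ xs g
  ∑ᶻ-minus xs f g = trans (Z.∑-+ xs f (λ x → -ᶻ g x)) (cong (Z.∑ xs f +ᶻ_) (∑ᶻ-neg xs g))

  abs-difference : ∀ x y {a b} → abs x ≤ a → abs y ≤ b → abs (x -ᶻ y) ≤ a + b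
  abs-difference x y h₁ h₂ = ≤-trans (ℤₚ.∣i-j∣≤∣i∣+∣j∣ x y) (+-mono-≤ h₁ h₂)

  -- Box kernels and the smoothed sign

  module Box (V : ℕ) where
    w : ℕ
    w = suc (2 * V)

    box : (ℤ → ℤ) → ℤ → ℤ
    box f t = Z.∑ (rng w) (λ x → f ((t -ᶻ + V) +ᶻ + x))

    box-cong : ∀ {f g} → (∀ x → f x ≡ g x) → ∀ x → box f x ≡ box g x
    box-cong h t = Z.∑-cong (rng w) (λ x → h _)

    box-bound : ∀ {f M} → f ≼ M → box f ≼ w * M
    box-bound {f} {M} h t = ≤-trans (abs-∑ (rng w) (λ x → f ((t -ᶻ + V) +ᶻ + x))) (≤-trans (∑-mono (rng w) (λ x → h ((t -ᶻ + V) +ᶻ + x))) (≤-reflexive (∑-rng-const w M)))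

    Δ-box : ∀ f x → Δ (box f) x ≡ box (Δ f) x
    Δ-box f t = trans (sym (∑ᶻ-minus (rng w) (λ x → f (((t +ᶻ + 1) -ᶻ + V) +ᶻ + x)) (λ x → f ((t -ᶻ + V) +ᶻ + x)))) (Z.∑-cong (rng w) (λ x → cong (λ z → f z -ᶻ f ((t -ᶻ + V) +ᶻ + x)) (lem t (+ V) (+ x))))
      where
      lem : ∀ t V x → ((t +ᶻ + 1) -ᶻ V) +ᶻ x ≡ ((t -ᶻ V) +ᶻ x) +ᶻ + 1
      lem = ZS.solve-∀

    -- Moving the box by one changes only its two end values, so a difference loses the factor `w`
    -- that a value carries.
    Δbox-bound : ∀ {f M} → f ≼ M → Δ (box f) ≼ 2 * M
    Δbox-bound {f} {M} h t = subst₂ _≤_ (cong abs (sym eq)) (cong (_+_ M) (sym (+-identityʳ M))) (abs-difference (f ((t -ᶻ + V) +ᶻ + w)) (f (t -ᶻ + V)) (h ((t -ᶻ + V) +ᶻ + w)) (h (t -ᶻ + V)))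
      where
      lem : ∀ t V x → ((t +ᶻ + 1) -ᶻ V) +ᶻ x ≡ ((t -ᶻ V) +ᶻ + 1) +ᶻ x
      lem = ZS.solve-∀
      move : ∀ {a b c d} → a +ᶻ b ≡ c +ᶻ d → a -ᶻ c ≡ d -ᶻ b
      move {a} {b} {c} {d} e = trans (l₁ a b c) (trans (cong (λ z → (z -ᶻ b) -ᶻ c) e) (l₂ c d b))
        where
        l₁ : ∀ a b c → a -ᶻ c ≡ ((a +ᶻ b) -ᶻ b) -ᶻ c
        l₁ = ZS.solve-∀
        l₂ : ∀ c d b → ((c +ᶻ d) -ᶻ b) -ᶻ c ≡ d -ᶻ b
        l₂ = ZS.solve-∀
      eq : Δ (box f) t ≡ f ((t -ᶻ + V) +ᶻ + w) -ᶻ f (t -ᶻ + V)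
      eq = trans (cong (_-ᶻ box f t) (Z.∑-cong (rng w) (λ x → cong f (lem t (+ V) (+ x))))) (move {Z.∑ (rng w) (λ x → f (((t -ᶻ + V) +ᶻ + 1) +ᶻ + x))} (Z.∑-slide w f (t -ᶻ + V)))

    -- The window is centred, hence its odd width; oddness must survive smoothing, because it
    -- provides the sign change under total reversal.
    box-odd : ∀ {f} → (∀ t → f (-ᶻ t) ≡ -ᶻ f t) → ∀ t → box f (-ᶻ t) ≡ -ᶻ box f t
    box-odd {f} h t = begin
      Z.∑ (rng w) (λ x → f ((-ᶻ t -ᶻ + V) +ᶻ + x)) ≡⟨ Z.∑-cong (rng w) (λ x → trans (cong f (lem₁ t (+ V) (+ x))) (h _)) ⟩
      Z.∑ (rng w) (λ x → -ᶻ f ((t -ᶻ + V) +ᶻ (+ 2 *ᶻ + V -ᶻ + x))) ≡⟨ ∑ᶻ-neg (rng w) (λ x → f ((t -ᶻ + V) +ᶻ (+ 2 *ᶻ + V -ᶻ + x))) ⟩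
      -ᶻ Z.∑ (rng w) (λ x → f ((t -ᶻ + V) +ᶻ (+ 2 *ᶻ + V -ᶻ + x))) ≡⟨ cong -ᶻ_ (Z.∑-cong (rng w) (λ x → cong (λ z → f ((t -ᶻ + V) +ᶻ (z -ᶻ + x))) (sym (ℤₚ.pos-* 2 V)))) ⟩
      -ᶻ Z.∑ (rng w) (λ x → f ((t -ᶻ + V) +ᶻ (+ (2 * V) -ᶻ + x))) ≡⟨ cong -ᶻ_ (Z.∑-reverse (2 * V) (λ z → f ((t -ᶻ + V) +ᶻ z))) ⟩
      -ᶻ box f t ∎
      where
      open ≡-Reasoning
      lem₁ : ∀ t V x → (-ᶻ t -ᶻ V) +ᶻ x ≡ -ᶻ ((t -ᶻ V) +ᶻ (+ 2 *ᶻ V -ᶻ x))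
      lem₁ = ZS.solve-∀

    -- Every box pushes the region where the function is constant outwards by `V`; three boxes spend
    -- 3V of the 4V that define a near tie.
    box-far : ∀ {f c M} → (∀ t → + suc c ≤ᶻ t → f t ≡ + M) → ∀ t → + suc (V + c) ≤ᶻ t → box f t ≡ + (w * M)
    box-far {f} {c} {M} h t ht = trans (Z.∑-cong (rng w) (λ x → h _ (≤ᶻ-from x ht
        (trans (lem t (+ V) (+ x) (+ c)) (cong (λ z → (t -ᶻ (+ 1 +ᶻ z)) +ᶻ + x) (sym (ℤₚ.pos-+ V c))))))) (trans (sym (+-∑ (rng w) (λ _ → M))) (cong +_ (∑-rng-const w M)))
      where
      lem : ∀ t V x c → ((t -ᶻ V) +ᶻ x) -ᶻ (+ 1 +ᶻ c) ≡ (t -ᶻ (+ 1 +ᶻ (V +ᶻ c))) +ᶻ x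
      lem = ZS.solve-∀

    open Smoothing box w 2 (λ {f} {M} → box-bound {f} {M}) (λ {f} {M} → Δbox-bound {f} {M}) Δ-box (λ {f} {g} → box-cong {f} {g}) public

  sgn : ℤ → ℤ
  sgn (+ zero)  = + 0
  sgn (+ suc _) = + 1
  sgn -[1+ _ ]  = -[1+ 0 ]

  sgn≼1 : sgn ≼ 1
  sgn≼1 (+ zero)  = z≤n
  sgn≼1 (+ suc _) = ≤-refl
  sgn≼1 -[1+ _ ]  = ≤-refl

  sgn-odd : ∀ t → sgn (-ᶻ t) ≡ -ᶻ sgn t
  sgn-odd (+ zero)  = refl
  sgn-odd (+ suc _) = refl
  sgn-odd -[1+ _ ]  = refl

  sgn-pos : ∀ t → + 1 ≤ᶻ t → sgn t ≡ + 1
  sgn-pos (+ suc _) _ = refl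
  sgn-pos (+ zero) (ℤ.+≤+ ())

  module Kernel (V : ℕ) where
    open Box V

    abstract
      φ : ℤ → ℤ
      φ = box (box (box sgn))

      w³ : ℕ
      w³ = w * (w * (w * 1))

      φ-smooth : Smooth φ w³ (2 * (w * (w * 1))) (2 * (2 * (w * 1))) (2 * (2 * (2 * 1)))
      φ-smooth = smooth {sgn} sgn≼1

      φ-odd : ∀ t → φ (-ᶻ t) ≡ -ᶻ φ t
      φ-odd = box-odd {box (box sgn)} (box-odd {box sgn} (box-odd {sgn} sgn-odd))

      φ-far : ∀ t → + suc (V + (V + (V + 0))) ≤ᶻ t → φ t ≡ + w³
      φ-far = box-far {box (box sgn)} (box-far {box sgn} (box-far {sgn} sgn-pos))

      w³≡ : w³ ≡ w * (w * (w * 1))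
      w³≡ = refl

    private
      close : ∀ T t → abs (T -ᶻ t) ≤ V → + suc (4 * V) ≤ᶻ T → + suc (V + (V + (V + 0))) ≤ᶻ t
      close T t h hT = ≤ᶻ-by _ (+-nonneg (ℤₚ.i≤j⇒0≤j-i hT) (ℤₚ.i≤j⇒0≤j-i (ℤₚ.≤-trans (i≤abs (T -ᶻ t)) (ℤ.+≤+ h))))
          (trans (cong (λ z → t -ᶻ (+ 1 +ᶻ z)) (trans (ℤₚ.pos-+ V (V + (V + 0))) (cong (+ V +ᶻ_) (trans (ℤₚ.pos-+ V (V + 0)) (cong (λ z → + V +ᶻ + z) (+-identityʳ V))))))
            (trans (lem t T (+ V)) (cong (λ z → (T -ᶻ (+ 1 +ᶻ z)) +ᶻ (+ V -ᶻ (T -ᶻ t))) (sym (ℤₚ.pos-* 4 V)))))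
        where
        i≤abs : ∀ i → i ≤ᶻ + abs i
        i≤abs (+ n)    = ℤₚ.≤-refl
        i≤abs -[1+ n ] = ℤ.-≤+
        lem : ∀ t T V → t -ᶻ (+ 1 +ᶻ (V +ᶻ (V +ᶻ V))) ≡ (T -ᶻ (+ 1 +ᶻ + 4 *ᶻ V)) +ᶻ (V -ᶻ (T -ᶻ t))
        lem = ZS.solve-∀

      agree⁺ : ∀ T t → abs (T -ᶻ t) ≤ V → + suc (4 * V) ≤ᶻ T → + w³ *ᶻ sgn T ≡ φ t
      agree⁺ T t h hT = trans (cong (+ w³ *ᶻ_) (sgn-pos T (ℤₚ.≤-trans (ℤ.+≤+ (s≤s z≤n)) hT))) (trans (ℤₚ.*-identityʳ (+ w³)) (sym (φ-far t (close T t h hT))))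

      agree : ∀ T t → abs (T -ᶻ t) ≤ V → 4 * V < abs T → + w³ *ᶻ sgn T ≡ φ t
      agree (+ a) t h hT = agree⁺ (+ a) t h (ℤ.+≤+ hT)
      agree T@(-[1+ a ]) t h hT = ℤₚ.neg-injective (trans (trans (ℤₚ.neg-distribʳ-* (+ w³) (sgn T)) (cong (+ w³ *ᶻ_) (sym (sgn-odd T))))
          (trans (agree⁺ (-ᶻ T) (-ᶻ t) (subst (_≤ V) (trans (sym (ℤₚ.∣-i∣≡∣i∣ (T -ᶻ t))) (cong abs (lem T t))) h) (ℤ.+≤+ hT)) (φ-odd t)))
        where
        lem : ∀ T t → -ᶻ (T -ᶻ t) ≡ -ᶻ T -ᶻ -ᶻ t
        lem = ZS.solve-∀

    private
      crude : ∀ T t → abs (+ w³ *ᶻ sgn T -ᶻ φ t) ≤ 2 * w³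
      crude T t = ≤-trans (abs-difference (+ w³ *ᶻ sgn T) (φ t) (abs-* (+ w³) (sgn T) {w³} {1} ≤-refl (sgn≼1 T)) (Smooth.bound₀ φ-smooth t)) (≤-reflexive (cong₂ _+_ (*-identityʳ w³) (sym (+-identityʳ w³))))

    -- `T` is the full margin and `t` the margin without the dropped coordinates. If `T` is no near
    -- tie and the two differ by at most `V`, then `t` is still beyond 3V on the same side and the
    -- error is exactly 0. Otherwise the crude bound is charged to the near tie or, as in
    -- Chebyshev's inequality, to the square of the difference.
    kernel-error : ∀ T t → V * V * abs (+ w³ *ᶻ sgn T -ᶻ φ t) ≤ 2 * w³ * (V * V * ind (abs T ≤? 4 * V) + sq (T -ᶻ t))
    kernel-error T t with abs T ≤? 4 * V
    ... | yes _ = begin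
        V * V * abs (+ w³ *ᶻ sgn T -ᶻ φ t)   ≤⟨ *-monoʳ-≤ (V * V) (crude T t) ⟩
        V * V * (2 * w³)                     ≡⟨ lem (V * V) w³ ⟩
        2 * w³ * (V * V * 1)                 ≤⟨ *-monoʳ-≤ (2 * w³) (m≤m+n (V * V * 1) _) ⟩
        2 * w³ * (V * V * 1 + sq (T -ᶻ t)) ∎
      where
      open ≤-Reasoning
      lem : ∀ a b → a * (2 * b) ≡ 2 * b * (a * 1)
      lem = NS.solve-∀
    ... | no ≰ with abs (T -ᶻ t) ≤? V
    ... | yes h = subst (_≤ 2 * w³ * (V * V * 0 + sq (T -ᶻ t))) (sym (trans (cong (λ z → V * V * abs z) (ℤₚ.i≡j⇒i-j≡0 (agree T t h (≰⇒> ≰)))) (*-zeroʳ (V * V)))) z≤n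
    ... | no ≰V = begin
        V * V * abs (+ w³ *ᶻ sgn T -ᶻ φ t)   ≤⟨ *-mono-≤ (*-mono-≤ (<⇒≤ (≰⇒> ≰V)) (<⇒≤ (≰⇒> ≰V))) (crude T t) ⟩
        sq (T -ᶻ t) * (2 * w³)               ≡⟨ *-comm (sq (T -ᶻ t)) (2 * w³) ⟩
        2 * w³ * sq (T -ᶻ t)                 ≤⟨ *-monoʳ-≤ (2 * w³) (m≤n+m (sq (T -ᶻ t)) (V * V * 0)) ⟩
        2 * w³ * (V * V * 0 + sq (T -ᶻ t)) ∎
      where
      open ≤-Reasoning

  -- Here `m` additional random faces play the part of the box: the total variation of their law
  -- replaces the two end values.
  module SumSmoothing (p m : ℕ) {ρ : ℕ} (r≤ρ : ∀ d → r (suc p) m d ≤ ρ) where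
    private
      n = suc p
      B : (ℤ → ℤ) → ℤ → ℤ
      B = Z.E (rng n) st₁ m

      B-bound : ∀ {f M} → f ≼ M → B f ≼ n ^ m * M
      B-bound {f} {M} h y = ≤-trans (abs-E (rng n) st₁ m f y) (≤-trans (E-bound (rng n) st₁ m h y) (≤-reflexive (cong (λ l → l ^ m * M) (length-rng n))))

      shift : ∀ f x → B f (x +ᶻ + 1) ≡ B (λ x → f (x +ᶻ + 1)) x
      shift f x = sym (Z.E-project (rng n) st₁ st₁ (_+ᶻ + 1) (λ i d → lem d (+ i)) m f x)
        where
        lem : ∀ d i → (d +ᶻ i) +ᶻ + 1 ≡ (d +ᶻ + 1) +ᶻ i
        lem = ZS.solve-∀

      ΔB : ∀ f x → Δ (B f) x ≡ B (Δ f) x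
      ΔB f x = trans (cong (_-ᶻ B f x) (shift f x)) (sym (Eᶻ-minus (rng n) st₁ m (λ x → f (x +ᶻ + 1)) f x))

    open Smoothing B (n ^ m) (2 * ρ) (λ {f} {M} → B-bound {f} {M}) (λ {f} h → E-difference p m f r≤ρ h) ΔB (λ h → Z.E-cong (rng n) st₁ m h) public
      renaming (smooth to E-smooth)

  -- Lindeberg: the steps st are replaced by st′ two at a time, each replacement costing the discrepancy.
  module Swap {Y : Set} (is : List ℕ) (st st′ : ℕ → Y → Y)
              (comm : ∀ i j y → st i (st′ j y) ≡ st′ j (st i y)) (comm′ : ∀ i j y → st′ i (st′ j y) ≡ st′ j (st′ i y))
              (G : Y → ℤ) where
    private
      n = length is
      ∑∑ : (ℕ → ℕ → ℤ) → ℤ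
      ∑∑ f = Z.∑ is (λ i → Z.∑ is (f i))

    discrepancy : Y → ℤ
    discrepancy y = ∑∑ (λ i j → G (st j (st i y)) -ᶻ G (st′ j (st′ i y)))

    -- Telescoping over the pairs of steps, each pair contributing an average of the discrepancy.
    -- The factor `κ` carries a cleared denominator.
    swap-bound : ∀ {κ err} → (∀ y → κ * abs (discrepancy y) ≤ err) → ∀ a y →
      n * n * (κ * abs (Z.E is st (a * 2) G y -ᶻ Z.E is st′ (a * 2) G y)) ≤ a * (n ^ (a * 2) * err)
    swap-bound {κ} h zero    y = ≤-reflexive (trans (cong (λ z → n * n * (κ * abs z)) (ℤₚ.+-inverseʳ (G y))) (trans (cong (n * n *_) (*-zeroʳ κ)) (*-zeroʳ (n * n))))
    swap-bound {κ} {err} h (suc a) y = begin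
        n * n * (κ * abs (Z.E is st (suc a * 2) G y -ᶻ Z.E is st′ (suc a * 2) G y))
          ≤⟨ *-monoʳ-≤ (n * n) (*-monoʳ-≤ κ (abs-+ {A} {B} eq A-bound ≤-refl)) ⟩
        n * n * (κ * (∑₂ (λ i j → abs (X i j)) + abs B))
          ≡⟨ lem₁ (n * n) κ (∑₂ (λ i j → abs (X i j))) (abs B) ⟩
        n * n * κ * ∑₂ (λ i j → abs (X i j)) + n * n * (κ * abs B)
          ≤⟨ +-mono-≤ first (*-monoʳ-≤ (n * n) second) ⟩
        n * (n * (a * (n ^ (a * 2) * err))) + n * n * (n ^ (a * 2) * err) ≡⟨ lem₂ n a (n ^ (a * 2)) err ⟩
        suc a * (n * (n * n ^ (a * 2)) * err) ∎
      where
      open ≤-Reasoning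
      E₁ = Z.E is st (a * 2) G
      E₂ = Z.E is st′ (a * 2) G
      X : ℕ → ℕ → ℤ
      X i j = E₁ (st j (st i y)) -ᶻ E₂ (st j (st i y))
      ∑₂ : (ℕ → ℕ → ℕ) → ℕ
      ∑₂ f = ∑ is (λ i → ∑ is (f i))
      A = ∑∑ X
      B = Z.E is st′ (a * 2) discrepancy y
      A-bound : abs A ≤ ∑₂ (λ i j → abs (X i j))
      A-bound = ≤-trans (abs-∑ is _) (∑-mono is (λ i → abs-∑ is (X i)))
      -- As the steps commute, the exchanged pair can be made to act last, on `G` itself; only the
      -- discrepancy of `G` is needed, not that of its averages along the walk.
      B≡ : B ≡ ∑∑ (λ i j → E₂ (st j (st i y)) -ᶻ E₂ (st′ j (st′ i y)))
      B≡ = trans (Z.E-∑ is st′ is (a * 2) (λ i y → Z.∑ is (λ j → G (st j (st i y)) -ᶻ G (st′ j (st′ i y)))) y)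
        (Z.∑-cong is (λ i → trans (Z.E-∑ is st′ is (a * 2) (λ j y → G (st j (st i y)) -ᶻ G (st′ j (st′ i y))) y)
          (Z.∑-cong is (λ j → trans (Eᶻ-minus is st′ (a * 2) (λ y → G (st j (st i y))) (λ y → G (st′ j (st′ i y))) y)
            (cong₂ _-ᶻ_ (Z.E-project is st′ st′ (λ y → st j (st i y)) (λ l y → trans (cong (st j) (comm i l y)) (comm j l (st i y))) (a * 2) G y)
                        (Z.E-project is st′ st′ (λ y → st′ j (st′ i y)) (λ l y → trans (cong (st′ j) (comm′ i l y)) (comm′ j l (st′ i y))) (a * 2) G y))))))
      telescope : ∀ a b c → a -ᶻ c ≡ (a -ᶻ b) +ᶻ (b -ᶻ c)
      telescope = ZS.solve-∀
      eq : Z.E is st (suc a * 2) G y -ᶻ Z.E is st′ (suc a * 2) G y ≡ A +ᶻ B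
      eq = trans (sym (∑ᶻ-minus is _ _)) (trans (Z.∑-cong is (λ i → trans (sym (∑ᶻ-minus is _ _)) (trans (Z.∑-cong is (λ j →
             telescope (E₁ (st j (st i y))) (E₂ (st j (st i y))) (E₂ (st′ j (st′ i y))))) (Z.∑-+ is (X i) _))))
             (trans (Z.∑-+ is _ _) (cong (A +ᶻ_) (sym B≡))))
      lem₁ : ∀ m κ x b → m * (κ * (x + b)) ≡ m * κ * x + m * (κ * b)
      lem₁ = NS.solve-∀
      lem₂ : ∀ n a x e → n * (n * (a * (x * e))) + n * n * (x * e) ≡ suc a * (n * (n * x) * e)
      lem₂ = NS.solve-∀
      first : n * n * κ * ∑₂ (λ i j → abs (X i j)) ≤ n * (n * (a * (n ^ (a * 2) * err)))
      first = begin
        n * n * κ * ∑₂ (λ i j → abs (X i j))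
          ≡⟨ trans (sym (∑-*ˡ is (n * n * κ) _)) (∑-cong is (λ i → trans (sym (∑-*ˡ is (n * n * κ) _)) (∑-cong is (λ j → *-assoc (n * n) κ _)))) ⟩
        ∑₂ (λ i j → n * n * (κ * abs (X i j)))
          ≤⟨ ∑-mono is (λ i → ∑-mono is (λ j → swap-bound {κ} {err} h a (st j (st i y)))) ⟩
        ∑₂ (λ i j → a * (n ^ (a * 2) * err))
          ≡⟨ trans (∑-cong is (λ i → ∑-const is _)) (∑-const is _) ⟩
        n * (n * (a * (n ^ (a * 2) * err))) ∎
      second : κ * abs B ≤ n ^ (a * 2) * err
      second = begin
        κ * abs B ≤⟨ *-monoʳ-≤ κ (abs-E is st′ (a * 2) discrepancy y) ⟩
        κ * E is st′ (a * 2) (λ y → abs (discrepancy y)) y ≡⟨ E-*ˡ is st′ (a * 2) κ _ y ⟨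
        E is st′ (a * 2) (λ y → κ * abs (discrepancy y)) y ≤⟨ E-bound is st′ (a * 2) h y ⟩
        n ^ (a * 2) * err ∎

  -- Reversing the steps of a walk two at a time

  quart : ℕ → ℕ
  quart x = x * x * (x * x)

  module _ (σ x : ℕ) where
    private
      by-cases : ∀ a → (σ ≤ x → a ≤ quart x) → (x ≤ σ → a ≤ quart σ) → a ≤ quart x + quart σ
      by-cases a f g with ≤-total σ x
      ... | inj₁ h = ≤-trans (f h) (m≤m+n _ _)
      ... | inj₂ h = ≤-trans (g h) (m≤n+m _ _)

    -- Mixed terms of degree four, with σ the typical size of a step `x`; comparing `x` with σ is
    -- enough, so that the third-order errors are paid from a fourth moment.
    young₁ : σ * σ * (σ * x) ≤ quart x + quart σ
    young₁ = by-cases (σ * σ * (σ * x)) (λ h → *-mono-≤ (*-mono-≤ h h) (*-mono-≤ h ≤-refl)) (λ h → *-mono-≤ (≤-refl {σ * σ}) (*-mono-≤ (≤-refl {σ}) h))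

    young₂ : σ * σ * (x * x) ≤ quart x + quart σ
    young₂ = by-cases (σ * σ * (x * x)) (λ h → *-mono-≤ (*-mono-≤ h h) ≤-refl) (λ h → *-mono-≤ (≤-refl {σ * σ}) (*-mono-≤ h h))

    young₃ : σ * x * (x * x) ≤ quart x + quart σ
    young₃ = by-cases (σ * x * (x * x)) (λ h → *-mono-≤ (*-mono-≤ h ≤-refl) ≤-refl) (λ h → *-mono-≤ (*-mono-≤ (≤-refl {σ}) h) (*-mono-≤ h h))

  module Lindeberg {p : ℕ} (S : Scale p) (v : ℕ → ℤ) (∑v : Z.∑ (rng (suc p)) v ≡ + 0)
                   {φ q : ℤ → ℤ} {P₀ P₁ P₂ P₃ Q₀ Q₁ Q₂ Q₃ : ℕ} (Φs : Smooth φ P₀ P₁ P₂ P₃) (Qs : Smooth q Q₀ Q₁ Q₂ Q₃)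
                   (φ-odd : ∀ t → φ (-ᶻ t) ≡ -ᶻ φ t) where
    open Density S

    Z₄ : ℕ
    Z₄ = ∑ is (λ i → q4 (v i) + quart σ)

    -- The third-order error of one swap at typical steps, σ in the margin and `n` in the sum: each
    -- difference of φ comes with a factor σ and each difference of `q` with a factor `n`.
    Θ : ℕ
    Θ = σ * (n * n) * (P₁ * Q₂) + σ * σ * σ * (P₃ * Q₀) + σ * σ * n * (P₂ * Q₁) + n * n * n * (P₀ * Q₃)

    private
      rem : ℕ → ℕ → ℕ
      rem = remainder Φs Qs (+ 0) (+ 0)

      rem≤ : ∀ x τ → τ ≤ n → quart σ * rem x τ ≤ 2 * Θ * (quart x + quart σ)
      rem≤ x τ h = begin
        quart σ * rem x τ ≡⟨ lem₁ σ x τ (P₁ * Q₂) (P₃ * Q₀) (P₂ * Q₁) (P₀ * Q₃) ⟩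
        2 * (σ * (τ * τ) * (P₁ * Q₂) * (σ * σ * (σ * x)) + σ * σ * σ * (P₃ * Q₀) * (σ * x * (x * x)) + σ * σ * τ * (P₂ * Q₁) * (σ * σ * (x * x)) + τ * τ * τ * (P₀ * Q₃) * quart σ)
          ≤⟨ *-monoʳ-≤ 2 (+-mono-≤ (+-mono-≤ (+-mono-≤
               (*-mono-≤ (*-monoˡ-≤ (P₁ * Q₂) (*-monoʳ-≤ σ (*-mono-≤ h h))) (young₁ σ x))
               (*-monoʳ-≤ (σ * σ * σ * (P₃ * Q₀)) (young₃ σ x)))
               (*-mono-≤ (*-monoˡ-≤ (P₂ * Q₁) (*-monoʳ-≤ (σ * σ) h)) (young₂ σ x)))
               (*-mono-≤ (*-monoˡ-≤ (P₀ * Q₃) (*-mono-≤ (*-mono-≤ h h) h)) (m≤n+m (quart σ) (quart x)))) ⟩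
        2 * (σ * (n * n) * (P₁ * Q₂) * Y + σ * σ * σ * (P₃ * Q₀) * Y + σ * σ * n * (P₂ * Q₁) * Y + n * n * n * (P₀ * Q₃) * Y)
          ≡⟨ lem₂ (σ * (n * n) * (P₁ * Q₂)) (σ * σ * σ * (P₃ * Q₀)) (σ * σ * n * (P₂ * Q₁)) (n * n * n * (P₀ * Q₃)) Y ⟩
        2 * Θ * Y ∎
        where
        open ≤-Reasoning
        Y = quart x + quart σ
        lem₁ : ∀ σ x τ A B C D → σ * σ * (σ * σ) * (2 * (x * (τ * τ) * A + x * x * x * B + x * x * τ * C + τ * τ * τ * D)) ≡
          2 * (σ * (τ * τ) * A * (σ * σ * (σ * x)) + σ * σ * σ * B * (σ * x * (x * x)) + σ * σ * τ * C * (σ * σ * (x * x)) + τ * τ * τ * D * (σ * σ * (σ * σ)))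
        lem₁ = NS.solve-∀
        lem₂ : ∀ a b c d Y → 2 * (a * Y + b * Y + c * Y + d * Y) ≡ 2 * (a + b + c + d) * Y
        lem₂ = NS.solve-∀

    G : ℤ × ℤ → ℤ
    G y = φ (proj₁ y) *ᶻ q (proj₂ y)

    st st⁻ : ℕ → ℤ × ℤ → ℤ × ℤ
    st = step v +s
    st⁻ = step (λ i → -ᶻ v i) (λ i → + p -ᶻ + i)

    private
      swap-add : ∀ x a b → (x +ᶻ a) +ᶻ b ≡ (x +ᶻ b) +ᶻ a
      swap-add = ZS.solve-∀

      ∑∑ᶻ : (ℕ → ℕ → ℤ) → ℤ
      ∑∑ᶻ f = Z.∑ is (λ i → Z.∑ is (f i))

    open Swap is st st⁻ (λ i j y → cong₂ _,_ (swap-add (proj₁ y) (-ᶻ v j) (v i)) (swap-add (proj₂ y) (+ p -ᶻ + j) (+ i)))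
                        (λ i j y → cong₂ _,_ (swap-add (proj₁ y) (-ᶻ v j) (-ᶻ v i)) (swap-add (proj₂ y) (+ p -ᶻ + j) (+ p -ᶻ + i))) G

    private
      ∑∑-sum : ∀ (f : ℕ → ℤ) → Z.∑ is f ≡ + 0 → ∀ c → ∑∑ᶻ (λ i j → (f i +ᶻ f j) *ᶻ c) ≡ + 0
      ∑∑-sum f h c = trans (Z.∑-cong is (λ i → trans (Z.∑-*ʳ is c (λ j → f i +ᶻ f j)) (trans (cong (_*ᶻ c) (inner i)) (lem (+ length is) (f i) c))))
          (trans (Z.∑-*ʳ is (+ length is *ᶻ c) f) (trans (cong (_*ᶻ (+ length is *ᶻ c)) h) refl))
        where
        inner : ∀ i → Z.∑ is (λ j → f i +ᶻ f j) ≡ + length is *ᶻ f i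
        inner i = trans (Z.∑-+ is (λ _ → f i) f) (trans (cong₂ _+ᶻ_ (∑ᶻ-const is (f i)) h) (ℤₚ.+-identityʳ (+ length is *ᶻ f i)))
        lem : ∀ n f c → n *ᶻ f *ᶻ c ≡ f *ᶻ (n *ᶻ c)
        lem = ZS.solve-∀

      displacement : ∀ i j → i ∈ is → j ∈ is → abs ((+ i +ᶻ + j) -ᶻ + p) ≤ n
      displacement i j i∈ j∈ = ≤-trans (≤-reflexive (cong abs (trans (lem (+ i) (+ j) (+ p)) (trans (cong (λ z → + i -ᶻ z) (trans (ℤₚ.m-n≡m⊖n p j) (ℤₚ.⊖-≥ (s≤s⁻¹ (∈-rng j∈))))) (ℤₚ.m-n≡m⊖n i (p ∸ j))))))
          (≤-trans (ℤₚ.∣m⊝n∣≤m⊔n i (p ∸ j)) (≤-trans (⊔-lub (s≤s⁻¹ (∈-rng i∈)) (m∸n≤m p j)) (n≤1+n p)))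
        where
        lem : ∀ i j p → (i +ᶻ j) -ᶻ p ≡ i -ᶻ (p -ᶻ j)
        lem = ZS.solve-∀

    module _ (t d : ℤ) where
      private
        α = t
        β = d +ᶻ + p
        s : ℕ → ℕ → ℤ
        s i j = v i +ᶻ v j
        τ : ℕ → ℕ → ℤ
        τ i j = (+ i +ᶻ + j) -ᶻ + p
        c₁ = + 2 *ᶻ (φ (α +ᶻ + 1) -ᶻ φ (α -ᶻ + 1)) *ᶻ q β
        c₂ = (q (β +ᶻ + 1) -ᶻ q (β -ᶻ + 1)) *ᶻ φ α
        D R L : ℕ → ℕ → ℤ
        D i j = φ (α +ᶻ s i j) *ᶻ q (β +ᶻ τ i j) -ᶻ φ (α -ᶻ s i j) *ᶻ q (β -ᶻ τ i j)
        L i j = s i j *ᶻ c₁ +ᶻ (+ 2 *ᶻ τ i j) *ᶻ c₂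
        R i j = + 2 *ᶻ D i j -ᶻ L i j

        discrepancy≡ : discrepancy (t , d) ≡ ∑∑ᶻ D
        discrepancy≡ = Z.∑-cong is (λ i → Z.∑-cong is (λ j → cong₂ _-ᶻ_
            (cong₂ (λ a b → φ a *ᶻ q b) (ℤₚ.+-assoc t (v i) (v j)) (lem₁ d (+ i) (+ j) (+ p)))
            (cong₂ (λ a b → φ a *ᶻ q b) (lem₂ t (v i) (v j)) (lem₃ d (+ i) (+ j) (+ p)))))
          where
          lem₁ : ∀ d i j p → (d +ᶻ i) +ᶻ j ≡ (d +ᶻ p) +ᶻ ((i +ᶻ j) -ᶻ p)
          lem₁ = ZS.solve-∀
          lem₂ : ∀ t a b → (t +ᶻ -ᶻ a) +ᶻ -ᶻ b ≡ t -ᶻ (a +ᶻ b)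
          lem₂ = ZS.solve-∀
          lem₃ : ∀ d i j p → (d +ᶻ (p -ᶻ i)) +ᶻ (p -ᶻ j) ≡ (d +ᶻ p) -ᶻ ((i +ᶻ j) -ᶻ p)
          lem₃ = ZS.solve-∀

        ∑∑L : ∑∑ᶻ L ≡ + 0
        ∑∑L = trans (Z.∑-cong is (λ i → Z.∑-+ is (λ j → s i j *ᶻ c₁) (λ j → (+ 2 *ᶻ τ i j) *ᶻ c₂))) (trans (Z.∑-+ is (λ i → Z.∑ is (λ j → s i j *ᶻ c₁)) (λ i → Z.∑ is (λ j → (+ 2 *ᶻ τ i j) *ᶻ c₂))) (cong₂ _+ᶻ_ (∑∑-sum v ∑v c₁)
            (trans (Z.∑-cong is (λ i → Z.∑-cong is (λ j → cong (_*ᶻ c₂) (lem (+ i) (+ j) (+ p))))) (∑∑-sum u ∑u c₂))))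
          where
          lem : ∀ i j p → + 2 *ᶻ ((i +ᶻ j) -ᶻ p) ≡ ((i +ᶻ i) -ᶻ p) +ᶻ ((j +ᶻ j) -ᶻ p)
          lem = ZS.solve-∀

        ∑∑R : ∑∑ᶻ R ≡ + 2 *ᶻ ∑∑ᶻ D
        ∑∑R = trans (Z.∑-cong is (λ i → ∑ᶻ-minus is (λ j → + 2 *ᶻ D i j) (L i))) (trans (∑ᶻ-minus is (λ i → Z.∑ is (λ j → + 2 *ᶻ D i j)) (λ i → Z.∑ is (L i)))
            (trans (cong₂ _-ᶻ_ (trans (Z.∑-cong is (λ i → Z.∑-*ˡ is (+ 2) (D i))) (Z.∑-*ˡ is (+ 2) (λ i → Z.∑ is (D i)))) ∑∑L) (ℤₚ.+-identityʳ (+ 2 *ᶻ ∑∑ᶻ D))))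

        moments : ∑ is (λ i → ∑ is (λ j → quart (abs (s i j)) + quart σ)) ≤ 16 * n * Z₄
        moments = begin
          ∑ is (λ i → ∑ is (λ j → quart (abs (s i j)) + quart σ))
            ≤⟨ ∑-mono is (λ i → ∑-mono is (λ j → ≤-trans (+-mono-≤ (q4-+ (v i) (v j)) (m≤m+n (quart σ) (15 * quart σ))) (≤-reflexive (lem₁ (q4 (v i)) (q4 (v j)) (quart σ))))) ⟩
          ∑ is (λ i → ∑ is (λ j → 8 * (z i + z j)))
            ≡⟨ trans (∑-cong is (λ i → trans (∑-*ˡ is 8 (λ j → z i + z j)) (cong (8 *_) (trans (∑-+ is (λ _ → z i) z) (cong (_+ Z₄) (∑-rng-const n (z i)))))))
                     (trans (∑-*ˡ is 8 (λ i → n * z i + Z₄)) (cong (8 *_) (trans (∑-+ is (λ i → n * z i) (λ _ → Z₄)) (cong₂ _+_ (∑-*ˡ is n z) (∑-rng-const n Z₄))))) ⟩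
          8 * (n * Z₄ + n * Z₄) ≡⟨ lem₂ n Z₄ ⟩
          16 * n * Z₄ ∎
          where
          open ≤-Reasoning
          z : ℕ → ℕ
          z i = q4 (v i) + quart σ
          lem₁ : ∀ a b c → 8 * (a + b) + (c + 15 * c) ≡ 8 * ((a + c) + (b + c))
          lem₁ = NS.solve-∀
          lem₂ : ∀ n z → 8 * (n * z + n * z) ≡ 16 * n * z
          lem₂ = NS.solve-∀

      -- The linear terms sum to 0 over all pairs of faces because both `v` and the centred faces
      -- `u` do. What is left is the remainder, averaged through the fourth moment of the steps.
      discrepancy-bound : quart σ * abs (discrepancy (t , d)) ≤ 16 * n * Z₄ * Θ
      discrepancy-bound = *-cancelˡ-≤ 2 (begin
          2 * (quart σ * abs (discrepancy (t , d)))  ≡⟨ lem₁ (quart σ) (abs (discrepancy (t , d))) ⟩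
          quart σ * (2 * abs (discrepancy (t , d)))  ≡⟨ cong (quart σ *_) (trans (cong (λ z → 2 * abs z) discrepancy≡) (trans (sym (ℤₚ.abs-* (+ 2) (∑∑ᶻ D))) (cong abs (sym ∑∑R)))) ⟩
          quart σ * abs (∑∑ᶻ R)                      ≤⟨ *-monoʳ-≤ (quart σ) (≤-trans (abs-∑ is (λ i → Z.∑ is (R i))) (∑-mono is (λ i → abs-∑ is (R i)))) ⟩
          quart σ * ∑ is (λ i → ∑ is (λ j → abs (R i j)))
            ≡⟨ trans (sym (∑-*ˡ is (quart σ) (λ i → ∑ is (λ j → abs (R i j))))) (∑-cong is (λ i → sym (∑-*ˡ is (quart σ) (λ j → abs (R i j))))) ⟩
          ∑ is (λ i → ∑ is (λ j → quart σ * abs (R i j)))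
            ≤⟨ ∑-mono∈ is (λ i i∈ → ∑-mono∈ is (λ j j∈ → ≤-trans (*-monoʳ-≤ (quart σ) (product-expansion Φs Qs α β (s i j) (τ i j))) (rem≤ (abs (s i j)) (abs (τ i j)) (displacement i j i∈ j∈)))) ⟩
          ∑ is (λ i → ∑ is (λ j → 2 * Θ * (quart (abs (s i j)) + quart σ)))
            ≡⟨ trans (∑-cong is (λ i → ∑-*ˡ is (2 * Θ) (λ j → quart (abs (s i j)) + quart σ))) (∑-*ˡ is (2 * Θ) (λ i → ∑ is (λ j → quart (abs (s i j)) + quart σ))) ⟩
          2 * Θ * ∑ is (λ i → ∑ is (λ j → quart (abs (s i j)) + quart σ)) ≤⟨ *-monoʳ-≤ (2 * Θ) moments ⟩
          2 * Θ * (16 * n * Z₄) ≡⟨ lem₂ Θ (16 * n * Z₄) ⟩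
          2 * (16 * n * Z₄ * Θ) ∎)
        where
        open ≤-Reasoning
        lem₁ : ∀ a b → 2 * (a * b) ≡ a * (2 * b)
        lem₁ = NS.solve-∀
        lem₂ : ∀ a b → 2 * a * b ≡ 2 * (b * a)
        lem₂ = NS.solve-∀

    module _ (a k : ℕ) (2a+k≡n : a * 2 + k ≡ n) (q-sym : ∀ d → q (-ᶻ + (k * p) -ᶻ d) ≡ q d) where
      private
        ν : ℤ → ℤ × ℤ → ℤ × ℤ
        ν c y = -ᶻ proj₁ y , c -ᶻ proj₂ y

        G-odd : ∀ y → G (ν (-ᶻ + (k * p)) y) ≡ -ᶻ G y
        G-odd y = trans (cong₂ _*ᶻ_ (φ-odd (proj₁ y)) (q-sym (proj₂ y))) (sym (ℤₚ.neg-distribˡ-* (φ (proj₁ y)) (q (proj₂ y))))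

        -- The reflection `ν` carries steps to reversed steps, and its centre moves by `p` with each
        -- of them. At the end point it changes the sign of `G`, hence of the whole average.
        reflected : ∀ l c → (∀ y → G (ν c y) ≡ -ᶻ G y) → ∀ y → Z.E is st⁻ l G (ν (c -ᶻ + l *ᶻ + p) y) ≡ -ᶻ Z.E is st l G y
        reflected zero    c h y = trans (cong (λ z → G (ν z y)) (lem c (+ p))) (h y)
          where
          lem : ∀ c p → c -ᶻ + 0 *ᶻ p ≡ c
          lem = ZS.solve-∀
        reflected (suc l) c h y = trans (Z.∑-cong is (λ i → trans (cong (Z.E is st⁻ l G) (cong₂ _,_ (lem₁ (proj₁ y) (v i)) (lem₂ c (+ l) (+ p) (proj₂ y) (+ i))))
                                                                   (reflected l c h (st i y)))) (∑ᶻ-neg is (λ i → Z.E is st l G (st i y)))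
          where
          lem₁ : ∀ t v → -ᶻ t +ᶻ -ᶻ v ≡ -ᶻ (t +ᶻ v)
          lem₁ = ZS.solve-∀
          lem₂ : ∀ c l p d i → ((c -ᶻ (+ 1 +ᶻ l) *ᶻ p) -ᶻ d) +ᶻ (p -ᶻ i) ≡ (c -ᶻ l *ᶻ p) -ᶻ (d +ᶻ i)
          lem₂ = ZS.solve-∀

        -- The start is a fixed point: its double is `- (n * p)`, of which the `a * 2` steps account
        -- for one part and the symmetry of `q` for the other.
        start : ν (-ᶻ + (k * p) -ᶻ + (a * 2) *ᶻ + p) (+ 0 , d₀) ≡ (+ 0 , d₀)
        start = cong (+ 0 ,_) (trans (cong (_-ᶻ d₀) (trans (cong (λ y → -ᶻ + (k * p) -ᶻ y) (sym (ℤₚ.pos-* (a * 2) p)))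
            (trans (lem₁ (+ (k * p)) (+ (a * 2 * p))) (trans (cong -ᶻ_ (trans (sym (ℤₚ.pos-+ (a * 2 * p) (k * p))) (cong +_ (trans (sym (*-distribʳ-+ p (a * 2) k)) (cong (_* p) 2a+k≡n))))) (sym d₀≡))))) (lem₂ d₀))
          where
          lem₁ : ∀ x y → -ᶻ x -ᶻ y ≡ -ᶻ (y +ᶻ x)
          lem₁ = ZS.solve-∀
          lem₂ : ∀ d → (d +ᶻ d) -ᶻ d ≡ d
          lem₂ = ZS.solve-∀

        Eₐ = Z.E is st (a * 2) G (+ 0 , d₀)

        twice : Eₐ -ᶻ Z.E is st⁻ (a * 2) G (+ 0 , d₀) ≡ + 2 *ᶻ Eₐ
        twice = trans (cong (λ z → Eₐ -ᶻ z) (trans (cong (Z.E is st⁻ (a * 2) G) (sym start)) (reflected (a * 2) (-ᶻ + (k * p)) G-odd (+ 0 , d₀)))) (lem Eₐ)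
          where
          lem : ∀ x → x -ᶻ (-ᶻ x) ≡ + 2 *ᶻ x
          lem = ZS.solve-∀

      -- Reversing all steps both changes the average little and negates it, so twice the average is
      -- bounded by the total cost of the swaps.
      lindeberg : quart σ * abs Eₐ ≤ 4 * (n ^ (a * 2) * (Z₄ * Θ))
      lindeberg = *-cancelˡ-≤ (2 * (n * n)) (begin
          2 * (n * n) * (quart σ * abs Eₐ)  ≡⟨ lem₁ (n * n) (quart σ) (abs Eₐ) ⟩
          n * n * (quart σ * (2 * abs Eₐ))  ≡⟨ cong (λ z → n * n * (quart σ * z)) (trans (sym (ℤₚ.abs-* (+ 2) Eₐ)) (cong abs (sym twice))) ⟩
          n * n * (quart σ * abs (Eₐ -ᶻ Z.E is st⁻ (a * 2) G (+ 0 , d₀)))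
            ≤⟨ subst (λ l → l * l * (quart σ * abs (Eₐ -ᶻ Z.E is st⁻ (a * 2) G (+ 0 , d₀))) ≤ a * (l ^ (a * 2) * (16 * n * Z₄ * Θ))) (length-rng n)
                     (swap-bound {quart σ} {16 * n * Z₄ * Θ} (λ y → discrepancy-bound (proj₁ y) (proj₂ y)) a (+ 0 , d₀)) ⟩
          a * (n ^ (a * 2) * (16 * n * Z₄ * Θ)) ≡⟨ lem₂ a (n ^ (a * 2)) n Z₄ Θ ⟩
          a * 2 * (8 * n * (n ^ (a * 2) * (Z₄ * Θ))) ≤⟨ *-monoˡ-≤ _ (≤-trans (m≤m+n (a * 2) k) (≤-reflexive 2a+k≡n)) ⟩
          n * (8 * n * (n ^ (a * 2) * (Z₄ * Θ))) ≡⟨ lem₃ n (n ^ (a * 2) * (Z₄ * Θ)) ⟩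
          2 * (n * n) * (4 * (n ^ (a * 2) * (Z₄ * Θ))) ∎)
        where
        open ≤-Reasoning
        lem₁ : ∀ m s e → 2 * m * (s * e) ≡ m * (s * (2 * e))
        lem₁ = NS.solve-∀
        lem₂ : ∀ a x n z t → a * (x * (16 * n * z * t)) ≡ a * 2 * (8 * n * (x * (z * t)))
        lem₂ = NS.solve-∀
        lem₃ : ∀ n x → n * (8 * n * x) ≡ 2 * (n * n) * (4 * x)
        lem₃ = NS.solve-∀

  -- Anticoncentration of the margin

  floor-bound : ∀ {X M a} .{{_ : NonZero M}} → a * M ≤ X → a ≤ X / M
  floor-bound {X} {M} {a} h = subst (_≤ X / M) (m*n/n≡m a M) (/-monoˡ-≤ M h)

  abstract
    -- 2049 = 1 + 2048, where 2048 = 16² · 8 comes from `n ≤ 16 * e` and `n ≤ 8 * k`.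
    C₁ : ℕ
    C₁ = 2049 * K

    C₁≡ : C₁ ≡ 2049 * K
    C₁≡ = refl

  sg : ℕ → ℕ → ℤ
  sg a b = + ind (b <? a) -ᶻ + ind (a <? b)

  sg-gt : ∀ {a b} → b < a → sg a b ≡ + 1
  sg-gt {a} {b} h = cong₂ (λ x y → + x -ᶻ + y) (ind-yes (b <? a) h) (ind-no (a <? b) (<-asym h))

  sg-lt : ∀ {a b} → a < b → sg a b ≡ -[1+ 0 ]
  sg-lt {a} {b} h = cong₂ (λ x y → + x -ᶻ + y) (ind-no (b <? a) (<-asym h)) (ind-yes (a <? b) h)

  grid-window : ∀ w Y r → 2 * Y < r * w → ∀ T → ind (abs T ≤? Y) ≤ ∑ (grid w (+ Y) r) (λ t → win w (t +ᶻ T))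
  grid-window w Y r h T with abs T ≤? Y
  ... | no  _ = z≤n
  ... | yes q with T +ᶻ + Y in eq | nonneg T q
    where
    nonneg : ∀ T → abs T ≤ Y → + 0 ≤ᶻ T +ᶻ + Y × T +ᶻ + Y ≤ᶻ + (2 * Y)
    nonneg (+ a)    q = ℤ.+≤+ z≤n , ℤ.+≤+ (≤-trans (+-monoˡ-≤ Y q) (≤-reflexive (cong (_+_ Y) (sym (+-identityʳ Y)))))
    nonneg -[1+ a ] q = subst (+ 0 ≤ᶻ_) (sym (ℤₚ.⊖-≥ q)) (ℤ.+≤+ z≤n) , ℤₚ.≤-trans (ℤₚ.≤-reflexive (ℤₚ.⊖-≥ q)) (ℤ.+≤+ (≤-trans (m∸n≤m Y (suc a)) (m≤m+n Y _)))
  ... | + a | _ , ℤ.+≤+ a≤ = ≤-trans (grid-cover w (+ Y) r {T} eq (≤-<-trans a≤ h))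
          (≤-reflexive (∑-cong (grid w (+ Y) r) {λ t → win w (T +ᶻ t)} (λ t → cong (win w) (ℤₚ.+-comm T t))))

  module Anticoncentration {p : ℕ} (S : Scale p) where
    open Density S

    private
      -- About half of the coordinates, in `k` pairs, drive Littlewood-Offord; the other `m` are at
      -- least half, as the density bound demands for meeting the sum constraint.
      quarter : ∃[ k ] ∃[ m ] k * 2 + m ≡ n × n ≤ 2 * m + 1 × n ≤ 8 * k
      quarter with halve n
      ... | q , f , eq , f≤1 with halve q
      ... | k , f′ , refl , f′≤1 = k , k * 2 + (f′ * 2 + f) , trans (lem₁ k f f′) (sym eq) ,
          ≤-trans (≤-reflexive eq) (≤-trans (m≤m+n _ (f′ * 2 + f + 1)) (≤-reflexive (lem₂ k f f′))) ,
          large k (≤-trans (≤-reflexive eq) (≤-trans (+-mono-≤ (*-monoˡ-≤ 2 (+-monoʳ-≤ (k * 2) f′≤1)) f≤1) (≤-reflexive (lem₃ k))))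
        where
        lem₁ : ∀ k f f′ → k * 2 + (k * 2 + (f′ * 2 + f)) ≡ (k * 2 + f′) * 2 + f
        lem₁ = NS.solve-∀
        lem₂ : ∀ k f f′ → (k * 2 + f′) * 2 + f + (f′ * 2 + f + 1) ≡ 2 * (k * 2 + (f′ * 2 + f)) + 1
        lem₂ = NS.solve-∀
        lem₃ : ∀ k → (k * 2 + 1) * 2 + 1 ≡ 4 * k + 3
        lem₃ = NS.solve-∀
        large : ∀ k → n ≤ 4 * k + 3 → n ≤ 8 * k
        large zero    h = ⊥-elim (<⇒≱ (s≤s (≤-trans h (≤-refl {3}))) (≤-trans (m≤m+n 4 12) 16≤n))
        large (suc k) h = ≤-trans h (≤-trans (+-monoʳ-≤ (4 * suc k) (≤-trans (n≤1+n 3) (m≤m+n 4 (4 * k)))) (≤-reflexive (lem k)))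
          where
          lem : ∀ k → 4 * suc k + (4 + 4 * k) ≡ 8 * suc k
          lem = NS.solve-∀

    1≤e : 1 ≤ e
    1≤e = factor-pos 16 e (≤-trans (s≤s z≤n) n≤16e)

    module Window (v : ℕ → ℤ) (o₁ o₂ o₃ o₄ w : ℕ)
                  (h₁ : o₁ + e ≤ o₃) (h₃ : o₃ + e ≤ n) (h₂ : o₂ + e ≤ n) (h₄ : o₄ + e ≤ n)
                  (same : ∀ x y → +s (o₁ + x) +ᶻ +s (o₂ + y) ≡ +s (o₃ + x) +ᶻ +s (o₄ + y)) where
      open Couples n e v +s o₁ o₂ o₃ o₄ w h₁ h₃ h₂ h₄ same public

      private
        st = step v +s
        β = n * n ∸ 2 * good
        total : n * n ≡ 2 * good + β
        total = good-total {n} {e} 8e≤n (∑e-ind≤ e (λ x y → w ≤? gap x y))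

      module _ (many : e * e ≤ 2 * good) (r : ℕ) where
        private
          module Split (k m : ℕ) (k2+m≡n : k * 2 + m ≡ n) (m-large : n ≤ 2 * m + 1) (k-large : n ≤ 8 * k) where
            instance
              nz : NonZero (n ^ (k * 2))
              nz = m^n≢0 n (k * 2)
            -- The density bound has to be a natural number here. Flooring loses nothing for the
            -- base case, which bounds an integer, and goes the right way when multiplied back.
            Q = K * N / n ^ (k * 2)
            F : ℤ × ℤ → ℕ
            F y = win w (proj₁ y) * δ (proj₂ y)

            base : Bounded w (Φ good β Q 0) (E is st m F)
            base = Bounded-base is v +s good β m δ (λ d → ≤-trans (≤-reflexive (E-project is st st₁ proj₂ (λ _ _ → refl) m δ (+ 0 , d)))
              (floor-bound {K * N} {n ^ (k * 2)} (completions m (k * 2) (trans (+-comm m (k * 2)) k2+m≡n) m-large d)))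

            count : ∀ x → ∑ (grid w x r) (λ t → E is st n F (t , d₀)) ≤ Φ good β Q k r
            count x = begin
              ∑ (grid w x r) (λ t → E is st n F (t , d₀))
                ≡⟨ ∑-cong (grid w x r) (λ t → trans (cong (λ l → E is st l F (t , d₀)) (sym k2+m≡n)) (E-add is st (k * 2) m F (t , d₀))) ⟩
              ∑ (grid w x r) (λ t → E is st (k * 2) (E is st m F) (t , d₀))
                ≤⟨ Bounded-walk total {Q} base k d₀ (Sep-grid w x r) ⟩
              Φ good β Q k (length (grid w x r)) ≡⟨ cong (Φ good β Q k) (length-grid w x r) ⟩
              Φ good β Q k r ∎
              where open ≤-Reasoning

            1≤k : 1 ≤ k
            1≤k = factor-pos 8 k (≤-trans (s≤s z≤n) k-large)
            1≤good : 1 ≤ good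
            1≤good = factor-pos 2 good (≤-trans (*-mono-≤ 1≤e 1≤e) many)

            -- `Φ-bound` at `R = σ`, of order √k; with at least half of the couples good, `good` is
            -- comparable to `n * n` and cancels.
            Φ≤ : σ * Φ good β Q k r ≤ C₁ * (N * r)
            Φ≤ = *-cancelˡ-≤ (2 * (good * k)) {{>-nonZero (*-mono-≤ {1} {2} {1} {good * k} (s≤s z≤n) (*-mono-≤ 1≤good 1≤k))}} (begin
              2 * (good * k) * (σ * Φ good β Q k r)   ≡⟨ lem₁ good k σ (Φ good β Q k r) ⟩
              k * (2 * good) * σ * Φ good β Q k r     ≤⟨ Φ-bound good β Q σ k r ⟩
              Q * (2 * good + β) ^ k * (2 * good * k * r + (2 * good + β) * σ * σ * r)
                ≡⟨ cong (λ V → Q * V ^ k * (2 * good * k * r + V * σ * σ * r)) (sym total) ⟩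
              Q * (n * n) ^ k * (2 * good * k * r + n * n * σ * σ * r)
                ≡⟨ cong₂ (λ a b → Q * a * (2 * good * k * r + b)) (n^2k n k) (lem₂ n σ r) ⟩
              Q * n ^ (k * 2) * (2 * good * k * r + n * n * (σ * σ) * r)
                ≤⟨ *-mono-≤ (m/n*n≤m (K * N) (n ^ (k * 2))) (+-monoʳ-≤ (2 * good * k * r) (*-monoˡ-≤ r (*-mono-≤ (*-mono-≤ n≤16e n≤16e) (≤-trans σ²≤n k-large)))) ⟩
              K * N * (2 * good * k * r + 16 * e * (16 * e) * (8 * k) * r)
                ≡⟨ cong (λ z → K * N * (2 * good * k * r + z)) (lem₃ e k r) ⟩
              K * N * (2 * good * k * r + 2048 * (e * e) * k * r)
                ≤⟨ *-monoʳ-≤ (K * N) (+-monoʳ-≤ (2 * good * k * r) (*-monoˡ-≤ r (*-monoˡ-≤ k (*-monoʳ-≤ 2048 many)))) ⟩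
              K * N * (2 * good * k * r + 2048 * (2 * good) * k * r) ≡⟨ lem₄ K N good k r ⟩
              2 * (good * k) * (2049 * K * (N * r)) ≡⟨ cong (λ c → 2 * (good * k) * (c * (N * r))) C₁≡ ⟨
              2 * (good * k) * (C₁ * (N * r)) ∎)
              where
              open ≤-Reasoning
              lem₁ : ∀ g k σ F → 2 * (g * k) * (σ * F) ≡ k * (2 * g) * σ * F
              lem₁ = NS.solve-∀
              lem₂ : ∀ n σ r → n * n * σ * σ * r ≡ n * n * (σ * σ) * r
              lem₂ = NS.solve-∀
              lem₃ : ∀ e k r → 16 * e * (16 * e) * (8 * k) * r ≡ 2048 * (e * e) * k * r
              lem₃ = NS.solve-∀
              lem₄ : ∀ K N g k r → K * N * (2 * g * k * r + 2048 * (2 * g) * k * r) ≡ 2 * (g * k) * (2049 * K * (N * r))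
              lem₄ = NS.solve-∀

        window : ∀ Y → 2 * Y < r * w → σ * E is st n (λ y → ind (abs (proj₁ y) ≤? Y) * δ (proj₂ y)) (+ 0 , d₀) ≤ C₁ * (N * r)
        window Y h with quarter
        ... | k , m , eq , m-large , k-large = ≤-trans (*-monoʳ-≤ σ (≤-trans covered (Split.count k m eq m-large k-large (+ Y)))) (Split.Φ≤ k m eq m-large k-large)
          where
          open ≤-Reasoning
          F : ℤ × ℤ → ℕ
          F y = win w (proj₁ y) * δ (proj₂ y)
          covered : E is st n (λ y → ind (abs (proj₁ y) ≤? Y) * δ (proj₂ y)) (+ 0 , d₀) ≤ ∑ (grid w (+ Y) r) (λ t → E is st n F (t , d₀))
          covered = begin
            E is st n (λ y → ind (abs (proj₁ y) ≤? Y) * δ (proj₂ y)) (+ 0 , d₀)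
              ≤⟨ E-mono is st n (λ y → *-monoˡ-≤ (δ (proj₂ y)) (grid-window w Y r h (proj₁ y))) (+ 0 , d₀) ⟩
            E is st n (λ y → ∑ (grid w (+ Y) r) (λ t → win w (t +ᶻ proj₁ y)) * δ (proj₂ y)) (+ 0 , d₀)
              ≡⟨ E-cong is st n (λ y → sym (∑-*ʳ (grid w (+ Y) r) (δ (proj₂ y)) (λ t → win w (t +ᶻ proj₁ y)))) (+ 0 , d₀) ⟩
            E is st n (λ y → ∑ (grid w (+ Y) r) (λ t → win w (t +ᶻ proj₁ y) * δ (proj₂ y))) (+ 0 , d₀)
              ≡⟨ E-∑ is st (grid w (+ Y) r) n (λ t y → win w (t +ᶻ proj₁ y) * δ (proj₂ y)) (+ 0 , d₀) ⟩
            ∑ (grid w (+ Y) r) (λ t → E is st n (λ y → win w (t +ᶻ proj₁ y) * δ (proj₂ y)) (+ 0 , d₀))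
              ≡⟨ ∑-cong (grid w (+ Y) r) (λ t → sym (E-shift-t is v +s n F t d₀)) ⟩
            ∑ (grid w (+ Y) r) (λ t → E is st n F (t , d₀)) ∎

    private
      same-offsets : ∀ {a b c d} → a + b ≡ c + d → ∀ x y → +s (a + x) +ᶻ +s (b + y) ≡ +s (c + x) +ᶻ +s (d + y)
      same-offsets {a} {b} {c} {d} eq x y = cong +_ (trans (lem a x b y) (trans (cong (_+ (x + y)) eq) (sym (lem c x d y))))
        where
        lem : ∀ a x b y → a + x + (b + y) ≡ a + b + (x + y)
        lem = NS.solve-∀

      ineq : ∀ {a b} → suc a ≡ b → a * e + e ≤ b * e
      ineq {a} refl = ≤-reflexive (+-comm (a * e) e)

    -- Octants are blocks of e consecutive faces: a couple moves one coordinate up and another one down by 4e.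
    module WindowB (h : ℕ → ℤ) (w : ℕ) =
      Window h (0 * e) (6 * e) (4 * e) (2 * e) w
        (m≤m+n e (3 * e)) (octant {n} {e} 8e≤n 4 (m≤m+n 5 3)) (octant {n} {e} 8e≤n 6 (m≤m+n 7 1)) (octant {n} {e} 8e≤n 2 (m≤m+n 3 5))
        (same-offsets {0 * e} {6 * e} {4 * e} {2 * e} (trans (sym (*-distribʳ-+ e 0 6)) (*-distribʳ-+ e 4 2)))

    -- The contribution of one face `i` of A to the gap of the couple (x, y) for B. It turns the
    -- oscillation of the profile of A into a walk over the faces of A.
    ω : ℕ → ℕ → ℕ → ℤ
    ω x y i = (sg i (0 * e + x) +ᶻ sg i (6 * e + y)) -ᶻ (sg i (4 * e + x) +ᶻ sg i (2 * e + y))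

    -- The blocks 1, 7, 5, 3 for the faces of A interlace the blocks 0, 6, 4, 2 of the four jumps of
    -- `ω`, so every comparison is decided by the blocks alone and every couple is good.
    module WindowA (x y : ℕ) (x<e : x < e) (y<e : y < e) where
      open Window (ω x y) (1 * e) (7 * e) (5 * e) (3 * e) 4
        (≤-trans (ineq {1} {2} refl) (*-monoˡ-≤ e (m≤m+n 2 3))) (octant {n} {e} 8e≤n 5 (m≤m+n 6 2)) (octant {n} {e} 8e≤n 7 (m≤m+n 8 0)) (octant {n} {e} 8e≤n 3 (m≤m+n 4 4))
        (same-offsets {1 * e} {7 * e} {5 * e} {3 * e} (trans (sym (*-distribʳ-+ e 1 7)) (*-distribʳ-+ e 5 3))) public

      private
        below : ∀ {a b x} y → suc a ≤ b → x < e → a * e + x < b * e + y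
        below {a} {b} {x} y a<b x<e = ≤-trans (+-monoʳ-< (a * e) x<e) (≤-trans (≤-reflexive (+-comm (a * e) e)) (≤-trans (*-monoˡ-≤ e a<b) (m≤m+n (b * e) y)))

        -- On the blocks 1, 7, 5, 3 the function `ω x y` takes the values 2, 0, -2, 0, and 2 + 0
        -- exceeds -2 + 0 by 4.
        gap≡4 : ∀ x′ y′ → x′ < e → y′ < e → gap x′ y′ ≡ 4
        gap≡4 x′ y′ x′<e y′<e = cong abs (cong₂ _-ᶻ_ (cong₂ _+ᶻ_
            (quad (sg-gt (below {0} {1} x′ (m≤m+n 1 0) x<e)) (sg-lt (below {1} {6} y (m≤m+n 2 4) x′<e)) (sg-lt (below {1} {4} x (m≤m+n 2 2) x′<e)) (sg-lt (below {1} {2} y (m≤m+n 2 0) x′<e)))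
            (quad (sg-gt (below {0} {7} y′ (m≤m+n 1 6) x<e)) (sg-gt (below {6} {7} y′ (m≤m+n 7 0) y<e)) (sg-gt (below {4} {7} y′ (m≤m+n 5 2) x<e)) (sg-gt (below {2} {7} y′ (m≤m+n 3 4) y<e))))
          (cong₂ _+ᶻ_
            (quad (sg-gt (below {0} {5} x′ (m≤m+n 1 4) x<e)) (sg-lt (below {5} {6} y (m≤m+n 6 0) x′<e)) (sg-gt (below {4} {5} x′ (m≤m+n 5 0) x<e)) (sg-gt (below {2} {5} x′ (m≤m+n 3 2) y<e)))
            (quad (sg-gt (below {0} {3} y′ (m≤m+n 1 2) x<e)) (sg-lt (below {3} {6} y (m≤m+n 4 2) y′<e)) (sg-lt (below {3} {4} x (m≤m+n 4 0) y′<e)) (sg-gt (below {2} {3} y′ (m≤m+n 3 0) y<e)))))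
          where
          quad : ∀ {a b c d a′ b′ c′ d′ : ℤ} → a ≡ a′ → b ≡ b′ → c ≡ c′ → d ≡ d′ → (a +ᶻ b) -ᶻ (c +ᶻ d) ≡ (a′ +ᶻ b′) -ᶻ (c′ +ᶻ d′)
          quad refl refl refl refl = refl

        good≡ : good ≡ e * e
        good≡ = trans (∑-cong∈ (rng e) (λ x′ x′∈ → ∑-cong∈ (rng e) (λ y′ y′∈ →
                         ind-yes (4 ≤? gap x′ y′) (≤-reflexive (sym (gap≡4 x′ y′ (∈-rng x′∈) (∈-rng y′∈)))))))
                      (trans (∑∑-const e e 1) (cong (e *_) (*-identityʳ e)))

      windowA : ∀ Y r → 2 * Y < r * 4 → σ * E is (step (ω x y) +s) n (λ y → ind (abs (proj₁ y) ≤? Y) * δ (proj₂ y)) (+ 0 , d₀) ≤ C₁ * (N * r)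
      windowA Y r h = window (≤-trans (≤-reflexive (sym good≡)) (m≤m+n good _)) r Y h

  -- Dice as walks

  ∑-cartesianProduct : {A B : Set} (xs : List A) (ys : List B) (f : A × B → ℕ) →
    ∑ (cartesianProduct xs ys) f ≡ ∑ xs (λ x → ∑ ys (λ y → f (x , y)))
  ∑-cartesianProduct []       ys f = refl
  ∑-cartesianProduct (x ∷ xs) ys f = trans (∑-++ (map (x ,_) ys) _ f) (cong₂ _+_ (∑-map (x ,_) ys f) (∑-cartesianProduct xs ys f))

  ∑ᶻ-filter : {A : Set} {P : A → Set} (P? : ∀ x → Dec (P x)) (xs : List A) (f : A → ℤ) →
             Z.∑ (filter P? xs) f ≡ Z.∑ xs (λ x → f x *ᶻ + ind (P? x))
  ∑ᶻ-filter P? []       f = refl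
  ∑ᶻ-filter P? (x ∷ xs) f with P? x
  ... | yes _ = cong₂ _+ᶻ_ (sym (ℤₚ.*-identityʳ (f x))) (∑ᶻ-filter P? xs f)
  ... | no  _ = trans (∑ᶻ-filter P? xs f) (trans (sym (ℤₚ.+-identityˡ _)) (cong (_+ᶻ Z.∑ xs (λ x → f x *ᶻ + ind (P? x))) (sym (ℤₚ.*-zeroʳ (f x)))))

  margin : ∀ {n} → Die n → Die n → ℤ
  margin a b = + #gt a b -ᶻ + #gt b a

  #gt≡ : ∀ {n} (a b : Die n) → #gt a b ≡ ∑ (toList a) (λ x → ∑ (toList b) (λ y → ind (y <? x)))
  #gt≡ a b = trans (length-filter (λ p → proj₂ p <? proj₁ p) (cartesianProduct (toList a) (toList b)))
                   (∑-cartesianProduct (toList a) (toList b) (λ p → ind (proj₂ p <? proj₁ p)))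

  score : ∀ {m} → Vec ℕ m → ℕ → ℤ
  score a y = Z.∑ (toList a) (λ x → sg x y)

  margin≡ : ∀ {n} (a b : Die n) → margin a b ≡ Z.∑ (toList b) (score a)
  margin≡ a b = begin
    + #gt a b -ᶻ + #gt b a
      ≡⟨ cong₂ (λ x y → + x -ᶻ + y) (trans (#gt≡ a b) (∑-swap (toList a) (toList b) (λ x y → ind (y <? x)))) (#gt≡ b a) ⟩
    + ∑ (toList b) (λ y → ∑ (toList a) (λ x → ind (y <? x))) -ᶻ + ∑ (toList b) (λ y → ∑ (toList a) (λ x → ind (x <? y)))
      ≡⟨ cong₂ _-ᶻ_ (trans (+-∑ (toList b) _) (Z.∑-cong (toList b) (λ y → +-∑ (toList a) _))) (trans (+-∑ (toList b) _) (Z.∑-cong (toList b) (λ y → +-∑ (toList a) _))) ⟩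
    Z.∑ (toList b) (λ y → Z.∑ (toList a) (λ x → + ind (y <? x))) -ᶻ Z.∑ (toList b) (λ y → Z.∑ (toList a) (λ x → + ind (x <? y)))
      ≡⟨ ∑ᶻ-minus (toList b) _ _ ⟨
    Z.∑ (toList b) (λ y → Z.∑ (toList a) (λ x → + ind (y <? x)) -ᶻ Z.∑ (toList a) (λ x → + ind (x <? y)))
      ≡⟨ Z.∑-cong (toList b) (λ y → sym (∑ᶻ-minus (toList a) _ _)) ⟩
    Z.∑ (toList b) (score a) ∎
    where open ≡-Reasoning

  module SeqSums {C : Set} {_⊕_ _⊛_ : C → C → C} {0# 1# : C} (isCS : IsCommutativeSemiring _≡_ _⊕_ _⊛_ 0# 1#) where
    private module S = Sum {C} {_⊕_} {_⊛_} {0#} {1#} isCS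

    seqs-E : ∀ n (f g : ℕ → ℤ) m (F : ℤ × ℤ → C) t d →
      S.∑ (seqs m (faces n)) (λ a → F (t +ᶻ Z.∑ (toList a) f , d +ᶻ Z.∑ (toList a) g)) ≡
      S.E (rng n) (step (λ i → f (suc i)) (λ i → g (suc i))) m F (t , d)
    seqs-E n f g zero F t d = trans (IsCS.+-identityʳ _) (cong₂ (λ x y → F (x , y)) (ℤₚ.+-identityʳ t) (ℤₚ.+-identityʳ d))
      where
      module IsCS = IsCommutativeSemiring isCS
    seqs-E n f g (suc m) F t d =
      trans (S.∑-concatMap (λ x → map (x Vec.∷_) (seqs m (faces n))) (faces n) _)
      (trans (S.∑-map suc (upTo n) _)
      (trans (S.∑-upTo n _)
      (S.∑-cong (rng n) (λ i → trans (S.∑-map (suc i Vec.∷_) (seqs m (faces n)) _)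
        (trans (S.∑-cong (seqs m (faces n)) (λ a → cong₂ (λ x y → F (x , y)) (sym (ℤₚ.+-assoc t (f (suc i)) _)) (sym (ℤₚ.+-assoc d (g (suc i)) _))))
               (seqs-E n f g m F (t +ᶻ f (suc i)) (d +ᶻ g (suc i))))))))

  module SeqN = SeqSums +-*-isCommutativeSemiring
  module SeqZ = SeqSums ℤₚ.+-*-isCommutativeSemiring

  AllFaces : ℕ → ∀ {m} → Vec ℕ m → Set
  AllFaces n Vec.[]       = ⊤
  AllFaces n (x Vec.∷ a) = (∃[ i ] i < n × x ≡ suc i) × AllFaces n a

  module _ where
    open import Data.List.Membership.Propositional.Properties using (∈-++⁻; ∈-map⁻; ∈-upTo⁻)
    open import Data.List.Relation.Unary.Any using (Any; here; there)

    private
      ∈-concatMap : {A B : Set} (f : A → List B) (xs : List A) {y : B} → y ∈ concatMap f xs → ∃[ x ] x ∈ xs × y ∈ f x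
      ∈-concatMap f (x ∷ xs) m with ∈-++⁻ (f x) m
      ... | inj₁ l = x , here refl , l
      ... | inj₂ r with ∈-concatMap f xs r
      ... | x′ , x′∈ , y∈ = x′ , there x′∈ , y∈

    seqs-faces : ∀ n m {a} → a ∈ seqs m (faces n) → AllFaces n a
    seqs-faces n zero    (here refl) = tt
    seqs-faces n (suc m) a∈ with ∈-concatMap (λ x → map (x Vec.∷_) (seqs m (faces n))) (faces n) a∈
    ... | x , x∈ , a∈′ with ∈-map⁻ suc x∈ | ∈-map⁻ (x Vec.∷_) a∈′
    ... | i , i∈ , x≡ | a′ , a′∈ , refl = (i , ∈-upTo⁻ i∈ , x≡) , seqs-faces n m a′∈

    dice-seqs : ∀ {n a} → a ∈ dice n → a ∈ seqs n (faces n) × IsBalanced n a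
    dice-seqs {n} = ∈-filter⁻ (λ a → Vec.sum a ≟ (n * suc n) / 2)

  even-product : ∀ n → ∃[ q ] n * suc n ≡ q * 2
  even-product zero    = 0 , refl
  even-product (suc n) with even-product n
  ... | q , eq = q + suc n , trans (lem₁ n) (trans (cong (_+ suc n * 2) eq) (lem₂ q n))
    where
    lem₁ : ∀ n → suc n * suc (suc n) ≡ n * suc n + suc n * 2
    lem₁ = NS.solve-∀
    lem₂ : ∀ q n → q * 2 + suc n * 2 ≡ (q + suc n) * 2
    lem₂ = NS.solve-∀

  target : ℕ → ℕ
  target n = (n * suc n) / 2

  2target : ∀ n → target n * 2 ≡ n * suc n
  2target n with even-product n
  ... | q , eq = trans (cong (_* 2) (trans (cong (_/ 2) eq) (m*n/n≡m q 2))) (sym eq)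

  offset : ∀ x → ℤ
  offset x = + x -ᶻ + 1

  sum-offset : ∀ {m} (a : Vec ℕ m) → Z.∑ (toList a) offset ≡ + Vec.sum a -ᶻ + m
  sum-offset Vec.[]       = refl
  sum-offset {suc m} (x Vec.∷ a) = trans (cong (offset x +ᶻ_) (sum-offset a)) (trans (lem (+ x) (+ Vec.sum a) (+ m)) (cong (λ z → z -ᶻ (+ 1 +ᶻ + m)) (sym (ℤₚ.pos-+ x (Vec.sum a)))))
    where
    lem : ∀ x s m → (x -ᶻ + 1) +ᶻ (s -ᶻ m) ≡ (x +ᶻ s) -ᶻ (+ 1 +ᶻ m)
    lem = ZS.solve-∀

  length-toList : ∀ {m} (a : Vec ℕ m) → length (toList a) ≡ m
  length-toList Vec.[]       = refl
  length-toList (x Vec.∷ a) = cong suc (length-toList a)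

  -- The offsets of the `n` faces add up to their sum minus `n`, so a walk from here ends at the sum
  -- minus its target.
  origin : ℕ → ℤ
  origin p = + suc p -ᶻ + target (suc p)

  origin-center : ∀ p → origin p +ᶻ origin p ≡ Unimodal.c p (suc p)
  origin-center p = trans (lem₁ (+ suc p) (+ target (suc p))) (trans (cong (λ z → + suc p +ᶻ + suc p -ᶻ z) (trans (sym (ℤₚ.pos-* (target (suc p)) 2)) (trans (cong +_ (2target (suc p))) (ℤₚ.pos-* (suc p) (suc (suc p))))))
      (trans (lem₂ (+ suc p) (+ p)) (cong -ᶻ_ (sym (ℤₚ.pos-* (suc p) p)))))
    where
    lem₁ : ∀ n t → (n -ᶻ t) +ᶻ (n -ᶻ t) ≡ n +ᶻ n -ᶻ t *ᶻ + 2
    lem₁ = ZS.solve-∀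
    lem₂ : ∀ n p → n +ᶻ n -ᶻ n *ᶻ (+ 1 +ᶻ (+ 1 +ᶻ p)) ≡ -ᶻ (n *ᶻ p)
    lem₂ = ZS.solve-∀

  sg-suc : ∀ a b → sg (suc a) (suc b) ≡ sg a b
  sg-suc a b = cong₂ (λ x y → + x -ᶻ + y) (ind-cong (suc b <? suc a) (b <? a) s≤s⁻¹ s≤s) (ind-cong (suc a <? suc b) (a <? b) s≤s⁻¹ s≤s)

  sg-refl : ∀ a → sg a a ≡ + 0
  sg-refl a = ℤₚ.+-inverseʳ (+ ind (a <? a))

  sg-anti : ∀ a b → sg a b ≡ -ᶻ sg b a
  sg-anti a b = lem (+ ind (b <? a)) (+ ind (a <? b))
    where
    lem : ∀ x y → x -ᶻ y ≡ -ᶻ (y -ᶻ x)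
    lem = ZS.solve-∀

  ∑-sg : ∀ k l → Z.∑ (rng (suc k + l)) (sg k) ≡ + k -ᶻ + l
  ∑-sg k zero    = trans (cong (λ z → Z.∑ (rng z) (sg k)) (+-identityʳ (suc k))) (trans (cong₂ _+ᶻ_ (sg-refl k) (lower k ≤-refl)) (trans (ℤₚ.+-identityˡ (+ k)) (sym (ℤₚ.+-identityʳ (+ k)))))
    where
    lower : ∀ j → j ≤ k → Z.∑ (rng j) (sg k) ≡ + j
    lower zero    h = refl
    lower (suc j) h = cong₂ _+ᶻ_ (sg-gt h) (lower j (<⇒≤ h))
  ∑-sg k (suc l) = trans (cong (λ z → Z.∑ (rng z) (sg k)) (+-suc (suc k) l)) (trans (cong₂ _+ᶻ_ (sg-lt {k} {suc k + l} (s≤s (m≤m+n k l))) (∑-sg k l)) (lem (+ k) (+ l)))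
    where
    lem : ∀ k l → -[1+ 0 ] +ᶻ (k -ᶻ l) ≡ k -ᶻ (+ 1 +ᶻ l)
    lem = ZS.solve-∀

  module Dice {p : ℕ} (S : Scale p) (d₀≡origin : Scale.d₀ S ≡ origin p) where
    open Density S

    private
      ∑sg : ∀ k → k < n → Z.∑ is (λ i → sg (suc k) (suc i)) ≡ u k
      ∑sg k (s≤s k≤p) = trans (Z.∑-cong is (λ i → sg-suc k i)) (trans (cong (λ z → Z.∑ (rng z) (sg k)) (cong suc (sym (m+[n∸m]≡n k≤p))))
          (trans (∑-sg k (p ∸ k)) (trans (cong (λ z → + k -ᶻ z) (trans (sym (ℤₚ.⊖-≥ k≤p)) (sym (ℤₚ.m-n≡m⊖n p k)))) (lem (+ k) (+ p)))))
        where
        lem : ∀ k p → k -ᶻ (p -ᶻ k) ≡ (k +ᶻ k) -ᶻ p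
        lem = ZS.solve-∀

    -- Adding the bias, which sums to 0 over a balanced die, centres the score without changing margins.
    bias : ℕ → ℤ
    bias x = (offset x +ᶻ offset x) -ᶻ + p

    private
      bias-suc : ∀ i → bias (suc i) ≡ u i
      bias-suc i = refl

      ∑-bias : ∀ {m} (a : Vec ℕ m) → Z.∑ (toList a) bias ≡ (Z.∑ (toList a) offset +ᶻ Z.∑ (toList a) offset) -ᶻ + m *ᶻ + p
      ∑-bias {m} a = trans (∑ᶻ-minus (toList a) _ _) (cong₂ _-ᶻ_ (Z.∑-+ (toList a) offset offset) (trans (∑ᶻ-const (toList a) (+ p)) (cong (λ l → + l *ᶻ + p) (length-toList a))))

    balanced-bias : ∀ (a : Die n) → IsBalanced n a → Z.∑ (toList a) bias ≡ + 0
    balanced-bias a bal = trans (∑-bias a) (trans (cong (λ z → (z +ᶻ z) -ᶻ + n *ᶻ + p) (trans (sum-offset a) (trans (cong (λ z → + z -ᶻ + n) bal) (lem₁ (+ target n) (+ n)))))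
        (trans (lem₂ (origin p) (+ n *ᶻ + p)) (trans (cong (λ z → -ᶻ z -ᶻ + n *ᶻ + p) (trans (origin-center p) (cong -ᶻ_ (ℤₚ.pos-* n p)))) (lem₃ (+ n *ᶻ + p)))))
      where
      lem₁ : ∀ t n → t -ᶻ n ≡ -ᶻ (n -ᶻ t)
      lem₁ = ZS.solve-∀
      lem₂ : ∀ s q → (-ᶻ s +ᶻ -ᶻ s) -ᶻ q ≡ -ᶻ (s +ᶻ s) -ᶻ q
      lem₂ = ZS.solve-∀
      lem₃ : ∀ q → -ᶻ (-ᶻ q) -ᶻ q ≡ + 0
      lem₃ = ZS.solve-∀

    centred : Die n → ℕ → ℤ
    centred a y = score a y +ᶻ bias y

    profile : Die n → ℕ → ℤ
    profile a i = centred a (suc i)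

    margin-centred : ∀ (a b : Die n) → IsBalanced n b → margin a b ≡ Z.∑ (toList b) (centred a)
    margin-centred a b bal = trans (margin≡ a b) (sym (trans (Z.∑-+ (toList b) (score a) bias)
        (trans (cong (Z.∑ (toList b) (score a) +ᶻ_) (balanced-bias b bal)) (ℤₚ.+-identityʳ _))))

    private
      ∑-score : ∀ {m} (a : Vec ℕ m) → AllFaces n a → Z.∑ is (λ i → score a (suc i)) ≡ Z.∑ (toList a) bias
      ∑-score a h = trans (Z.∑-swap is (toList a) (λ i x → sg x (suc i))) (go a h)
        where
        go : ∀ {m} (a : Vec ℕ m) → AllFaces n a → Z.∑ (toList a) (λ x → Z.∑ is (λ i → sg x (suc i))) ≡ Z.∑ (toList a) bias
        go Vec.[] h = refl
        go (.(suc i) Vec.∷ a) ((i , i<n , refl) , h) = cong₂ _+ᶻ_ (trans (∑sg i i<n) (sym (bias-suc i))) (go a h)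

    -- Double counting: the comparisons of a face of A with all `n` faces add up to its bias, and
    -- the biases of A cancel because A is balanced.
    ∑-profile : ∀ a → a ∈ dice n → Z.∑ is (profile a) ≡ + 0
    ∑-profile a a∈ with dice-seqs a∈
    ... | a∈seqs , bal = trans (Z.∑-+ is (λ i → score a (suc i)) (λ i → bias (suc i))) (cong₂ _+ᶻ_
        (trans (∑-score a (seqs-faces n n a∈seqs)) (balanced-bias a bal)) (trans (Z.∑-cong is bias-suc) ∑u))

    private
      balanced-δ : ∀ (a : Die n) → ind (Vec.sum a ≟ target n) ≡ δ (d₀ +ᶻ Z.∑ (toList a) offset)
      balanced-δ a = ind-cong (Vec.sum a ≟ target n) (_ ℤₚ.≟ + 0)
          (λ eq → trans pt (trans (cong (λ z → + z -ᶻ + target n) eq) (ℤₚ.+-inverseʳ (+ target n))))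
          (λ eq → ℤₚ.+-injective (ℤₚ.i-j≡0⇒i≡j (+ Vec.sum a) (+ target n) (trans (sym pt) eq)))
        where
        lem : ∀ n t s → (n -ᶻ t) +ᶻ (s -ᶻ n) ≡ s -ᶻ t
        lem = ZS.solve-∀
        pt : d₀ +ᶻ Z.∑ (toList a) offset ≡ + Vec.sum a -ᶻ + target n
        pt = trans (cong₂ _+ᶻ_ d₀≡origin (sum-offset a)) (lem (+ n) (+ target n) (+ Vec.sum a))

    ∑-dice : ∀ (f : ℕ → ℤ) (Ψ : ℤ → ℕ) →
      ∑ (dice n) (λ a → Ψ (Z.∑ (toList a) f)) ≡ E is (step (λ i → f (suc i)) +s) n (λ y → Ψ (proj₁ y) * δ (proj₂ y)) (+ 0 , d₀)
    ∑-dice f Ψ = trans (∑-filter (λ a → Vec.sum a ≟ target n) (seqs n (faces n)) _)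
      (trans (∑-cong (seqs n (faces n)) (λ a → trans (*-comm (ind (Vec.sum a ≟ target n)) _)
                (cong₂ _*_ (cong Ψ (sym (ℤₚ.+-identityˡ _))) (balanced-δ a))))
             (SeqN.seqs-E n f offset n (λ y → Ψ (proj₁ y) * δ (proj₂ y)) (+ 0) d₀))

    ∑ᶻ-dice : ∀ (f : ℕ → ℤ) (Ψ : ℤ → ℤ) →
      Z.∑ (dice n) (λ a → Ψ (Z.∑ (toList a) f)) ≡ Z.E is (step (λ i → f (suc i)) +s) n (λ y → Ψ (proj₁ y) *ᶻ + δ (proj₂ y)) (+ 0 , d₀)
    ∑ᶻ-dice f Ψ = trans (∑ᶻ-filter (λ a → Vec.sum a ≟ target n) (seqs n (faces n)) _)
      (trans (Z.∑-cong (seqs n (faces n)) (λ a → cong₂ _*ᶻ_ (cong Ψ (sym (ℤₚ.+-identityˡ _))) (cong +_ (balanced-δ a))))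
             (SeqZ.seqs-E n f offset n (λ y → Ψ (proj₁ y) *ᶻ + δ (proj₂ y)) (+ 0) d₀))

    length-dice : length (dice n) ≡ N
    length-dice = begin
      length (dice n)                  ≡⟨ *-identityʳ _ ⟨
      length (dice n) * 1              ≡⟨ ∑-const (dice n) 1 ⟨
      ∑ (dice n) (λ _ → 1)             ≡⟨ ∑-dice (λ _ → + 0) (λ _ → 1) ⟩
      E is (step (λ _ → + 0) +s) n (λ y → 1 * δ (proj₂ y)) (+ 0 , d₀)  ≡⟨ E-project is (step (λ _ → + 0) +s) st₁ proj₂ (λ _ _ → refl) n (λ d → 1 * δ d) (+ 0 , d₀) ⟩
      E is st₁ n (λ d → 1 * δ d) d₀    ≡⟨ E-cong is st₁ n (λ d → *-identityˡ (δ d)) d₀ ⟩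
      N ∎
      where open ≡-Reasoning

    -- For fixed A, the margins against all dice B become the first coordinate of a walk with steps
    -- `profile a`; the second coordinate enforces the balance of B.
    ∑-margins : ∀ a (Ψ : ℤ → ℕ) → ∑ (dice n) (λ b → Ψ (margin a b)) ≡ E is (step (profile a) +s) n (λ y → Ψ (proj₁ y) * δ (proj₂ y)) (+ 0 , d₀)
    ∑-margins a Ψ = trans (∑-cong∈ (dice n) (λ b b∈ → cong Ψ (margin-centred a b (proj₂ (dice-seqs b∈))))) (∑-dice (centred a) Ψ)

    ∑ᶻ-margins : ∀ a (Ψ : ℤ → ℤ) → Z.∑ (dice n) (λ b → Ψ (margin a b)) ≡ Z.E is (step (profile a) +s) n (λ y → Ψ (proj₁ y) *ᶻ + δ (proj₂ y)) (+ 0 , d₀)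
    ∑ᶻ-margins a Ψ = trans (Z.∑-cong∈ (dice n) (λ b b∈ → cong Ψ (margin-centred a b (proj₂ (dice-seqs b∈))))) (∑ᶻ-dice (centred a) Ψ)

    -- n times the profile at i is a sum over the faces x of a of the centred terms n sg x (i + 1) + u i.
    profile-fourth-moment : ∀ i → i < n → ∑ (dice n) (λ a → q4 (profile a i)) ≤ 1024 * K * (N * (n * n))
    profile-fourth-moment i i<n = *-cancelˡ-≤ (quart n) {{>-nonZero (*-mono-≤ {1} {n * n} {1} {n * n} (s≤s z≤n) (s≤s z≤n))}} (begin
        quart n * ∑ (dice n) (λ a → q4 (profile a i))   ≡⟨ ∑-*ˡ (dice n) (quart n) _ ⟨
        ∑ (dice n) (λ a → quart n * q4 (profile a i))   ≡⟨ ∑-cong (dice n) (λ a → trans (q4-scale (profile a i)) (cong q4 (scaled a))) ⟩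
        ∑ (dice n) (λ a → q4 (Z.∑ (toList a) z))         ≡⟨ ∑-dice z q4 ⟩
        E is (step (λ k → z (suc k)) +s) n (λ y → q4 (proj₁ y) * δ (proj₂ y)) (+ 0 , d₀)
          ≤⟨ balanced-fourth-moment (λ k → z (suc k)) (2 * n) ∑z z≤ ⟩
        64 * K * (N * (n * n * (2 * n * (2 * n) * (2 * n * (2 * n))))) ≡⟨ lem K N n ⟩
        quart n * (1024 * K * (N * (n * n))) ∎)
      where
      open ≤-Reasoning
      z : ℕ → ℤ
      z x = + n *ᶻ sg x (suc i) +ᶻ u i
      lem : ∀ K N n → 64 * K * (N * (n * n * (2 * n * (2 * n) * (2 * n * (2 * n))))) ≡ n * n * (n * n) * (1024 * K * (N * (n * n)))
      lem = NS.solve-∀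
      q4-scale : ∀ x → quart n * q4 x ≡ q4 (+ n *ᶻ x)
      q4-scale x = trans (lem′ n (abs x)) (cong (λ y → y * y * (y * y)) (sym (ℤₚ.abs-* (+ n) x)))
        where
        lem′ : ∀ n x → n * n * (n * n) * (x * x * (x * x)) ≡ n * x * (n * x) * (n * x * (n * x))
        lem′ = NS.solve-∀
      scaled : ∀ a → + n *ᶻ profile a i ≡ Z.∑ (toList a) z
      scaled a = sym (trans (Z.∑-+ (toList a) (λ x → + n *ᶻ sg x (suc i)) (λ _ → u i)) (trans (cong₂ _+ᶻ_ (Z.∑-*ˡ (toList a) (+ n) (λ x → sg x (suc i)))
          (trans (∑ᶻ-const (toList a) (u i)) (cong (λ l → + l *ᶻ u i) (length-toList a)))) (sym (ℤₚ.*-distribˡ-+ (+ n) (score a (suc i)) (u i)))))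
      ∑z : Z.∑ is (λ k → z (suc k)) ≡ + 0
      ∑z = trans (Z.∑-+ is (λ k → + n *ᶻ sg (suc k) (suc i)) (λ _ → u i)) (trans (cong₂ _+ᶻ_ (trans (Z.∑-*ˡ is (+ n) (λ k → sg (suc k) (suc i)))
          (cong (+ n *ᶻ_) (trans (Z.∑-cong is (λ k → sg-anti (suc k) (suc i))) (trans (∑ᶻ-neg is (λ k → sg (suc i) (suc k))) (cong -ᶻ_ (∑sg i i<n))))))
          (trans (∑ᶻ-const is (u i)) (cong (λ l → + l *ᶻ u i) (length-rng n)))) (lem′ (+ n) (u i)))
        where
        lem′ : ∀ n u → n *ᶻ (-ᶻ u) +ᶻ n *ᶻ u ≡ + 0
        lem′ = ZS.solve-∀
      sg≤1 : ∀ a b → abs (sg a b) ≤ 1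
      sg≤1 a b with b <? a | a <? b
      ... | yes _ | yes _ = z≤n
      ... | yes _ | no _  = ≤-refl
      ... | no _  | yes _ = ≤-refl
      ... | no _  | no _  = z≤n
      u≤ : abs (u i) ≤ n
      u≤ = ≤-trans (≤-reflexive (cong abs (trans (lem′ (+ i) (+ p)) (trans (cong (λ z → + i -ᶻ z) (trans (ℤₚ.m-n≡m⊖n p i) (ℤₚ.⊖-≥ (s≤s⁻¹ i<n)))) (ℤₚ.m-n≡m⊖n i (p ∸ i))))))
          (≤-trans (ℤₚ.∣m⊝n∣≤m⊔n i (p ∸ i)) (≤-trans (⊔-lub (s≤s⁻¹ i<n) (m∸n≤m p i)) (n≤1+n p)))
        where
        lem′ : ∀ i p → (i +ᶻ i) -ᶻ p ≡ i -ᶻ (p -ᶻ i)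
        lem′ = ZS.solve-∀
      z≤ : ∀ k → k ∈ is → abs (z (suc k)) ≤ 2 * n
      z≤ k _ = abs-+ {+ n *ᶻ sg (suc k) (suc i)} {u i} refl (≤-trans (≤-reflexive (ℤₚ.abs-* (+ n) (sg (suc k) (suc i)))) (≤-trans (*-monoʳ-≤ n (sg≤1 (suc k) (suc i))) (≤-reflexive (*-identityʳ n))))
                     (≤-trans u≤ (≤-reflexive (sym (+-identityʳ n))))

  -- Near ties and the mean advantage

  module Spread {p : ℕ} (S : Scale p) (d₀≡origin : Scale.d₀ S ≡ origin p)
                (G z : ℕ) (1≤z : 1 ≤ z) (σ≡Gz : Scale.σ S ≡ G * z) where
    open Density S
    open Dice S d₀≡origin
    open Anticoncentration S

    -- Both scales derive from `z = σ / G`: a near tie is a margin of order z², and a couple counts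
    -- as good when it moves the margin by at least 2z.
    V θ : ℕ
    V = z * z
    θ = 2 * z

    near : Die n → ℕ
    near a = ∑ (dice n) (λ b → ind (abs (margin a b) ≤? 4 * V))

    near≡ : ∀ a → near a ≡ E is (step (profile a) +s) n (λ y → ind (abs (proj₁ y) ≤? 4 * V) * δ (proj₂ y)) (+ 0 , d₀)
    near≡ a = ∑-margins a (λ t → ind (abs t ≤? 4 * V))

    private
      ωᶠ : ℕ → ℕ → ℕ → ℤ
      ωᶠ x y f = (sg f (suc (0 * e + x)) +ᶻ sg f (suc (6 * e + y))) -ᶻ (sg f (suc (4 * e + x)) +ᶻ sg f (suc (2 * e + y)))

      Ω : Die n → ℕ → ℕ → ℤ
      Ω a x y = Z.∑ (toList a) (ωᶠ x y)

      flat : Die n → ℕ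
      flat a = ∑ (rng e) (λ x → ∑ (rng e) (λ y → ind (abs (Ω a x y) ≤? θ)))

      -- The bias is affine in the face and the two members of a couple have equal sums, so it drops
      -- out of the gap.
      gap≡ : ∀ a x y → WindowB.gap (profile a) θ x y ≡ abs (Ω a x y)
      gap≡ a x y = cong abs (trans (regroup (sc (0 * e + x)) (sc (6 * e + y)) (sc (4 * e + x)) (sc (2 * e + y)) (u (0 * e + x)) (u (6 * e + y)) (u (4 * e + x)) (u (2 * e + y)))
          (trans (cong (_-ᶻ_ (((sc (0 * e + x) +ᶻ sc (6 * e + y)) -ᶻ (sc (4 * e + x) +ᶻ sc (2 * e + y))))) cancel) (trans (ℤₚ.+-identityʳ _) (sym split))))
        where
        sc : ℕ → ℤ
        sc i = score a (suc i)
        regroup : ∀ a b c d a′ b′ c′ d′ → ((a +ᶻ a′) +ᶻ (b +ᶻ b′)) -ᶻ ((c +ᶻ c′) +ᶻ (d +ᶻ d′)) ≡ ((a +ᶻ b) -ᶻ (c +ᶻ d)) -ᶻ ((c′ +ᶻ d′) -ᶻ (a′ +ᶻ b′))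
        regroup = ZS.solve-∀
        u-sum : ∀ i j → u i +ᶻ u j ≡ + 2 *ᶻ + (i + j) -ᶻ + 2 *ᶻ + p
        u-sum i j = trans (lem (+ i) (+ j) (+ p)) (cong (λ w → + 2 *ᶻ w -ᶻ + 2 *ᶻ + p) (sym (ℤₚ.pos-+ i j)))
          where
          lem : ∀ i j p → ((i +ᶻ i) -ᶻ p) +ᶻ ((j +ᶻ j) -ᶻ p) ≡ + 2 *ᶻ (i +ᶻ j) -ᶻ + 2 *ᶻ p
          lem = ZS.solve-∀
        index : ∀ e x y → 4 * e + x + (2 * e + y) ≡ 0 * e + x + (6 * e + y)
        index = NS.solve-∀
        cancel : (u (4 * e + x) +ᶻ u (2 * e + y)) -ᶻ (u (0 * e + x) +ᶻ u (6 * e + y)) ≡ + 0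
        cancel = trans (cong₂ _-ᶻ_ (trans (u-sum (4 * e + x) (2 * e + y)) (cong (λ w → + 2 *ᶻ + w -ᶻ + 2 *ᶻ + p) (index e x y))) (u-sum (0 * e + x) (6 * e + y)))
                       (ℤₚ.+-inverseʳ (+ 2 *ᶻ + (0 * e + x + (6 * e + y)) -ᶻ + 2 *ᶻ + p))
        split : Ω a x y ≡ (sc (0 * e + x) +ᶻ sc (6 * e + y)) -ᶻ (sc (4 * e + x) +ᶻ sc (2 * e + y))
        split = trans (∑ᶻ-minus (toList a) (λ f → sg f (suc (0 * e + x)) +ᶻ sg f (suc (6 * e + y))) (λ f → sg f (suc (4 * e + x)) +ᶻ sg f (suc (2 * e + y))))
          (cong₂ _-ᶻ_ (Z.∑-+ (toList a) (λ f → sg f (suc (0 * e + x))) (λ f → sg f (suc (6 * e + y)))) (Z.∑-+ (toList a) (λ f → sg f (suc (4 * e + x))) (λ f → sg f (suc (2 * e + y)))))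

      dichotomy : ∀ a → e * e ≤ WindowB.good (profile a) θ + flat a
      dichotomy a = begin
        e * e ≡⟨ trans (∑∑-const e e 1) (cong (e *_) (*-identityʳ e)) ⟨
        ∑ (rng e) (λ x → ∑ (rng e) (λ y → 1)) ≤⟨ ∑-mono (rng e) (λ x → ∑-mono (rng e) (λ y → one x y)) ⟩
        ∑ (rng e) (λ x → ∑ (rng e) (λ y → ind (θ ≤? WindowB.gap (profile a) θ x y) + ind (abs (Ω a x y) ≤? θ)))
          ≡⟨ trans (∑-cong (rng e) (λ x → ∑-+ (rng e) (λ y → ind (θ ≤? WindowB.gap (profile a) θ x y)) (λ y → ind (abs (Ω a x y) ≤? θ))))
                   (∑-+ (rng e) (λ x → ∑ (rng e) (λ y → ind (θ ≤? WindowB.gap (profile a) θ x y))) (λ x → ∑ (rng e) (λ y → ind (abs (Ω a x y) ≤? θ)))) ⟩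
        WindowB.good (profile a) θ + flat a ∎
        where
        open ≤-Reasoning
        one : ∀ x y → 1 ≤ ind (θ ≤? WindowB.gap (profile a) θ x y) + ind (abs (Ω a x y) ≤? θ)
        one x y with ≤-total θ (WindowB.gap (profile a) θ x y)
        ... | inj₁ h = ≤-trans (≤-reflexive (sym (ind-yes (θ ≤? WindowB.gap (profile a) θ x y) h))) (m≤m+n _ _)
        ... | inj₂ h = ≤-trans (≤-reflexive (sym (ind-yes (abs (Ω a x y) ≤? θ) (subst (_≤ θ) (gap≡ a x y) h)))) (m≤n+m _ _)

      near≤N : ∀ a → near a ≤ N
      near≤N a = ≤-trans (∑-mono (dice n) (λ b → ind≤1 (abs (margin a b) ≤? 4 * V)))
                         (≤-reflexive (trans (∑-const (dice n) 1) (trans (*-identityʳ _) length-dice)))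

      -- Either half of the couples are good and Littlewood-Offord applies to B, or more than half
      -- fail and `flat a` is at least half of `e * e`, which pays for the trivial bound. Keeping
      -- `flat a` linear on the right avoids a case split when summing over A.
      near-bound : ∀ a → e * e * (σ * near a) ≤ e * e * (C₁ * (N * (4 * z + 1))) + 2 * (σ * N) * flat a
      near-bound a with ≤-total (e * e) (2 * WindowB.good (profile a) θ)
      ... | inj₁ many = ≤-trans (*-monoʳ-≤ (e * e) (subst (λ w → σ * w ≤ C₁ * (N * (4 * z + 1))) (sym (near≡ a))
                          (WindowB.window (profile a) θ many (4 * z + 1) (4 * V) wide))) (m≤m+n _ _)
        where
        wide : 2 * (4 * V) < (4 * z + 1) * θ
        wide = ≤-trans (≤-trans (+-monoˡ-≤ (2 * (4 * V)) 1≤z) (m≤m+n _ z)) (≤-reflexive (lem z))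
          where
          lem : ∀ z → z + 2 * (4 * (z * z)) + z ≡ (4 * z + 1) * (2 * z)
          lem = NS.solve-∀
      ... | inj₂ few = ≤-trans (begin
          e * e * (σ * near a)        ≤⟨ *-mono-≤ e²≤ (*-monoʳ-≤ σ (near≤N a)) ⟩
          2 * flat a * (σ * N)        ≡⟨ lem (flat a) (σ * N) ⟩
          2 * (σ * N) * flat a ∎) (m≤n+m _ _)
        where
        open ≤-Reasoning
        lem : ∀ f x → 2 * f * x ≡ 2 * x * f
        lem = NS.solve-∀
        e²≤ : e * e ≤ 2 * flat a
        e²≤ = +-cancelˡ-≤ (e * e) _ _ (begin
          e * e + e * e ≤⟨ +-mono-≤ (dichotomy a) (dichotomy a) ⟩
          good + flat a + (good + flat a) ≡⟨ lem₂ good (flat a) ⟩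
          2 * good + 2 * flat a ≤⟨ +-monoˡ-≤ (2 * flat a) few ⟩
          e * e + 2 * flat a ∎)
          where
          good = WindowB.good (profile a) θ
          lem₂ : ∀ g f → g + f + (g + f) ≡ 2 * g + 2 * f
          lem₂ = NS.solve-∀

      -- For each single couple the gap is a sum over the faces of A, so Littlewood-Offord for A
      -- bounds the number of dice for which it is small.
      flat-bound : σ * ∑ (dice n) flat ≤ e * e * (C₁ * (N * θ))
      flat-bound = begin
        σ * ∑ (dice n) flat
          ≡⟨ cong (σ *_) (trans (∑-swap (dice n) (rng e) (λ a x → ∑ (rng e) (λ y → ind (abs (Ω a x y) ≤? θ))))
                                (∑-cong (rng e) (λ x → ∑-swap (dice n) (rng e) (λ a y → ind (abs (Ω a x y) ≤? θ))))) ⟩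
        σ * ∑ (rng e) (λ x → ∑ (rng e) (λ y → ∑ (dice n) (λ a → ind (abs (Ω a x y) ≤? θ))))
          ≡⟨ trans (sym (∑-*ˡ (rng e) σ _)) (∑-cong (rng e) (λ x → sym (∑-*ˡ (rng e) σ _))) ⟩
        ∑ (rng e) (λ x → ∑ (rng e) (λ y → σ * ∑ (dice n) (λ a → ind (abs (Ω a x y) ≤? θ))))
          ≤⟨ ∑-mono∈ (rng e) (λ x x∈ → ∑-mono∈ (rng e) (λ y y∈ → one x y (∈-rng x∈) (∈-rng y∈))) ⟩
        ∑ (rng e) (λ x → ∑ (rng e) (λ y → C₁ * (N * θ))) ≡⟨ trans (∑∑-const e e _) (sym (*-assoc e e _)) ⟩
        e * e * (C₁ * (N * θ)) ∎
        where
        open ≤-Reasoning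
        one : ∀ x y → x < e → y < e → σ * ∑ (dice n) (λ a → ind (abs (Ω a x y) ≤? θ)) ≤ C₁ * (N * θ)
        one x y x<e y<e = subst (λ w → σ * w ≤ C₁ * (N * θ)) (sym (trans (∑-dice (ωᶠ x y) (λ t → ind (abs t ≤? θ)))
            (E-project is (step (λ i → ωᶠ x y (suc i)) +s) (step (ω x y) +s) (λ y → y)
              (λ i s → cong (λ w → proj₁ s +ᶻ w , proj₂ s +ᶻ + i) (cong₂ _-ᶻ_ (cong₂ _+ᶻ_ (sg-suc i (0 * e + x)) (sg-suc i (6 * e + y))) (cong₂ _+ᶻ_ (sg-suc i (4 * e + x)) (sg-suc i (2 * e + y)))))
              n (λ y → ind (abs (proj₁ y) ≤? θ) * δ (proj₂ y)) (+ 0 , d₀))))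
            (WindowA.windowA x y x<e y<e θ θ (≤-trans (≤-reflexive (+-comm 1 (2 * θ))) (≤-trans (+-monoʳ-≤ (2 * θ) (≤-trans (*-mono-≤ {1} {2} {1} {z} (s≤s z≤n) 1≤z) (m≤m+n θ θ))) (≤-reflexive (lem θ)))))
          where
          lem : ∀ t → 2 * t + (t + t) ≡ t * 4
          lem = NS.solve-∀

    -- The 9 is 5 + 4: `4 * z + 1 ≤ 5 * z` windows for B, and `θ = 2 * z` windows for A doubled by
    -- the dichotomy.
    near-total : G * ∑ (dice n) near ≤ 9 * C₁ * (N * N)
    near-total = *-cancelˡ-≤ (e * e * z) {{>-nonZero (*-mono-≤ {1} {e * e} {1} {z} (*-mono-≤ 1≤e 1≤e) 1≤z)}} (begin
        e * e * z * (G * ∑ (dice n) near)  ≡⟨ lem₁ (e * e) z G (∑ (dice n) near) ⟩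
        e * e * (G * z * ∑ (dice n) near)  ≡⟨ cong (λ s → e * e * (s * ∑ (dice n) near)) σ≡Gz ⟨
        e * e * (σ * ∑ (dice n) near)      ≡⟨ trans (cong (e * e *_) (sym (∑-*ˡ (dice n) σ near))) (sym (∑-*ˡ (dice n) (e * e) (λ a → σ * near a))) ⟩
        ∑ (dice n) (λ a → e * e * (σ * near a)) ≤⟨ ∑-mono (dice n) near-bound ⟩
        ∑ (dice n) (λ a → e * e * (C₁ * (N * (4 * z + 1))) + 2 * (σ * N) * flat a)
          ≡⟨ trans (∑-+ (dice n) (λ _ → e * e * (C₁ * (N * (4 * z + 1)))) (λ a → 2 * (σ * N) * flat a))
                   (cong₂ _+_ (trans (∑-const (dice n) (e * e * (C₁ * (N * (4 * z + 1))))) (cong (_* (e * e * (C₁ * (N * (4 * z + 1))))) length-dice)) (∑-*ˡ (dice n) (2 * (σ * N)) flat)) ⟩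
        N * (e * e * (C₁ * (N * (4 * z + 1)))) + 2 * (σ * N) * ∑ (dice n) flat
          ≡⟨ cong (_+_ (N * (e * e * (C₁ * (N * (4 * z + 1)))))) (lem₂ σ N (∑ (dice n) flat)) ⟩
        N * (e * e * (C₁ * (N * (4 * z + 1)))) + 2 * N * (σ * ∑ (dice n) flat)
          ≤⟨ +-mono-≤ (*-monoʳ-≤ N (*-monoʳ-≤ (e * e) (*-monoʳ-≤ C₁ (*-monoʳ-≤ N (+-monoʳ-≤ (4 * z) 1≤z))))) (*-monoʳ-≤ (2 * N) flat-bound) ⟩
        N * (e * e * (C₁ * (N * (4 * z + z)))) + 2 * N * (e * e * (C₁ * (N * (2 * z)))) ≡⟨ lem₃ (e * e) C₁ N z ⟩
        e * e * z * (9 * C₁ * (N * N)) ∎)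
      where
      open ≤-Reasoning
      lem₁ : ∀ E z G x → E * z * (G * x) ≡ E * (G * z * x)
      lem₁ = NS.solve-∀
      lem₂ : ∀ s N f → 2 * (s * N) * f ≡ 2 * N * (s * f)
      lem₂ = NS.solve-∀
      lem₃ : ∀ E C N z → N * (E * (C * (N * (4 * z + z)))) + 2 * N * (E * (C * (N * (2 * z)))) ≡ E * z * (9 * C * (N * N))
      lem₃ = NS.solve-∀

  abstract
    -- `C₂` bounds the mean energy, `C₃` collects the four terms of `Θ`, `C₄` belongs to the
    -- Lindeberg error, and `C₅` adds the near ties and the dropped coordinates.
    C₂ C₃ C₄ C₅ : ℕ
    C₂ = 16384 * K + 1
    C₃ = 72 * (C₀ * C₀) + 8 + 24 * C₀ + 216 * (C₀ * C₀ * C₀)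
    C₄ = 192 * (C₂ * C₃ * C₀)
    C₅ = 18 * C₁ + 52 * (K * C₂)

    C₂≡ : C₂ ≡ 16384 * K + 1
    C₂≡ = refl
    C₃≡ : C₃ ≡ 72 * (C₀ * C₀) + 8 + 24 * C₀ + 216 * (C₀ * C₀ * C₀)
    C₃≡ = refl
    C₄≡ : C₄ ≡ 192 * (C₂ * C₃ * C₀)
    C₄≡ = refl
    C₅≡ : C₅ ≡ 18 * C₁ + 52 * (K * C₂)
    C₅≡ = refl

  -- Moments of the profile and of the dropped coordinates

  module Energy {p : ℕ} (S : Scale p) (d₀≡origin : Scale.d₀ S ≡ origin p) where
    open Density S
    open Dice S d₀≡origin

    -- The `Z₄` of the Lindeberg bound. It depends on the die, so it is kept until the sum over A,
    -- where its mean is of order n σ⁴.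
    energy : Die n → ℕ
    energy a = ∑ is (λ i → q4 (profile a i) + quart σ)

    energy-total : ∑ (dice n) energy ≤ C₂ * (N * (n * quart σ))
    energy-total = begin
      ∑ (dice n) energy ≡⟨ ∑-swap (dice n) is (λ a i → q4 (profile a i) + quart σ) ⟩
      ∑ is (λ i → ∑ (dice n) (λ a → q4 (profile a i) + quart σ))
        ≤⟨ ∑-mono∈ is (λ i i∈ → ≤-trans (≤-reflexive (trans (∑-+ (dice n) (λ a → q4 (profile a i)) (λ _ → quart σ)) (cong (_+_ (∑ (dice n) (λ a → q4 (profile a i)))) (trans (∑-const (dice n) (quart σ)) (cong (_* quart σ) length-dice)))))
                                       (+-monoˡ-≤ (N * quart σ) (≤-trans (profile-fourth-moment i (∈-rng i∈)) (*-monoʳ-≤ (1024 * K) (*-monoʳ-≤ N (*-mono-≤ n≤4σ² n≤4σ²)))))) ⟩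
      ∑ is (λ _ → 1024 * K * (N * (4 * (σ * σ) * (4 * (σ * σ)))) + N * quart σ) ≡⟨ ∑-rng-const n _ ⟩
      n * (1024 * K * (N * (4 * (σ * σ) * (4 * (σ * σ)))) + N * quart σ) ≡⟨ lem n K N σ ⟩
      (16384 * K + 1) * (N * (n * quart σ)) ≡⟨ cong (_* (N * (n * quart σ))) C₂≡ ⟨
      C₂ * (N * (n * quart σ)) ∎
      where
      open ≤-Reasoning
      lem : ∀ n K N σ → n * (1024 * K * (N * (4 * (σ * σ) * (4 * (σ * σ)))) + N * (σ * σ * (σ * σ))) ≡ (16384 * K + 1) * (N * (n * (σ * σ * (σ * σ))))
      lem = NS.solve-∀

    -- The dropped coordinates form at most half of the die, so the density bound reduces their
    -- second moment to that of independent steps, `k` times the mean square of the profile.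
    tail : ∀ n₁ k → n₁ + k ≡ n → n ≤ 2 * n₁ + 1 → ∀ a → a ∈ dice n →
      σ * σ * n * E is (step (profile a) +s) n₁ (λ y → E is (step (profile a) +s) k (λ y → sq (proj₁ y) * δ (proj₂ y)) (+ 0 , proj₂ y)) (+ 0 , d₀)
        ≤ 2 * (K * N * k) * energy a
    tail n₁ k eq h a a∈ = begin
        σ * σ * n * X                  ≤⟨ *-monoʳ-≤ (σ * σ * n) (E-density-second v sq n₁ k eq h moment) ⟩
        σ * σ * n * (K * N * (k * B))  ≡⟨ lem₁ (σ * σ) n (K * N) k B ⟩
        K * N * k * (σ * σ * (n * B))  ≤⟨ *-monoʳ-≤ (K * N * k) (*-monoʳ-≤ (σ * σ) B≤) ⟩
        K * N * k * (σ * σ * (Σsq + n)) ≡⟨ cong (K * N * k *_) (*-distribˡ-+ (σ * σ) Σsq n) ⟩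
        K * N * k * (σ * σ * Σsq + σ * σ * n) ≤⟨ *-monoʳ-≤ (K * N * k) (+-mono-≤ part₁ part₂) ⟩
        K * N * k * (energy a + energy a) ≡⟨ lem₂ (K * N * k) (energy a) ⟩
        2 * (K * N * k) * energy a ∎
      where
      open ≤-Reasoning
      v = profile a
      X = E is (step v +s) n₁ (λ y → E is (step v +s) k (λ y → sq (proj₁ y) * δ (proj₂ y)) (+ 0 , proj₂ y)) (+ 0 , d₀)
      Σsq = ∑ is (λ i → sq (v i))
      -- The mean square of the steps rounded up to an integer; the excess, at most `n` in total, is
      -- absorbed by the σ⁴ terms of the energy.
      B = suc (Σsq / n)
      lem₁ : ∀ s n K k B → s * n * (K * (k * B)) ≡ K * k * (s * (n * B))
      lem₁ = NS.solve-∀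
      lem₂ : ∀ x e → x * (e + e) ≡ 2 * x * e
      lem₂ = NS.solve-∀
      B≤ : n * B ≤ Σsq + n
      B≤ = ≤-trans (≤-reflexive (trans (*-suc n (Σsq / n)) (trans (+-comm n _) (cong (_+ n) (*-comm n (Σsq / n)))))) (+-monoˡ-≤ n (m/n*n≤m Σsq n))
      Σsq≤ : Σsq ≤ n * B
      Σsq≤ = begin
        Σsq ≡⟨ m≡m%n+[m/n]*n Σsq n ⟩
        Σsq % n + Σsq / n * n ≤⟨ +-monoˡ-≤ (Σsq / n * n) (<⇒≤ (m%n<n Σsq n)) ⟩
        n + Σsq / n * n ≡⟨ *-comm (suc (Σsq / n)) n ⟩
        n * B ∎
      moment : E is (λ i t → t +ᶻ v i) k sq (+ 0) ≤ n ^ k * (k * B)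
      moment = subst (λ l → E is (λ i t → t +ᶻ v i) k sq (+ 0) ≤ l ^ k * (k * B)) (length-rng n)
        (second-moment is v (+ 0) B (trans (Z.∑-cong is (λ i → ℤₚ.+-identityʳ (v i))) (∑-profile a a∈))
          (ℤₚ.≤-trans (ℤₚ.≤-reflexive (trans (Z.∑-cong is (λ i → trans (cong₂ _*ᶻ_ (ℤₚ.+-identityʳ (v i)) (ℤₚ.+-identityʳ (v i))) (sym (+sq (v i))))) (sym (+-∑ is (λ i → sq (v i))))))
            (subst (λ l → + Σsq ≤ᶻ + l *ᶻ + B) (sym (length-rng n)) (ℤₚ.≤-trans (ℤ.+≤+ Σsq≤) (ℤₚ.≤-reflexive (ℤₚ.pos-* n B)))))
          k (+ 0) (trans (ℤₚ.+-identityˡ _) (ℤₚ.*-zeroʳ (+ k))))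
      part₁ : σ * σ * Σsq ≤ energy a
      part₁ = ≤-trans (≤-reflexive (sym (∑-*ˡ is (σ * σ) (λ i → sq (v i))))) (∑-mono is (λ i → young₂ σ (abs (v i))))
      part₂ : σ * σ * n ≤ energy a
      part₂ = ≤-trans (≤-reflexive (*-comm (σ * σ) n)) (≤-trans (≤-reflexive (sym (∑-rng-const n (σ * σ)))) (∑-mono is (λ i → ≤-trans (≤-trans (≤-reflexive (sym (*-identityʳ (σ * σ)))) (*-monoʳ-≤ (σ * σ) (*-mono-≤ 1≤σ 1≤σ))) (m≤n+m (quart σ) (q4 (v i))))))

  -- The mean advantage at given scales

  module Mean {p : ℕ} (S : Scale p) (d₀≡origin : Scale.d₀ S ≡ origin p)
              (G y : ℕ) (2≤G : 2 ≤ G) (1≤y : 1 ≤ y) (σ≡ : Scale.σ S ≡ G * (G * G * y)) where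
    open Density S
    open Dice S d₀≡origin
    open Energy S d₀≡origin

    z : ℕ
    z = G * G * y

    1≤G : 1 ≤ G
    1≤G = ≤-trans (s≤s z≤n) 2≤G

    1≤z : 1 ≤ z
    1≤z = *-mono-≤ {1} {G * G} {1} {y} (*-mono-≤ 1≤G 1≤G) 1≤y

    open Spread S d₀≡origin G z 1≤z σ≡ using (V; near; near≡; near-total)
    open Kernel V

    1≤V : 1 ≤ V
    1≤V = *-mono-≤ 1≤z 1≤z

    advantage : Die n → ℤ
    advantage a = Z.∑ (dice n) (λ b → sgn (margin a b))

    private
      y² m : ℕ
      y² = y * y
      m = suc (y² * 2 + 0)

      nz : NonZero y
      nz = >-nonZero 1≤y

      sup : ℕ → ℕ
      sup e₀ = _/_ (C₀ * n ^ (y² * 2 + e₀)) y {{nz}}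

      r≤sup : ∀ e₀ d → r n (suc (y² * 2 + e₀)) d ≤ sup e₀
      r≤sup e₀ d = floor-bound {C₀ * n ^ (y² * 2 + e₀)} {y} {{nz}} (≤-trans (≤-reflexive (*-comm _ y))
                     (r-bound₈ p e 8e≤n n≤16e y² e₀ {y} (m≤n*m y² 8) d))

      sup≤ : ∀ e₀ → y * sup e₀ * n ≤ C₀ * n ^ suc (y² * 2 + e₀)
      sup≤ e₀ = ≤-trans (*-monoˡ-≤ n (≤-trans (≤-reflexive (*-comm y (sup e₀))) (m/n*n≤m (C₀ * n ^ (y² * 2 + e₀)) y {{nz}})))
                  (≤-reflexive (lem C₀ (n ^ (y² * 2 + e₀)) n))
        where
        lem : ∀ c x n → c * x * n ≡ c * (n * x)
        lem = NS.solve-∀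

    -- The last `k` coordinates are cut into three blocks of `m`, one for each difference of the law
    -- of the sum, and a fourth block whose law is the bounded function being smoothed. Its extra
    -- face `e₀` absorbs the parity, since the other coordinates must come in pairs.
    module Blocks (h e₀ : ℕ) (e₀≤1 : e₀ ≤ 1) (blocks : h * 2 + (m + (m + (m + suc (y² * 2 + e₀)))) ≡ n) where
      private
        mₑ k ρ M A D : ℕ
        mₑ = suc (y² * 2 + e₀)
        k = m + (m + (m + mₑ))
        ρ = sup 0
        M = sup e₀
        A = n ^ m
        D = 2 * ρ

        open SumSmoothing p m {ρ} (r≤sup 0)

        f q : ℤ → ℤ
        f d = + r n mₑ d
        q = Z.E is st₁ m (Z.E is st₁ m (Z.E is st₁ m f))

        q-smooth : Smooth q (A * (A * (A * M))) (D * (A * (A * M))) (D * (D * (A * M))) (D * (D * (D * M)))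
        q-smooth = E-smooth {f} {M} (r≤sup e₀)

        q≡E : ∀ d → q d ≡ Z.E is st₁ k (λ d → + δ d) d
        q≡E d = sym (trans (Z.E-add is st₁ m _ _ d) (Z.E-cong is st₁ m (λ d → trans (Z.E-add is st₁ m _ _ d)
          (Z.E-cong is st₁ m (λ d → trans (Z.E-add is st₁ m mₑ _ d) (Z.E-cong is st₁ m (λ d → sym (+-E is st₁ mₑ δ d)) d)) d)) d))

        q≡r : ∀ d → q d ≡ + r n k d
        q≡r d = trans (q≡E d) (sym (+-E is st₁ k δ d))

        q-sym : ∀ d → q (-ᶻ + (k * p) -ᶻ d) ≡ q d
        q-sym d = trans (q≡r (-ᶻ + (k * p) -ᶻ d)) (trans (cong +_ (Unimodal.r-sym p k d)) (sym (q≡r d)))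

        W : ℕ
        W = w³

        k≤ : k ≤ 13 * y²
        k≤ = ≤-trans (+-monoʳ-≤ m (+-monoʳ-≤ m (+-monoʳ-≤ m (s≤s (+-monoʳ-≤ (y² * 2) e₀≤1))))) (≤-trans (≤-reflexive (lem y²)) (≤-trans (+-monoʳ-≤ (8 * y²) (*-monoʳ-≤ 5 (*-mono-≤ 1≤y 1≤y))) (≤-reflexive (lem₂ y²))))
          where
          lem : ∀ y → suc (y * 2 + 0) + (suc (y * 2 + 0) + (suc (y * 2 + 0) + suc (y * 2 + 1))) ≡ 8 * y + 5 * 1
          lem = NS.solve-∀
          lem₂ : ∀ y → 8 * y + 5 * y ≡ 13 * y
          lem₂ = NS.solve-∀

        -- As `G ≥ 2`, σ is at least 8y, so at most 13y² dropped coordinates stay below half of n ≥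
        -- 64y².
        small-tail : n ≤ 2 * (h * 2) + 1
        small-tail = ≤-trans (+-cancelʳ-≤ n n (2 * (h * 2)) (begin
            n + n ≡⟨ cong₂ _+_ (sym blocks) (sym blocks) ⟩
            h * 2 + k + (h * 2 + k) ≡⟨ lem₁ (h * 2) k ⟩
            2 * (h * 2) + 2 * k ≤⟨ +-monoʳ-≤ (2 * (h * 2)) (≤-trans (*-monoʳ-≤ 2 k≤) 26y²≤n) ⟩
            2 * (h * 2) + n ∎)) (m≤m+n _ 1)
          where
          open ≤-Reasoning
          lem₁ : ∀ h k → h + k + (h + k) ≡ 2 * h + 2 * k
          lem₁ = NS.solve-∀
          8y≤σ : 8 * y ≤ σ
          8y≤σ = ≤-trans (*-monoˡ-≤ y (*-mono-≤ 2≤G (*-mono-≤ 2≤G 2≤G))) (≤-reflexive (trans (lem G y) (sym σ≡)))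
            where
            lem : ∀ G y → G * (G * G) * y ≡ G * (G * G * y)
            lem = NS.solve-∀
          26y²≤n : 2 * (13 * y²) ≤ n
          26y²≤n = ≤-trans (≤-trans (m≤m+n _ (38 * y²)) (≤-reflexive (lem y))) (≤-trans (*-mono-≤ 8y≤σ 8y≤σ) σ²≤n)
            where
            lem : ∀ y → 2 * (13 * (y * y)) + 38 * (y * y) ≡ 8 * y * (8 * y)
            lem = NS.solve-∀

      module Single (a : Die n) (a∈ : a ∈ dice n) where
        private
          v = profile a
          st = step v +s
        module L = Lindeberg S v (∑-profile a a∈) φ-smooth q-smooth φ-odd

        main : ℤ
        main = Z.E is st (h * 2) L.G (+ 0 , d₀)

        rest : ℕ
        rest = E is st (h * 2) (λ y → E is st k (λ y → sq (proj₁ y) * δ (proj₂ y)) (+ 0 , proj₂ y)) (+ 0 , d₀)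

        private
          F N₁ : ℤ × ℤ → ℕ
          F y = sq (proj₁ y) * δ (proj₂ y)
          N₁ y = ind (abs (proj₁ y) ≤? 4 * V) * δ (proj₂ y)
          Ψ : ℤ × ℤ → ℤ
          Ψ y = (+ W *ᶻ sgn (proj₁ y)) *ᶻ + δ (proj₂ y)

          whole : + W *ᶻ advantage a ≡ Z.E is st (h * 2) (Z.E is st k Ψ) (+ 0 , d₀)
          whole = trans (sym (Z.∑-*ˡ (dice n) (+ W) _)) (trans (∑ᶻ-margins a (λ t → + W *ᶻ sgn t))
              (trans (cong (λ l → Z.E is st l Ψ (+ 0 , d₀)) (sym blocks)) (Z.E-add is st (h * 2) k Ψ (+ 0 , d₀))))

          -- Given the state before the dropped coordinates, `φ t` is constant over the rest of the
          -- walk, and the rest only contributes its number of balanced completions `q d`. The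
          -- pointwise kernel error is then averaged.
          local : ∀ y → V * V * abs (Z.E is st k Ψ y -ᶻ L.G y) ≤ 2 * W * (V * V * E is st k N₁ y + E is st k F (+ 0 , proj₂ y))
          local (t , d) = begin
            V * V * abs (Z.E is st k Ψ (t , d) -ᶻ φ t *ᶻ q d)
              ≡⟨ cong (λ x → V * V * abs (Z.E is st k Ψ (t , d) -ᶻ x)) G≡ ⟩
            V * V * abs (Z.E is st k Ψ (t , d) -ᶻ Z.E is st k (λ y → φ t *ᶻ + δ (proj₂ y)) (t , d))
              ≡⟨ cong (λ x → V * V * abs x) (sym (Eᶻ-minus is st k Ψ (λ y → φ t *ᶻ + δ (proj₂ y)) (t , d))) ⟩
            V * V * abs (Z.E is st k (λ y → Ψ y -ᶻ φ t *ᶻ + δ (proj₂ y)) (t , d))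
              ≤⟨ *-monoʳ-≤ (V * V) (abs-E is st k (λ y → Ψ y -ᶻ φ t *ᶻ + δ (proj₂ y)) (t , d)) ⟩
            V * V * E is st k (λ y → abs (Ψ y -ᶻ φ t *ᶻ + δ (proj₂ y))) (t , d)
              ≡⟨ E-*ˡ is st k (V * V) (λ y → abs (Ψ y -ᶻ φ t *ᶻ + δ (proj₂ y))) (t , d) ⟨
            E is st k (λ y → V * V * abs (Ψ y -ᶻ φ t *ᶻ + δ (proj₂ y))) (t , d)
              ≤⟨ E-mono is st k (λ y → pointwise (proj₁ y) (δ (proj₂ y))) (t , d) ⟩
            E is st k (λ y → 2 * W * (V * V * N₁ y + sq (proj₁ y -ᶻ t) * δ (proj₂ y))) (t , d)
              ≡⟨ trans (E-*ˡ is st k (2 * W) (λ y → V * V * N₁ y + sq (proj₁ y -ᶻ t) * δ (proj₂ y)) (t , d))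
                       (cong (2 * W *_) (trans (E-+ is st k (λ y → V * V * N₁ y) (λ y → sq (proj₁ y -ᶻ t) * δ (proj₂ y)) (t , d))
                         (cong₂ _+_ (E-*ˡ is st k (V * V) N₁ (t , d))
                           (trans (E-shift-t is v +s k (λ y → sq (proj₁ y -ᶻ t) * δ (proj₂ y)) t d)
                                  (E-cong is st k (λ y → cong (λ x → sq x * δ (proj₂ y)) (lem t (proj₁ y))) (+ 0 , d)))))) ⟩
            2 * W * (V * V * E is st k N₁ (t , d) + E is st k F (+ 0 , d)) ∎
            where
            open ≤-Reasoning
            lem : ∀ t s → (t +ᶻ s) -ᶻ t ≡ s
            lem = ZS.solve-∀
            G≡ : φ t *ᶻ q d ≡ Z.E is st k (λ y → φ t *ᶻ + δ (proj₂ y)) (t , d)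
            G≡ = trans (cong (φ t *ᶻ_) (q≡E d)) (trans (sym (Z.E-*ˡ is st₁ k (φ t) (λ d → + δ d) d))
                   (sym (Z.E-project is st st₁ proj₂ (λ _ _ → refl) k (λ d → φ t *ᶻ + δ d) (t , d))))
            pointwise : ∀ T c → V * V * abs ((+ W *ᶻ sgn T) *ᶻ + c -ᶻ φ t *ᶻ + c) ≤ 2 * W * (V * V * (ind (abs T ≤? 4 * V) * c) + sq (T -ᶻ t) * c)
            pointwise T c = begin
              V * V * abs ((+ W *ᶻ sgn T) *ᶻ + c -ᶻ φ t *ᶻ + c) ≡⟨ cong (V * V *_) (trans (cong abs (lem₁ (+ W *ᶻ sgn T) (φ t) (+ c))) (ℤₚ.abs-* (+ W *ᶻ sgn T -ᶻ φ t) (+ c))) ⟩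
              V * V * (abs (+ W *ᶻ sgn T -ᶻ φ t) * c) ≡⟨ *-assoc (V * V) _ c ⟨
              V * V * abs (+ W *ᶻ sgn T -ᶻ φ t) * c ≤⟨ *-monoˡ-≤ c (kernel-error T t) ⟩
              2 * W * (V * V * ind (abs T ≤? 4 * V) + sq (T -ᶻ t)) * c ≡⟨ lem₂ W (V * V) (ind (abs T ≤? 4 * V)) (sq (T -ᶻ t)) c ⟩
              2 * W * (V * V * (ind (abs T ≤? 4 * V) * c) + sq (T -ᶻ t) * c) ∎
              where
              lem₁ : ∀ a b c → a *ᶻ c -ᶻ b *ᶻ c ≡ (a -ᶻ b) *ᶻ c
              lem₁ = ZS.solve-∀
              lem₂ : ∀ W V i s c → 2 * W * (V * i + s) * c ≡ 2 * W * (V * (i * c) + s * c)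
              lem₂ = NS.solve-∀

        decomposition : V * V * (W * abs (advantage a)) ≤ V * V * abs main + 2 * W * (V * V * near a + rest)
        decomposition = begin
          V * V * (W * abs (advantage a)) ≡⟨ cong (V * V *_) (trans (sym (ℤₚ.abs-* (+ W) (advantage a))) (cong abs whole)) ⟩
          V * V * abs (Z.E is st (h * 2) (Z.E is st k Ψ) (+ 0 , d₀))
            ≤⟨ *-monoʳ-≤ (V * V) (abs-+ {main} {Z.E is st (h * 2) Y (+ 0 , d₀)} split ≤-refl (abs-E is st (h * 2) Y (+ 0 , d₀))) ⟩
          V * V * (abs main + E is st (h * 2) (λ y → abs (Y y)) (+ 0 , d₀))
            ≡⟨ *-distribˡ-+ (V * V) (abs main) _ ⟩
          V * V * abs main + V * V * E is st (h * 2) (λ y → abs (Y y)) (+ 0 , d₀)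
            ≤⟨ +-monoʳ-≤ (V * V * abs main) averaged ⟩
          V * V * abs main + 2 * W * (V * V * near a + rest) ∎
          where
          open ≤-Reasoning
          Y : ℤ × ℤ → ℤ
          Y y = Z.E is st k Ψ y -ᶻ L.G y
          tel : ∀ x g → x ≡ g +ᶻ (x -ᶻ g)
          tel = ZS.solve-∀
          split : Z.E is st (h * 2) (Z.E is st k Ψ) (+ 0 , d₀) ≡ main +ᶻ Z.E is st (h * 2) Y (+ 0 , d₀)
          split = trans (tel _ main) (cong (main +ᶻ_) (sym (Eᶻ-minus is st (h * 2) (Z.E is st k Ψ) L.G (+ 0 , d₀))))
          averaged : V * V * E is st (h * 2) (λ y → abs (Y y)) (+ 0 , d₀) ≤ 2 * W * (V * V * near a + rest)
          averaged = begin
            V * V * E is st (h * 2) (λ y → abs (Y y)) (+ 0 , d₀)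
              ≡⟨ E-*ˡ is st (h * 2) (V * V) (λ y → abs (Y y)) (+ 0 , d₀) ⟨
            E is st (h * 2) (λ y → V * V * abs (Y y)) (+ 0 , d₀)
              ≤⟨ E-mono is st (h * 2) local (+ 0 , d₀) ⟩
            E is st (h * 2) (λ y → 2 * W * (V * V * E is st k N₁ y + E is st k F (+ 0 , proj₂ y))) (+ 0 , d₀)
              ≡⟨ trans (E-*ˡ is st (h * 2) (2 * W) (λ y → V * V * E is st k N₁ y + E is st k F (+ 0 , proj₂ y)) (+ 0 , d₀))
                  (cong (2 * W *_) (trans (E-+ is st (h * 2) (λ y → V * V * E is st k N₁ y) (λ y → E is st k F (+ 0 , proj₂ y)) (+ 0 , d₀))
                    (cong (_+ rest) (trans (E-*ˡ is st (h * 2) (V * V) (E is st k N₁) (+ 0 , d₀))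
                      (cong (V * V *_) (trans (sym (E-add is st (h * 2) k N₁ (+ 0 , d₀))) (trans (cong (λ l → E is st l N₁ (+ 0 , d₀)) blocks) (sym (near≡ a))))))))) ⟩
            2 * W * (V * V * near a + rest) ∎

      private
        Θ w V³ : ℕ
        w = Box.w V
        Θ = σ * (n * n) * (2 * (w * (w * 1)) * (D * (D * (A * M)))) + σ * σ * σ * (2 * (2 * (2 * 1)) * (A * (A * (A * M))))
          + σ * σ * n * (2 * (2 * (w * 1)) * (D * (A * (A * M)))) + n * n * n * (W * (D * (D * (D * M))))
        V³ = V * V * V

        w≤3V : w ≤ 3 * V
        w≤3V = ≤-trans (+-monoˡ-≤ (2 * V) 1≤V) (≤-reflexive refl)

        W≤ : W ≤ 27 * V³
        W≤ = ≤-trans (≤-reflexive w³≡) (≤-trans (*-mono-≤ w≤3V (*-mono-≤ w≤3V (*-monoˡ-≤ 1 w≤3V))) (≤-reflexive (lem V)))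
          where
          lem : ∀ V → 3 * V * (3 * V * (3 * V * 1)) ≡ 27 * (V * V * V)
          lem = NS.solve-∀

        V³≤W : V³ ≤ W
        V³≤W = ≤-trans (≤-trans (≤-reflexive (lem V)) (*-mono-≤ V≤w (*-mono-≤ V≤w (*-monoˡ-≤ 1 V≤w)))) (≤-reflexive (sym w³≡))
          where
          V≤w : V ≤ w
          V≤w = ≤-trans (m≤m+n V (V + 0)) (n≤1+n _)
          lem : ∀ V → V * V * V ≡ V * (V * (V * 1))
          lem = NS.solve-∀

        c s : ℕ
        c = 2 * C₀
        s = σ * y

        -- A typical step σ is at most V / y, so each difference of φ gains a factor 1 / y, the same
        -- gain as each difference of `q` by `ynD≤`.
        s≤V : s ≤ V
        s≤V = ≤-trans (≤-reflexive (trans (cong (_* y) σ≡) (lem G y))) (≤-trans (*-monoʳ-≤ (G * G * G * (y * y)) 1≤G) (≤-reflexive (lem₂ G y)))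
          where
          lem : ∀ G y → G * (G * G * y) * y ≡ G * G * G * (y * y) * 1
          lem = NS.solve-∀
          lem₂ : ∀ G y → G * G * G * (y * y) * G ≡ G * G * y * (G * G * y)
          lem₂ = NS.solve-∀

        ynD≤ : y * n * D ≤ c * A
        ynD≤ = ≤-trans (≤-reflexive (lem y n ρ)) (≤-trans (*-monoʳ-≤ 2 (sup≤ 0)) (≤-reflexive (sym (*-assoc 2 C₀ A))))
          where
          lem : ∀ y n ρ → y * n * (2 * ρ) ≡ 2 * (y * ρ * n)
          lem = NS.solve-∀

        -- Every term of `Θ` carries three differences in all, shared between φ and `q`, and each
        -- difference is worth one factor 1 / y.
        Θ-bound₁ : y * y * y * Θ ≤ A * (A * (A * M)) * (C₃ * V³)
        Θ-bound₁ = begin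
          y * y * y * Θ ≡⟨ lem₁ y σ n D A M w W ⟩
          s * (2 * (w * (w * 1))) * (y * n * D * (y * n * D) * (A * M)) + s * s * s * 8 * (A * (A * (A * M)))
            + s * s * (2 * (2 * (w * 1))) * (y * n * D * (A * (A * M))) + W * (y * n * D * (y * n * D) * (y * n * D) * M)
            ≤⟨ +-mono-≤ (+-mono-≤ (+-mono-≤
                 (*-mono-≤ (*-mono-≤ s≤V (*-monoʳ-≤ 2 (*-mono-≤ w≤3V (*-monoˡ-≤ 1 w≤3V)))) (*-monoˡ-≤ (A * M) (*-mono-≤ ynD≤ ynD≤)))
                 (*-monoˡ-≤ (A * (A * (A * M))) (*-monoˡ-≤ 8 (*-mono-≤ (*-mono-≤ s≤V s≤V) s≤V))))
                 (*-mono-≤ (*-mono-≤ (*-mono-≤ s≤V s≤V) (*-monoʳ-≤ 2 (*-monoʳ-≤ 2 (*-monoˡ-≤ 1 w≤3V)))) (*-monoˡ-≤ (A * (A * M)) ynD≤)))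
                 (*-mono-≤ W≤ (*-monoˡ-≤ M (*-mono-≤ (*-mono-≤ ynD≤ ynD≤) ynD≤))) ⟩
          V * (2 * (3 * V * (3 * V * 1))) * (c * A * (c * A) * (A * M)) + V * V * V * 8 * (A * (A * (A * M)))
            + V * V * (2 * (2 * (3 * V * 1))) * (c * A * (A * (A * M))) + 27 * V³ * (c * A * (c * A) * (c * A) * M)
            ≡⟨ lem₂ V A M C₀ ⟩
          A * (A * (A * M)) * ((72 * (C₀ * C₀) + 8 + 24 * C₀ + 216 * (C₀ * C₀ * C₀)) * V³)
            ≡⟨ cong (λ c → A * (A * (A * M)) * (c * V³)) C₃≡ ⟨
          A * (A * (A * M)) * (C₃ * V³) ∎
          where
          open ≤-Reasoning
          lem₁ : ∀ y σ n D A M w W →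
            y * y * y * (σ * (n * n) * (2 * (w * (w * 1)) * (D * (D * (A * M)))) + σ * σ * σ * (2 * (2 * (2 * 1)) * (A * (A * (A * M))))
              + σ * σ * n * (2 * (2 * (w * 1)) * (D * (A * (A * M)))) + n * n * n * (W * (D * (D * (D * M))))) ≡
            σ * y * (2 * (w * (w * 1))) * (y * n * D * (y * n * D) * (A * M)) + σ * y * (σ * y) * (σ * y) * 8 * (A * (A * (A * M)))
              + σ * y * (σ * y) * (2 * (2 * (w * 1))) * (y * n * D * (A * (A * M))) + W * (y * n * D * (y * n * D) * (y * n * D) * M)
          lem₁ = NS.solve-∀
          lem₂ : ∀ V A M C →
            V * (2 * (3 * V * (3 * V * 1))) * (2 * C * A * (2 * C * A) * (A * M)) + V * V * V * 8 * (A * (A * (A * M)))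
              + V * V * (2 * (2 * (3 * V * 1))) * (2 * C * A * (A * (A * M))) + 27 * (V * V * V) * (2 * C * A * (2 * C * A) * (2 * C * A) * M) ≡
            A * (A * (A * M)) * ((72 * (C * C) + 8 + 24 * C + 216 * (C * C * C)) * (V * V * V))
          lem₂ = NS.solve-∀

        -- A fourth factor 1 / y, together with 1 / n, comes from the density bound on the fourth
        -- block.
        Θ-bound : y * y * y * y * (n * Θ) ≤ C₃ * C₀ * V³ * n ^ k
        Θ-bound = begin
          y * y * y * y * (n * Θ)               ≡⟨ lem₁ y n Θ ⟩
          y * n * (y * y * y * Θ)               ≤⟨ *-monoʳ-≤ (y * n) Θ-bound₁ ⟩
          y * n * (A * (A * (A * M)) * (C₃ * V³)) ≡⟨ lem₂ y n A M (C₃ * V³) ⟩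
          A * (A * A) * (C₃ * V³) * (y * M * n) ≤⟨ *-monoʳ-≤ (A * (A * A) * (C₃ * V³)) (sup≤ e₀) ⟩
          A * (A * A) * (C₃ * V³) * (C₀ * n ^ mₑ) ≡⟨ lem₃ A C₃ V³ C₀ (n ^ mₑ) ⟩
          C₃ * C₀ * V³ * (A * (A * (A * n ^ mₑ))) ≡⟨ cong (C₃ * C₀ * V³ *_) powers ⟩
          C₃ * C₀ * V³ * n ^ k ∎
          where
          open ≤-Reasoning
          lem₁ : ∀ y n t → y * y * y * y * (n * t) ≡ y * n * (y * y * y * t)
          lem₁ = NS.solve-∀
          lem₂ : ∀ y n A M x → y * n * (A * (A * (A * M)) * x) ≡ A * (A * A) * x * (y * M * n)
          lem₂ = NS.solve-∀
          lem₃ : ∀ A c v d x → A * (A * A) * (c * v) * (d * x) ≡ c * d * v * (A * (A * (A * x)))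
          lem₃ = NS.solve-∀
          powers : A * (A * (A * n ^ mₑ)) ≡ n ^ k
          powers = sym (trans (^-distribˡ-+-* n m (m + (m + mₑ))) (cong (A *_) (trans (^-distribˡ-+-* n m (m + mₑ)) (cong (A *_) (^-distribˡ-+-* n m mₑ)))))

        single : ∀ a → a ∈ dice n → quart σ * n * (V * V * (W * abs (advantage a))) ≤
          V * V * (4 * (n ^ (h * 2) * (n * Θ))) * energy a + 2 * W * (V * V * (quart σ * n) * near a + σ * σ * (2 * (K * N * k)) * energy a)
        single a a∈ = begin
          quart σ * n * (V * V * (W * abs (advantage a)))   ≤⟨ *-monoʳ-≤ (quart σ * n) B.decomposition ⟩
          quart σ * n * (V * V * abs B.main + 2 * W * (V * V * near a + B.rest))
            ≡⟨ lem₁ σ n (V * V) (abs B.main) W (near a) B.rest ⟩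
          V * V * n * (quart σ * abs B.main) + 2 * W * (V * V * (quart σ * n) * near a + σ * σ * (σ * σ * n * B.rest))
            ≤⟨ +-mono-≤ (*-monoʳ-≤ (V * V * n) (B.L.lindeberg h k blocks q-sym))
                        (*-monoʳ-≤ (2 * W) (+-monoʳ-≤ (V * V * (quart σ * n) * near a) (*-monoʳ-≤ (σ * σ) (tail (h * 2) k blocks small-tail a a∈)))) ⟩
          V * V * n * (4 * (n ^ (h * 2) * (energy a * Θ))) + 2 * W * (V * V * (quart σ * n) * near a + σ * σ * (2 * (K * N * k) * energy a))
            ≡⟨ cong₂ _+_ (lem₂ (V * V) n (n ^ (h * 2)) (energy a) Θ) (cong (λ x → 2 * W * (V * V * (quart σ * n) * near a + x)) (sym (*-assoc (σ * σ) (2 * (K * N * k)) (energy a)))) ⟩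
          V * V * (4 * (n ^ (h * 2) * (n * Θ))) * energy a + 2 * W * (V * V * (quart σ * n) * near a + σ * σ * (2 * (K * N * k)) * energy a) ∎
          where
          open ≤-Reasoning
          module B = Single a a∈
          lem₁ : ∀ σ n v m W b r → σ * σ * (σ * σ) * n * (v * m + 2 * W * (v * b + r)) ≡
            v * n * (σ * σ * (σ * σ) * m) + 2 * W * (v * (σ * σ * (σ * σ) * n) * b + σ * σ * (σ * σ * n * r))
          lem₁ = NS.solve-∀
          lem₂ : ∀ v n x e t → v * n * (4 * (x * (e * t))) ≡ v * (4 * (x * (n * t))) * e
          lem₂ = NS.solve-∀

      ∑∣advantage∣ : ℕ
      ∑∣advantage∣ = ∑ (dice n) (λ a → abs (advantage a))

      private
        Σnear : ℕ
        Σnear = ∑ (dice n) near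

        summed : V * V * (W * ∑∣advantage∣) ≤ V * V * (4 * (n ^ (h * 2) * (n * Θ)) * (C₂ * N)) + 2 * W * (V * V * Σnear + σ * σ * (2 * (K * N * k)) * (C₂ * N))
        summed = *-cancelˡ-≤ (quart σ * n) {{>-nonZero (*-mono-≤ {1} {quart σ} {1} {n} (*-mono-≤ {1} {σ * σ} {1} {σ * σ} (*-mono-≤ 1≤σ 1≤σ) (*-mono-≤ 1≤σ 1≤σ)) (s≤s z≤n))}} (begin
          quart σ * n * (V * V * (W * ∑∣advantage∣))
            ≡⟨ trans (cong (quart σ * n *_) (trans (cong (V * V *_) (sym (∑-*ˡ (dice n) W (λ a → abs (advantage a))))) (sym (∑-*ˡ (dice n) (V * V) (λ a → W * abs (advantage a))))))
                     (sym (∑-*ˡ (dice n) (quart σ * n) (λ a → V * V * (W * abs (advantage a))))) ⟩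
          ∑ (dice n) (λ a → quart σ * n * (V * V * (W * abs (advantage a)))) ≤⟨ ∑-mono∈ (dice n) single ⟩
          ∑ (dice n) (λ a → X * energy a + 2 * W * (Y * near a + T * energy a))
            ≡⟨ trans (∑-+ (dice n) (λ a → X * energy a) (λ a → 2 * W * (Y * near a + T * energy a)))
                     (cong₂ _+_ (∑-*ˡ (dice n) X energy) (trans (∑-*ˡ (dice n) (2 * W) (λ a → Y * near a + T * energy a))
                       (cong (2 * W *_) (trans (∑-+ (dice n) (λ a → Y * near a) (λ a → T * energy a)) (cong₂ _+_ (∑-*ˡ (dice n) Y near) (∑-*ˡ (dice n) T energy)))))) ⟩
          X * Σe + 2 * W * (Y * Σnear + T * Σe)
            ≤⟨ +-mono-≤ (*-monoʳ-≤ X energy-total) (*-monoʳ-≤ (2 * W) (+-monoʳ-≤ (Y * Σnear) (*-monoʳ-≤ T energy-total))) ⟩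
          X * (C₂ * (N * (n * quart σ))) + 2 * W * (Y * Σnear + T * (C₂ * (N * (n * quart σ))))
            ≡⟨ lem (V * V) (4 * (n ^ (h * 2) * (n * Θ))) (quart σ) n C₂ N W Σnear T ⟩
          quart σ * n * (V * V * (4 * (n ^ (h * 2) * (n * Θ)) * (C₂ * N)) + 2 * W * (V * V * Σnear + T * (C₂ * N))) ∎)
          where
          open ≤-Reasoning
          Σe = ∑ (dice n) energy
          X = V * V * (4 * (n ^ (h * 2) * (n * Θ)))
          Y = V * V * (quart σ * n)
          T = σ * σ * (2 * (K * N * k))
          lem : ∀ v x q n C N W b T → v * x * (C * (N * (n * q))) + 2 * W * (v * (q * n) * b + T * (C * (N * (n * q)))) ≡
                q * n * (v * (x * (C * N)) + 2 * W * (v * b + T * (C * N)))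
          lem = NS.solve-∀

        -- Passing from all sequences to balanced dice costs a factor 12nσ, at most 48σ³ = 48G⁹y³.
        -- Three of the four factors 1 / y pay for it, and the one that is left makes the error
        -- vanish as `y` grows.
        first-term : y * (4 * (n ^ (h * 2) * (n * Θ)) * (C₂ * N)) ≤ C₄ * (G ^ 9 * (W * (N * N)))
        first-term = *-cancelˡ-≤ (y * y * y) {{>-nonZero (*-mono-≤ {1} {y * y} {1} {y} (*-mono-≤ 1≤y 1≤y) 1≤y)}} (begin
          y * y * y * (y * (4 * (X * (n * Θ)) * (C₂ * N)))  ≡⟨ lem₁ y X (n * Θ) (C₂ * N) ⟩
          4 * X * (C₂ * N) * (y * y * y * y * (n * Θ))      ≤⟨ *-monoʳ-≤ (4 * X * (C₂ * N)) Θ-bound ⟩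
          4 * X * (C₂ * N) * (C₃ * C₀ * V³ * n ^ k)         ≡⟨ lem₂ X C₂ N C₃ C₀ V³ (n ^ k) ⟩
          4 * (C₂ * C₃ * C₀) * (V³ * N) * (X * n ^ k)       ≡⟨ cong (4 * (C₂ * C₃ * C₀) * (V³ * N) *_) (trans (sym (^-distribˡ-+-* n (h * 2) k)) (cong (n ^_) blocks)) ⟩
          4 * (C₂ * C₃ * C₀) * (V³ * N) * n ^ n             ≤⟨ *-mono-≤ (*-monoʳ-≤ (4 * (C₂ * C₃ * C₀)) (*-monoˡ-≤ N V³≤W)) (≤-trans many-dice (*-monoˡ-≤ N (*-monoʳ-≤ 12 (*-monoˡ-≤ σ n≤4σ²)))) ⟩
          4 * (C₂ * C₃ * C₀) * (W * N) * (12 * (4 * (σ * σ) * σ) * N)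
            ≡⟨ cong (λ σ → 4 * (C₂ * C₃ * C₀) * (W * N) * (12 * (4 * (σ * σ) * σ) * N)) σ≡ ⟩
          4 * (C₂ * C₃ * C₀) * (W * N) * (12 * (4 * (G * z * (G * z)) * (G * z)) * N)
            ≡⟨ lem₃ (C₂ * C₃ * C₀) W N G y ⟩
          y * y * y * (192 * (C₂ * C₃ * C₀) * (G ^ 9 * (W * (N * N)))) ≡⟨ cong (λ c → y * y * y * (c * (G ^ 9 * (W * (N * N))))) C₄≡ ⟨
          y * y * y * (C₄ * (G ^ 9 * (W * (N * N)))) ∎)
          where
          open ≤-Reasoning
          X = n ^ (h * 2)
          lem₁ : ∀ y X t c → y * y * y * (y * (4 * (X * t) * c)) ≡ 4 * X * c * (y * y * y * y * t)
          lem₁ = NS.solve-∀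
          lem₂ : ∀ X a N b c v x → 4 * X * (a * N) * (b * c * v * x) ≡ 4 * (a * b * c) * (v * N) * (X * x)
          lem₂ = NS.solve-∀
          lem₃ : ∀ c W N G y → 4 * c * (W * N) * (12 * (4 * (G * (G * G * y) * (G * (G * G * y))) * (G * (G * G * y))) * N) ≡
                 y * y * y * (192 * c * (G * (G * (G * (G * (G * (G * (G * (G * (G * 1)))))))) * (W * (N * N))))
          lem₃ = NS.solve-∀

        -- The second moment σ²k of the dropped coordinates is of order G⁶y⁴, against V² = G⁸y⁴; one
        -- of the two spare factors of `G` is used.
        Gkσ² : G * (σ * σ * k) ≤ 13 * (V * V)
        Gkσ² = begin
          G * (σ * σ * k)             ≤⟨ *-monoʳ-≤ G (*-monoʳ-≤ (σ * σ) k≤) ⟩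
          G * (σ * σ * (13 * (y * y))) ≡⟨ cong (λ σ → G * (σ * σ * (13 * (y * y)))) σ≡ ⟩
          G * (G * z * (G * z) * (13 * (y * y))) ≡⟨ lem₁ G y ⟩
          13 * (G * G * G * G * G * G * G * (y * y * y * y)) * 1 ≤⟨ *-monoʳ-≤ (13 * (G * G * G * G * G * G * G * (y * y * y * y))) 1≤G ⟩
          13 * (G * G * G * G * G * G * G * (y * y * y * y)) * G ≡⟨ lem₂ G y ⟩
          13 * (V * V) ∎
          where
          open ≤-Reasoning
          lem₁ : ∀ G y → G * (G * (G * G * y) * (G * (G * G * y)) * (13 * (y * y))) ≡ 13 * (G * G * G * G * G * G * G * (y * y * y * y)) * 1
          lem₁ = NS.solve-∀
          lem₂ : ∀ G y → 13 * (G * G * G * G * G * G * G * (y * y * y * y)) * G ≡ 13 * (G * G * y * (G * G * y) * (G * G * y * (G * G * y)))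
          lem₂ = NS.solve-∀

      -- The two errors behave differently: the Lindeberg part is G⁹ / y and vanishes only as `n`
      -- grows, while near ties and dropped coordinates cost 1 / G uniformly in `n`.
      advantage-total : y * G * ∑∣advantage∣ ≤ (C₄ * G ^ 10 + y * C₅) * (N * N)
      advantage-total = *-cancelˡ-≤ (V * V * W) {{>-nonZero (*-mono-≤ {1} {V * V} {1} {W} (*-mono-≤ 1≤V 1≤V) (≤-trans (*-mono-≤ {1} {V * V} {1} {V} (*-mono-≤ 1≤V 1≤V) 1≤V) V³≤W))}} (begin
          V * V * W * (y * G * ∑∣advantage∣) ≡⟨ lem₁ (V * V) W y G ∑∣advantage∣ ⟩
          y * G * (V * V * (W * ∑∣advantage∣)) ≤⟨ *-monoʳ-≤ (y * G) summed ⟩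
          y * G * (V * V * X + 2 * W * (V * V * Σnear + σ * σ * (2 * (K * N * k)) * (C₂ * N)))
            ≡⟨ lem₂ y G (V * V) X W Σnear σ K N k C₂ ⟩
          V * V * G * (y * X) + 2 * W * y * (V * V * (G * Σnear) + 2 * (K * C₂) * (N * N) * (G * (σ * σ * k)))
            ≤⟨ +-mono-≤ (*-monoʳ-≤ (V * V * G) first-term) (*-monoʳ-≤ (2 * W * y) (+-mono-≤ (*-monoʳ-≤ (V * V) near-total) (*-monoʳ-≤ (2 * (K * C₂) * (N * N)) Gkσ²))) ⟩
          V * V * G * (C₄ * (G ^ 9 * (W * (N * N)))) + 2 * W * y * (V * V * (9 * C₁ * (N * N)) + 2 * (K * C₂) * (N * N) * (13 * (V * V)))
            ≡⟨ lem₃ (V * V) G C₄ (G ^ 9) W (N * N) y C₁ (K * C₂) ⟩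
          V * V * W * ((C₄ * (G * G ^ 9) + y * (18 * C₁ + 52 * (K * C₂))) * (N * N))
            ≡⟨ cong (λ c → V * V * W * ((C₄ * (G * G ^ 9) + y * c) * (N * N))) C₅≡ ⟨
          V * V * W * ((C₄ * G ^ 10 + y * C₅) * (N * N)) ∎)
        where
        open ≤-Reasoning
        X = 4 * (n ^ (h * 2) * (n * Θ)) * (C₂ * N)
        lem₁ : ∀ v W y G a → v * W * (y * G * a) ≡ y * G * (v * (W * a))
        lem₁ = NS.solve-∀
        lem₂ : ∀ y G v X W b σ K N k C → y * G * (v * X + 2 * W * (v * b + σ * σ * (2 * (K * N * k)) * (C * N))) ≡
               v * G * (y * X) + 2 * W * y * (v * (G * b) + 2 * (K * C) * (N * N) * (G * (σ * σ * k)))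
        lem₂ = NS.solve-∀
        lem₃ : ∀ v G C g W M y c d → v * G * (C * (g * (W * M))) + 2 * W * y * (v * (9 * c * M) + 2 * d * M * (13 * v)) ≡
               v * W * ((C * (G * g) + y * (18 * c + 52 * d)) * M)
        lem₃ = NS.solve-∀

  -- Counting transitive triples

  module Tournament {A : Set} (L : List A) (x τ : A → A → ℕ) (trichotomy : ∀ a b → x a b + x b a + τ a b ≡ 1) where
    n : ℕ
    n = length L

    out in′ tie imbalance : A → ℕ
    out a = ∑ L (λ b → x a b)
    in′ a = ∑ L (λ b → x b a)
    tie a = ∑ L (λ b → τ a b)
    imbalance a = abs (+ out a -ᶻ + in′ a)

    paths transitive : ℕ
    paths = ∑ L (λ a → ∑ L (λ b → ∑ L (λ c → x a b * x b c)))
    transitive = ∑ L (λ a → ∑ L (λ b → ∑ L (λ c → x a b * x b c * x a c)))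

    Σimbalance Σtie : ℕ
    Σimbalance = ∑ L imbalance
    Σtie = ∑ L tie

    private
      degree : ∀ a → out a + in′ a + tie a ≡ n
      degree a = trans (cong (_+ tie a) (sym (∑-+ L (x a) (λ b → x b a)))) (trans (sym (∑-+ L (λ b → x a b + x b a) (τ a)))
                   (trans (∑-cong L (trichotomy a)) (trans (∑-const L 1) (*-identityʳ n))))

      out≤n : ∀ a → out a ≤ n
      out≤n a = ≤-trans (≤-trans (m≤m+n (out a) (in′ a)) (m≤m+n _ (tie a))) (≤-reflexive (degree a))

      compare : ∀ o i → (o ≡ i + abs (+ o -ᶻ + i)) ⊎ (i ≡ o + abs (+ o -ᶻ + i))
      compare o i with ≤-total o i
      ... | inj₁ h = inj₂ (trans (sym (abs-pos-diff h)) (+-comm _ o))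
      ... | inj₂ h = inj₁ (trans (sym (abs-pos-diff h)) (trans (+-comm _ i) (cong (_+_ i) (abs-sym (+ i) (+ o)))))

      -- Summation around the middle element `b` of the path.
      paths≡ : paths ≡ ∑ L (λ b → out b * in′ b)
      paths≡ = trans (∑-swap L L (λ a b → ∑ L (λ c → x a b * x b c))) (∑-cong L (λ b →
        trans (∑-cong L (λ a → ∑-*ˡ L (x a b) (x b))) (trans (∑-*ʳ L (out b) (λ a → x a b)) (*-comm (in′ b) (out b)))))

      -- An ordered pair beaten by `a` is decided one way, the other way, or tied; the first two
      -- cases are transitive triples, equally many by exchanging `b` and `c`.
      out² : ∑ L (λ a → out a * out a) ≡ 2 * transitive + ∑ L (λ a → ∑ L (λ b → ∑ L (λ c → x a b * x a c * τ b c)))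
      out² = begin
        ∑ L (λ a → out a * out a)
          ≡⟨ ∑-cong L (λ a → trans (sym (∑-*ʳ L (out a) (x a))) (∑-cong L (λ b → sym (∑-*ˡ L (x a b) (x a))))) ⟩
        ∑³ (λ a b c → x a b * x a c)
          ≡⟨ ∑³-cong (λ a b c → trans (sym (*-identityʳ (x a b * x a c))) (trans (cong (x a b * x a c *_) (sym (trichotomy b c))) (lem (x a b) (x a c) (x b c) (x c b) (τ b c)))) ⟩
        ∑³ (λ a b c → x a b * x b c * x a c + (x a c * x c b * x a b + x a b * x a c * τ b c))
          ≡⟨ trans (∑³-+ _ _) (cong (_+_ transitive) (∑³-+ _ _)) ⟩
        transitive + (∑³ (λ a b c → x a c * x c b * x a b) + rest)
          ≡⟨ cong (λ t → transitive + (t + rest)) (∑-cong L (λ a → ∑-swap L L (λ b c → x a c * x c b * x a b))) ⟩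
        transitive + (transitive + rest) ≡⟨ lem₂ transitive rest ⟩
        2 * transitive + rest ∎
        where
        open ≡-Reasoning
        ∑³ : (A → A → A → ℕ) → ℕ
        ∑³ f = ∑ L (λ a → ∑ L (λ b → ∑ L (f a b)))
        rest = ∑³ (λ a b c → x a b * x a c * τ b c)
        ∑³-cong : ∀ {f g : A → A → A → ℕ} → (∀ a b c → f a b c ≡ g a b c) → ∑³ f ≡ ∑³ g
        ∑³-cong h = ∑-cong L (λ a → ∑-cong L (λ b → ∑-cong L (h a b)))
        ∑³-+ : ∀ (f g : A → A → A → ℕ) → ∑³ (λ a b c → f a b c + g a b c) ≡ ∑³ f + ∑³ g
        ∑³-+ f g = trans (∑-cong L (λ a → trans (∑-cong L (λ b → ∑-+ L (f a b) (g a b))) (∑-+ L (λ b → ∑ L (f a b)) (λ b → ∑ L (g a b)))))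
                         (∑-+ L (λ a → ∑ L (λ b → ∑ L (f a b))) (λ a → ∑ L (λ b → ∑ L (g a b))))
        lem : ∀ ab ac bc cb t → ab * ac * (bc + cb + t) ≡ ab * bc * ac + (ac * cb * ab + ab * ac * t)
        lem = NS.solve-∀
        lem₂ : ∀ t r → t + (t + r) ≡ 2 * t + r
        lem₂ = NS.solve-∀

      x≤1 : ∀ a b → x a b ≤ 1
      x≤1 a b = ≤-trans (≤-trans (m≤m+n (x a b) (x b a)) (m≤m+n _ (τ a b))) (≤-reflexive (trichotomy a b))

      ties≤ : ∑ L (λ a → ∑ L (λ b → ∑ L (λ c → x a b * x a c * τ b c))) ≤ n * Σtie
      ties≤ = ≤-trans (∑-mono L (λ a → ∑-mono L (λ b → ∑-mono L (λ c → ≤-trans (*-monoˡ-≤ (τ b c) (*-mono-≤ (x≤1 a b) (x≤1 a c))) (≤-reflexive (*-identityˡ (τ b c)))))))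
                      (≤-reflexive (∑-const L Σtie))

      out²≤ : ∀ a → out a * out a ≤ out a * in′ a + n * imbalance a
      out²≤ a with compare (out a) (in′ a)
      ... | inj₁ e = ≤-trans (≤-reflexive (trans (cong (out a *_) e) (*-distribˡ-+ (out a) (in′ a) (imbalance a)))) (+-monoʳ-≤ (out a * in′ a) (*-monoˡ-≤ (imbalance a) (out≤n a)))
      ... | inj₂ e = ≤-trans (*-monoʳ-≤ (out a) (≤-trans (m≤m+n (out a) (imbalance a)) (≤-reflexive (sym e)))) (m≤m+n _ _)

      ≤out² : ∀ a → out a * in′ a ≤ out a * out a + n * imbalance a
      ≤out² a with compare (out a) (in′ a)
      ... | inj₁ e = ≤-trans (*-monoʳ-≤ (out a) (≤-trans (m≤m+n (in′ a) (imbalance a)) (≤-reflexive (sym e)))) (m≤m+n _ _)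
      ... | inj₂ e = ≤-trans (≤-reflexive (trans (cong (out a *_) e) (*-distribˡ-+ (out a) (out a) (imbalance a)))) (+-monoʳ-≤ (out a * out a) (*-monoˡ-≤ (imbalance a) (out≤n a)))

      summed : ∀ (f : A → ℕ) → ∑ L (λ a → f a + n * imbalance a) ≡ ∑ L f + n * Σimbalance
      summed f = trans (∑-+ L f (λ a → n * imbalance a)) (cong (_+_ (∑ L f)) (∑-*ˡ L n imbalance))

    transitive-upper : 2 * transitive ≤ paths + n * Σimbalance
    transitive-upper = begin
      2 * transitive ≤⟨ m≤m+n _ _ ⟩
      2 * transitive + _ ≡⟨ out² ⟨
      ∑ L (λ a → out a * out a) ≤⟨ ∑-mono L out²≤ ⟩
      ∑ L (λ a → out a * in′ a + n * imbalance a) ≡⟨ summed (λ a → out a * in′ a) ⟩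
      ∑ L (λ a → out a * in′ a) + n * Σimbalance ≡⟨ cong (_+ n * Σimbalance) paths≡ ⟨
      paths + n * Σimbalance ∎
      where open ≤-Reasoning

    transitive-lower : paths ≤ 2 * transitive + n * (Σtie + Σimbalance)
    transitive-lower = begin
      paths ≡⟨ paths≡ ⟩
      ∑ L (λ a → out a * in′ a) ≤⟨ ∑-mono L ≤out² ⟩
      ∑ L (λ a → out a * out a + n * imbalance a) ≡⟨ summed (λ a → out a * out a) ⟩
      ∑ L (λ a → out a * out a) + n * Σimbalance ≡⟨ cong (_+ n * Σimbalance) out² ⟩
      2 * transitive + ∑ L (λ a → ∑ L (λ b → ∑ L (λ c → x a b * x a c * τ b c))) + n * Σimbalance ≤⟨ +-monoˡ-≤ (n * Σimbalance) (+-monoʳ-≤ (2 * transitive) ties≤) ⟩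
      2 * transitive + n * Σtie + n * Σimbalance ≡⟨ lem (2 * transitive) n Σtie Σimbalance ⟩
      2 * transitive + n * (Σtie + Σimbalance) ∎
      where
      open ≤-Reasoning
      lem : ∀ t n a b → t + n * a + n * b ≡ t + n * (a + b)
      lem = NS.solve-∀

    private
      -- From (o + i)² = 4oi + d² and d² ≤ md: a nearly regular tournament has out · in close to m²
      -- / 4.
      square : ∀ o i t d → (o ≡ i + d) ⊎ (i ≡ o + d) → let m = o + i + t in m * m ≤ 4 * (o * i) + m * d + 2 * (m * t)
      square .(i + d) i t d (inj₁ refl) = ≤-trans (m≤m+n _ (t * t + (2 * i + t) * d)) (≤-reflexive (lem i t d))
        where
        lem : ∀ i t d → let m = i + d + i + t in m * m + (t * t + (2 * i + t) * d) ≡ 4 * ((i + d) * i) + m * d + 2 * (m * t)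
        lem = NS.solve-∀
      square o .(o + d) t d (inj₂ refl) = ≤-trans (m≤m+n _ (t * t + (2 * o + t) * d)) (≤-reflexive (lem o t d))
        where
        lem : ∀ i t d → let m = i + (i + d) + t in m * m + (t * t + (2 * i + t) * d) ≡ 4 * (i * (i + d)) + m * d + 2 * (m * t)
        lem = NS.solve-∀

    many-paths : n * (n * n) ≤ 4 * paths + n * Σimbalance + 2 * (n * Σtie)
    many-paths = begin
      n * (n * n) ≡⟨ ∑-const L (n * n) ⟨
      ∑ L (λ _ → n * n) ≤⟨ ∑-mono L (λ a → subst (λ m → m * m ≤ 4 * (out a * in′ a) + m * imbalance a + 2 * (m * tie a)) (degree a) (square (out a) (in′ a) (tie a) (imbalance a) (compare (out a) (in′ a)))) ⟩
      ∑ L (λ a → 4 * (out a * in′ a) + n * imbalance a + 2 * (n * tie a))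
        ≡⟨ trans (∑-+ L (λ a → 4 * (out a * in′ a) + n * imbalance a) (λ a → 2 * (n * tie a)))
                 (cong₂ _+_ (trans (summed (λ a → 4 * (out a * in′ a))) (cong (_+ n * Σimbalance) (∑-*ˡ L 4 (λ a → out a * in′ a))))
                            (trans (∑-*ˡ L 2 (λ a → n * tie a)) (cong (2 *_) (∑-*ˡ L n tie)))) ⟩
      4 * ∑ L (λ a → out a * in′ a) + n * Σimbalance + 2 * (n * Σtie) ≡⟨ cong (λ z → 4 * z + n * Σimbalance + 2 * (n * Σtie)) paths≡ ⟨
      4 * paths + n * Σimbalance + 2 * (n * Σtie) ∎
      where open ≤-Reasoning

    -- Paths number Σ out · in and, up to ties, transitive triples number Σ out² / 2: the two are
    -- comparable because out ≈ in on average.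
    half-transitive : ∀ M → 6 ≤ M → 1 ≤ n → M * Σimbalance ≤ n * n → M * Σtie ≤ n * n →
      1 ≤ paths × M * abs (+ (2 * transitive) -ᶻ + paths) ≤ 16 * paths
    half-transitive M 6≤M 1≤n hI hT = 1≤paths , ≤-trans (*-monoʳ-≤ M close) (begin
        M * (n * (Σtie + Σimbalance)) ≡⟨ lem₁ M n Σtie Σimbalance ⟩
        n * (M * Σtie + M * Σimbalance) ≤⟨ *-monoʳ-≤ n (+-mono-≤ hT hI) ⟩
        n * (n * n + n * n) ≡⟨ lem₂ n (n * n) ⟩
        2 * (n * (n * n)) ≤⟨ *-monoʳ-≤ 2 cubic ⟩
        2 * (8 * paths) ≡⟨ *-assoc 2 8 paths ⟨
        16 * paths ∎)
      where
      open ≤-Reasoning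
      lem₁ : ∀ M n t i → M * (n * (t + i)) ≡ n * (M * t + M * i)
      lem₁ = NS.solve-∀
      lem₂ : ∀ n m → n * (m + m) ≡ 2 * (n * m)
      lem₂ = NS.solve-∀
      -- `M ≥ 6` is chosen so that imbalances and ties together, with weights 1 and 2, take at most
      -- half of n³; the rest bounds the number of paths from below and makes the condition
      -- nonempty.
      cubic : n * (n * n) ≤ 8 * paths
      cubic = *-cancelˡ-≤ 3 (+-cancelʳ-≤ (3 * (n * (n * n))) _ _ (begin
        3 * (n * (n * n)) + 3 * (n * (n * n)) ≡⟨ l₁ (n * (n * n)) ⟩
        6 * (n * (n * n)) ≤⟨ *-monoʳ-≤ 6 many-paths ⟩
        6 * (4 * paths + n * Σimbalance + 2 * (n * Σtie)) ≡⟨ l₂ paths n Σimbalance Σtie ⟩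
        24 * paths + n * (6 * Σimbalance) + 2 * (n * (6 * Σtie))
          ≤⟨ +-mono-≤ (+-monoʳ-≤ (24 * paths) (*-monoʳ-≤ n (≤-trans (*-monoˡ-≤ Σimbalance 6≤M) hI))) (*-monoʳ-≤ 2 (*-monoʳ-≤ n (≤-trans (*-monoˡ-≤ Σtie 6≤M) hT))) ⟩
        24 * paths + n * (n * n) + 2 * (n * (n * n)) ≡⟨ l₃ paths (n * (n * n)) ⟩
        3 * (8 * paths) + 3 * (n * (n * n)) ∎))
        where
        l₁ : ∀ c → 3 * c + 3 * c ≡ 6 * c
        l₁ = NS.solve-∀
        l₂ : ∀ p n i t → 6 * (4 * p + n * i + 2 * (n * t)) ≡ 24 * p + n * (6 * i) + 2 * (n * (6 * t))
        l₂ = NS.solve-∀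
        l₃ : ∀ p c → 24 * p + c + 2 * c ≡ 3 * (8 * p) + 3 * c
        l₃ = NS.solve-∀
      1≤paths : 1 ≤ paths
      1≤paths = factor-pos 8 paths (≤-trans (*-mono-≤ 1≤n (*-mono-≤ 1≤n 1≤n)) cubic)
      close : abs (+ (2 * transitive) -ᶻ + paths) ≤ n * (Σtie + Σimbalance)
      close with ≤-total (2 * transitive) paths
      ... | inj₁ h = +-cancelʳ-≤ (2 * transitive) _ _ (≤-trans (≤-reflexive (abs-pos-diff h)) (≤-trans transitive-lower (≤-reflexive (+-comm (2 * transitive) _))))
      ... | inj₂ h = +-cancelʳ-≤ paths _ _ (≤-trans (≤-reflexive (trans (cong (_+ paths) (abs-sym (+ (2 * transitive)) (+ paths))) (abs-pos-diff h)))
                       (≤-trans transitive-upper (≤-trans (+-monoʳ-≤ paths (*-monoʳ-≤ n (m≤n+m Σimbalance Σtie))) (≤-reflexive (+-comm paths _)))))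

  -- The conditional probability

  -- Since ε is at least 1 / q for its denominator q, an error of at most 16 / (18q) suffices; the 9
  -- against 16 leaves room for the strict inequality.
  ratio-close : ∀ v d (ε : ℚ) → 0ℚ ℚ.< ε → 9 * ℚ.↧ₙ ε * abs (+ (2 * v) -ᶻ + suc d) ≤ 16 * suc d →
                ℚ.∣ (+ v) ℚ./ suc d ℚ.- ½ ∣ ℚ.< ε
  ratio-close v d ε@(ℚ.mkℚ (+ suc a) q′ _) 0<ε h = ℚₚ.toℚᵘ-cancel-< (ℚᵘₚ.<-respˡ-≃ (ℚᵘₚ.≃-sym unnormalised) (ℚᵘ.*<* (subst₂ ℤ._<_ (ℤₚ.pos-* X q) (ℤₚ.pos-* (suc a) (suc d * 2)) (ℤ.+<+ main))))
    where
    q = suc q′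
    X = abs (+ v *ᶻ + 2 +ᶻ -[1+ 0 ] *ᶻ + suc d)
    unnormalised : ℚ.toℚᵘ (ℚ.∣ (+ v) ℚ./ suc d ℚ.- ½ ∣) ℚᵘ.≃ ℚᵘ.∣ ℚᵘ.mkℚᵘ (+ v) d ℚᵘ.+ ℚᵘ.- (ℚᵘ.mkℚᵘ (+ 1) 1) ∣
    unnormalised = ℚᵘₚ.≃-trans (ℚₚ.toℚᵘ-homo-∣-∣ ((+ v) ℚ./ suc d ℚ.- ½)) (ℚᵘₚ.∣-∣-cong (ℚᵘₚ.≃-trans (ℚₚ.toℚᵘ-homo-+ ((+ v) ℚ./ suc d) (ℚ.- ½))
        (ℚᵘₚ.+-cong (ℚₚ.toℚᵘ-fromℚᵘ (ℚᵘ.mkℚᵘ (+ v) d)) ℚᵘₚ.≃-refl)))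
    X≡ : X ≡ abs (+ (2 * v) -ᶻ + suc d)
    X≡ = cong abs (trans (lem (+ v) (+ suc d)) (cong (_-ᶻ + suc d) (sym (ℤₚ.pos-* 2 v))))
      where
      lem : ∀ v d → v *ᶻ + 2 +ᶻ -[1+ 0 ] *ᶻ d ≡ + 2 *ᶻ v -ᶻ d
      lem = ZS.solve-∀
    main : X * q < suc a * (suc d * 2)
    main = *-cancelˡ-< 9 (X * q) (suc a * (suc d * 2)) (begin-strict
      9 * (X * q) ≡⟨ trans (cong (λ x → 9 * (x * q)) X≡) (lem q (abs (+ (2 * v) -ᶻ + suc d))) ⟩
      9 * q * abs (+ (2 * v) -ᶻ + suc d) ≤⟨ h ⟩
      16 * suc d <⟨ *-monoˡ-< (suc d) {16} {18} (m≤m+n 17 1) ⟩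
      18 * suc d ≡⟨ lem₂ (suc d) ⟩
      9 * (suc d * 2) ≤⟨ *-monoʳ-≤ 9 (m≤m+n (suc d * 2) (a * (suc d * 2))) ⟩
      9 * (suc a * (suc d * 2)) ∎)
      where
      open ≤-Reasoning
      lem : ∀ q x → 9 * (x * q) ≡ 9 * q * x
      lem = NS.solve-∀
      lem₂ : ∀ d → 18 * d ≡ 9 * (d * 2)
      lem₂ = NS.solve-∀
  ratio-close v d (ℚ.mkℚ (+ zero) _ _) (ℚ.*<* (ℤ.+<+ ())) h
  ratio-close v d (ℚ.mkℚ -[1+ _ ] _ _) (ℚ.*<* ()) h

  trichotomy : ∀ m k → ind (k <? m) + ind (m <? k) + ind (m ≟ k) ≡ 1
  trichotomy m k with <-cmp m k
  ... | tri< m<k m≢k k≮m = cong₂ _+_ (cong₂ _+_ (ind-no (k <? m) k≮m) (ind-yes (m <? k) m<k)) (ind-no (m ≟ k) m≢k)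
  ... | tri≈ m≮k m≡k k≮m = cong₂ _+_ (cong₂ _+_ (ind-no (k <? m) k≮m) (ind-no (m <? k) m≮k)) (ind-yes (m ≟ k) m≡k)
  ... | tri> m≮k m≢k k<m = cong₂ _+_ (cong₂ _+_ (ind-yes (k <? m) k<m) (ind-no (m <? k) m≮k)) (ind-no (m ≟ k) m≢k)

  sgn-difference : ∀ m k → sgn (+ m -ᶻ + k) ≡ + ind (k <? m) -ᶻ + ind (m <? k)
  sgn-difference m k with <-cmp m k
  ... | tri< m<k _ k≮m = trans (trans (cong sgn (lem (+ m) (+ k))) (trans (sgn-odd (+ k -ᶻ + m)) (cong -ᶻ_ (sgn-pos (+ k -ᶻ + m) (≤ᶻ-from 0 (ℤ.+≤+ m<k) (lem₂ (+ m) (+ k)))))))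
                               (sym (cong₂ (λ x y → + x -ᶻ + y) (ind-no (k <? m) k≮m) (ind-yes (m <? k) m<k)))
    where
    lem : ∀ m k → m -ᶻ k ≡ -ᶻ (k -ᶻ m)
    lem = ZS.solve-∀
    lem₂ : ∀ m k → (k -ᶻ m) -ᶻ + 1 ≡ (k -ᶻ (+ 1 +ᶻ m)) +ᶻ + 0
    lem₂ = ZS.solve-∀
  ... | tri≈ m≮k refl k≮m = trans (cong sgn (ℤₚ.+-inverseʳ (+ m))) (sym (cong₂ (λ x y → + x -ᶻ + y) (ind-no (m <? m) k≮m) (ind-no (m <? m) m≮k)))
  ... | tri> m≮k _ k<m = trans (sgn-pos (+ m -ᶻ + k) (≤ᶻ-from 0 (ℤ.+≤+ k<m) (lem (+ m) (+ k)))) (sym (cong₂ (λ x y → + x -ᶻ + y) (ind-yes (k <? m) k<m) (ind-no (m <? k) m≮k)))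
    where
    lem : ∀ m k → (m -ᶻ k) -ᶻ + 1 ≡ (m -ᶻ (+ 1 +ᶻ k)) +ᶻ + 0
    lem = ZS.solve-∀

  ind-× : {P Q : Set} (d : Dec P) (e : Dec Q) → ind (d ×-dec e) ≡ ind d * ind e
  ind-× (yes _) (yes _) = refl
  ind-× (yes _) (no _)  = refl
  ind-× (no _)  e       = refl

  ∑-triples : ∀ n (f : Die n × Die n × Die n → ℕ) →
    ∑ (triples n) f ≡ ∑ (dice n) (λ a → ∑ (dice n) (λ b → ∑ (dice n) (λ c → f (a , b , c))))
  ∑-triples n f = trans (∑-concatMap _ (dice n) f) (∑-cong (dice n) (λ a → trans (∑-concatMap _ (dice n) f)
    (∑-cong (dice n) (λ b → ∑-map (λ c → (a , b , c)) (dice n) f))))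

  module Counts (n : ℕ) where
    beats ties : Die n → Die n → ℕ
    beats a b = ind (beats? a b)
    ties a b = ind (#gt a b ≟ #gt b a)

    open Tournament (dice n) beats ties (λ a b → trichotomy (#gt a b) (#gt b a)) public hiding (n)

    #cond≡ : #cond n ≡ paths
    #cond≡ = trans (length-filter _ (triples n)) (trans (∑-triples n _)
      (∑-cong (dice n) (λ a → ∑-cong (dice n) (λ b → ∑-cong (dice n) (λ c → ind-× (beats? a b) (beats? b c))))))

    #condAC≡ : #condAC n ≡ transitive
    #condAC≡ = trans (length-filter _ (triples n)) (trans (∑-triples n _)
      (∑-cong (dice n) (λ a → ∑-cong (dice n) (λ b → ∑-cong (dice n) (λ c →
        trans (ind-× (beats? a b ×-dec beats? b c) (beats? a c)) (cong (_* beats a c) (ind-× (beats? a b) (beats? b c))))))))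

    condProb-close : ∀ (ε : ℚ) → 0ℚ ℚ.< ε → 1 ≤ length (dice n) →
      9 * ℚ.↧ₙ ε * Σimbalance ≤ length (dice n) * length (dice n) → 9 * ℚ.↧ₙ ε * Σtie ≤ length (dice n) * length (dice n) →
      ℚ.∣ condProb n ℚ.- ½ ∣ ℚ.< ε
    condProb-close ε 0<ε 1≤N hI hT = final (#cond n) (#condAC n) (subst (1 ≤_) (sym #cond≡) (proj₁ half))
        (subst₂ (λ t c → 9 * ℚ.↧ₙ ε * abs (+ (2 * t) -ᶻ + c) ≤ 16 * c) (sym #condAC≡) (sym #cond≡) (proj₂ half))
      where
      half : 1 ≤ paths × 9 * ℚ.↧ₙ ε * abs (+ (2 * transitive) -ᶻ + paths) ≤ 16 * paths
      half = half-transitive (9 * ℚ.↧ₙ ε) (≤-trans (m≤m+n 6 3) (m≤m*n 9 (ℚ.↧ₙ ε))) 1≤N hI hT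
      final : ∀ c t → 1 ≤ c → 9 * ℚ.↧ₙ ε * abs (+ (2 * t) -ᶻ + c) ≤ 16 * c → ℚ.∣ ratio t c ℚ.- ½ ∣ ℚ.< ε
      final (suc d) t _ h = ratio-close t d ε 0<ε h

  -- Choice of the scales and of the threshold

  floor-root : ∀ κ → 1 ≤ κ → ∀ n → ∃[ y ] κ * (y * y) ≤ n × n < κ * (suc y * suc y)
  floor-root κ 1≤κ zero = 0 , ≤-reflexive (*-zeroʳ κ) , ≤-trans 1≤κ (≤-reflexive (sym (*-identityʳ κ)))
  floor-root κ 1≤κ (suc n) with floor-root κ 1≤κ n
  ... | y , lo , hi with suc n <? κ * (suc y * suc y)
  ... | yes lt = y , m≤n⇒m≤1+n lo , lt
  ... | no  ge = suc y , ≮⇒≥ ge , ≤-<-trans hi (*-monoʳ-< κ {{>-nonZero 1≤κ}} (*-mono-< (n<1+n (suc y)) (n<1+n (suc y))))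

  module Asymptotics (G y : ℕ) (2≤G : 2 ≤ G) (1≤y : 1 ≤ y) (p : ℕ)
                     (σ²≤n : G * (G * G * y) * (G * (G * G * y)) ≤ suc p) (n≤4σ² : suc p ≤ 4 * (G * (G * G * y) * (G * (G * G * y)))) where
    n = suc p

    private
      8y≤σ : 8 * y ≤ G * (G * G * y)
      8y≤σ = ≤-trans (*-monoˡ-≤ y (*-mono-≤ 2≤G (*-mono-≤ 2≤G 2≤G))) (≤-reflexive (lem G y))
        where
        lem : ∀ G y → G * (G * G) * y ≡ G * (G * G * y)
        lem = NS.solve-∀

      64y²≤n : 64 * (y * y) ≤ n
      64y²≤n = ≤-trans (≤-trans (≤-reflexive (lem y)) (*-mono-≤ 8y≤σ 8y≤σ)) σ²≤n
        where
        lem : ∀ y → 64 * (y * y) ≡ 8 * y * (8 * y)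
        lem = NS.solve-∀

      1≤y² : 1 ≤ y * y
      1≤y² = *-mono-≤ 1≤y 1≤y

      64≤n : 64 ≤ n
      64≤n = ≤-trans (*-monoʳ-≤ 64 1≤y²) 64y²≤n

    scale : Scale p
    scale = record
      { e = n / 8
      ; σ = G * (G * G * y)
      ; 8e≤n = ≤-trans (≤-reflexive (*-comm 8 (n / 8))) (m/n*n≤m n 8)
      ; n≤16e = upper
      ; σ²≤n = σ²≤n
      ; n≤4σ² = n≤4σ²
      ; 16≤n = ≤-trans (m≤m+n 16 48) 64≤n
      ; d₀ = origin p
      ; d₀≡ = origin-center p
      }
      where
      open ≤-Reasoning
      n≤8e+8 : n ≤ 8 * (n / 8) + 8
      n≤8e+8 = begin
        n                 ≡⟨ m≡m%n+[m/n]*n n 8 ⟩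
        n % 8 + n / 8 * 8 ≤⟨ +-monoˡ-≤ (n / 8 * 8) (<⇒≤ (m%n<n n 8)) ⟩
        8 + n / 8 * 8     ≡⟨ trans (+-comm 8 _) (cong (_+ 8) (*-comm (n / 8) 8)) ⟩
        8 * (n / 8) + 8 ∎
      pos : ∀ e → 64 ≤ 8 * e + 8 → 1 ≤ e
      pos zero    h = ⊥-elim (<⇒≱ (m≤m+n 9 55) h)
      pos (suc e) _ = s≤s z≤n
      upper : n ≤ 16 * (n / 8)
      upper = ≤-trans n≤8e+8 (≤-trans (+-monoʳ-≤ (8 * (n / 8)) (*-monoʳ-≤ 8 (pos (n / 8) (≤-trans 64≤n n≤8e+8)))) (≤-reflexive (lem (n / 8))))
        where
        lem : ∀ e → 8 * e + 8 * e ≡ 16 * e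
        lem = NS.solve-∀

    open Density scale using (N; many-dice; 1≤σ)
    open Dice scale refl using (length-dice)
    open Mean scale refl G y 2≤G 1≤y refl using (advantage; z; 1≤z; module Blocks)
    open Spread scale refl G z 1≤z refl using (V; near; near-total)
    open Counts n using (imbalance; Σimbalance; Σtie; beats; ties; out; in′)

    private
      imbalance≡ : ∀ a → imbalance a ≡ abs (advantage a)
      imbalance≡ a = cong abs (sym (trans (Z.∑-cong (dice n) (λ b → sgn-difference (#gt a b) (#gt b a)))
        (trans (∑ᶻ-minus (dice n) (λ b → + beats a b) (λ b → + beats b a))
               (sym (cong₂ _-ᶻ_ (+-∑ (dice n) (beats a)) (+-∑ (dice n) (λ b → beats b a)))))))

      tie≤near : Σtie ≤ ∑ (dice n) near
      tie≤near = ∑-mono (dice n) (λ a → ∑-mono (dice n) (λ b → ind-mono (#gt a b ≟ #gt b a) (abs (margin a b) ≤? 4 * V)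
        (λ eq → subst (λ x → abs x ≤ 4 * V) (sym (trans (cong (λ k → + k -ᶻ + #gt b a) eq) (ℤₚ.+-inverseʳ (+ #gt b a)))) z≤n)))

      -- The four blocks take `8 * (y * y) + 4` coordinates; the others are paired off, and a
      -- possible odd one becomes `e₀`.
      tail-blocks : ∃[ h ] ∃[ e₀ ] e₀ ≤ 1 × h * 2 + (suc (y * y * 2 + 0) + (suc (y * y * 2 + 0) + (suc (y * y * 2 + 0) + suc (y * y * 2 + e₀)))) ≡ n
      tail-blocks with halve (n ∸ (8 * (y * y) + 4))
      ... | h , e₀ , eq , e₀≤1 = h , e₀ , e₀≤1 , trans (lem h (y * y) e₀) (trans (cong (_+ (8 * (y * y) + 4)) (sym eq)) (m∸n+n≡m fits))
        where
        fits : 8 * (y * y) + 4 ≤ n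
        fits = ≤-trans (+-monoʳ-≤ (8 * (y * y)) (*-monoʳ-≤ 4 1≤y²)) (≤-trans (≤-trans (m≤m+n _ (52 * (y * y))) (≤-reflexive (lem₂ (y * y)))) 64y²≤n)
          where
          lem₂ : ∀ x → 8 * x + 4 * x + 52 * x ≡ 64 * x
          lem₂ = NS.solve-∀
        lem : ∀ h x e → h * 2 + (suc (x * 2 + 0) + (suc (x * 2 + 0) + (suc (x * 2 + 0) + suc (x * 2 + e)))) ≡ h * 2 + e + (8 * x + 4)
        lem = NS.solve-∀

    1≤dice : 1 ≤ length (dice n)
    1≤dice = subst (1 ≤_) (sym length-dice) (factor-pos (12 * (n * (G * (G * G * y)))) N (≤-trans (m^n>0 n n) many-dice))

    imbalance-total : y * G * Σimbalance ≤ (C₄ * G ^ 10 + y * C₅) * (length (dice n) * length (dice n))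
    imbalance-total = subst₂ (λ s l → y * G * s ≤ (C₄ * G ^ 10 + y * C₅) * (l * l)) (sym (∑-cong (dice n) imbalance≡)) (sym length-dice)
        (Blocks.advantage-total (proj₁ tail-blocks) (proj₁ (proj₂ tail-blocks)) (proj₁ (proj₂ (proj₂ tail-blocks))) (proj₂ (proj₂ (proj₂ tail-blocks))))

    tie-total : G * Σtie ≤ 9 * C₁ * (length (dice n) * length (dice n))
    tie-total = subst (λ l → G * Σtie ≤ 9 * C₁ * (l * l)) (sym length-dice) (≤-trans (*-monoʳ-≤ G tie≤near) near-total)

  -- `G` is fixed first, to bring the errors of order 1 / G below 1 / (2M). Only then `Y`, which
  -- depends on G⁹, brings the Lindeberg error below the other 1 / (2M). `κ = G⁶` makes σ² = κ y².
  module Threshold (M G Y : ℕ) (G-large : 2 * M * C₅ + 2 ≤ G) (Y-large : 2 * M * (C₄ * G ^ 9) + 1 ≤ Y) where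
    κ N₀ : ℕ
    κ = G * (G * G) * (G * (G * G))
    N₀ = κ * (Y * Y)

    2≤G : 2 ≤ G
    2≤G = ≤-trans (m≤n+m 2 (2 * M * C₅)) G-large

    private
      1≤κ : 1 ≤ κ
      1≤κ = *-mono-≤ {1} {G * (G * G)} {1} (*-mono-≤ 1≤G (*-mono-≤ 1≤G 1≤G)) (*-mono-≤ 1≤G (*-mono-≤ 1≤G 1≤G))
        where
        1≤G : 1 ≤ G
        1≤G = ≤-trans (s≤s z≤n) 2≤G

      18C₁≤C₅ : 18 * C₁ ≤ C₅
      18C₁≤C₅ = ≤-trans (m≤m+n _ (52 * (K * C₂))) (≤-reflexive (sym C₅≡))

    module At (p : ℕ) (large : N₀ ≤ suc p) where
      n = suc p
      private
        root = floor-root κ 1≤κ n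
        y = proj₁ root
        lo = proj₁ (proj₂ root)
        hi = proj₂ (proj₂ root)

        Y≤y : Y ≤ y
        Y≤y with Y ≤? y
        ... | yes h = h
        ... | no  h = ⊥-elim (<⇒≱ hi (≤-trans (*-monoʳ-≤ κ (*-mono-≤ (≰⇒> h) (≰⇒> h))) large))

        1≤y : 1 ≤ y
        1≤y = ≤-trans (≤-trans (m≤n+m 1 (2 * M * (C₄ * G ^ 9))) Y-large) Y≤y

        σ²≡ : ∀ G y → G * (G * G) * (G * (G * G)) * (y * y) ≡ G * (G * G * y) * (G * (G * G * y))
        σ²≡ = NS.solve-∀

        -- As `y ≥ 1`, the next square κ(y + 1)² is at most 4κy², which explains the factor 4 in
        -- `n≤4σ²`.
        upper : n ≤ 4 * (G * (G * G * y) * (G * (G * G * y)))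
        upper = ≤-trans (<⇒≤ hi) (≤-trans (*-monoʳ-≤ κ (*-mono-≤ (+-monoˡ-≤ y 1≤y) (+-monoˡ-≤ y 1≤y))) (≤-reflexive (trans (lem κ y) (cong (4 *_) (σ²≡ G y)))))
          where
          lem : ∀ κ y → κ * ((y + y) * (y + y)) ≡ 4 * (κ * (y * y))
          lem = NS.solve-∀

      open Asymptotics G y 2≤G 1≤y p (≤-trans (≤-reflexive (sym (σ²≡ G y))) lo) upper public hiding (n)
      open Counts n using (Σimbalance; Σtie) public

      private
        Q = length (dice n) * length (dice n)

      few-ties : M * Σtie ≤ Q
      few-ties = *-cancelˡ-≤ G {{>-nonZero (≤-trans (s≤s z≤n) 2≤G)}} (begin
        G * (M * Σtie)       ≡⟨ lem₁ G M Σtie ⟩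
        M * (G * Σtie)       ≤⟨ *-monoʳ-≤ M tie-total ⟩
        M * (9 * C₁ * Q)     ≤⟨ m≤m+n _ (M * (27 * C₁ * Q)) ⟩
        M * (9 * C₁ * Q) + M * (27 * C₁ * Q) ≡⟨ lem₂ M C₁ Q ⟩
        2 * M * (18 * C₁) * Q ≤⟨ *-monoˡ-≤ Q (≤-trans (≤-trans (*-monoʳ-≤ (2 * M) 18C₁≤C₅) (m≤m+n _ 2)) G-large) ⟩
        G * Q ∎)
        where
        open ≤-Reasoning
        lem₁ : ∀ G M t → G * (M * t) ≡ M * (G * t)
        lem₁ = NS.solve-∀
        lem₂ : ∀ M c q → M * (9 * c * q) + M * (27 * c * q) ≡ 2 * M * (18 * c) * q
        lem₂ = NS.solve-∀

      small-imbalance : M * Σimbalance ≤ Q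
      small-imbalance = *-cancelˡ-≤ (2 * (y * G)) {{>-nonZero (*-mono-≤ {1} {2} {1} {y * G} (s≤s z≤n) (*-mono-≤ 1≤y (≤-trans (s≤s z≤n) 2≤G)))}} (begin
        2 * (y * G) * (M * Σimbalance)   ≡⟨ lem₁ y G M Σimbalance ⟩
        2 * M * (y * G * Σimbalance)     ≤⟨ *-monoʳ-≤ (2 * M) imbalance-total ⟩
        2 * M * ((C₄ * (G * G ^ 9) + y * C₅) * Q) ≡⟨ lem₂ M C₄ G (G ^ 9) y C₅ Q ⟩
        (G * (2 * M * (C₄ * G ^ 9)) + y * (2 * M * C₅)) * Q
          ≤⟨ *-monoˡ-≤ Q (+-mono-≤ (*-monoʳ-≤ G (≤-trans (≤-trans (m≤m+n _ 1) Y-large) Y≤y)) (*-monoʳ-≤ y (≤-trans (m≤m+n (2 * M * C₅) 2) G-large))) ⟩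
        (G * y + y * G) * Q ≡⟨ cong (_* Q) (lem₃ G y) ⟩
        2 * (y * G) * Q ∎)
        where
        open ≤-Reasoning
        lem₁ : ∀ y G M s → 2 * (y * G) * (M * s) ≡ 2 * M * (y * G * s)
        lem₁ = NS.solve-∀
        lem₂ : ∀ M C G g y D Q → 2 * M * ((C * (G * g) + y * D) * Q) ≡ (G * (2 * M * (C * g)) + y * (2 * M * D)) * Q
        lem₂ = NS.solve-∀
        lem₃ : ∀ G y → G * y + y * G ≡ 2 * (y * G)
        lem₃ = NS.solve-∀

  abstract
    eventually-regular : ∀ M → ∃[ N₀ ] (∀ p → N₀ ≤ suc p → let n = suc p ; Q = length (dice n) * length (dice n) in
      1 ≤ length (dice n) × M * Counts.Σimbalance n ≤ Q × M * Counts.Σtie n ≤ Q)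
    eventually-regular M = N₀ , λ p large → At.1≤dice p large , At.small-imbalance p large , At.few-ties p large
      where open Threshold M (2 * M * C₅ + 2) (2 * M * (C₄ * (2 * M * C₅ + 2) ^ 9) + 1) ≤-refl ≤-refl

  condProb→½ : (ε : ℚ) → 0ℚ ℚ.< ε → ∃[ N ] ((n : ℕ) → 1 ≤ n → N ≤ n → ℚ.∣ condProb n ℚ.- ½ ∣ ℚ.< ε)
  condProb→½ ε 0<ε = proj₁ threshold , close
    where
    threshold = eventually-regular (9 * ℚ.↧ₙ ε)
    close : (n : ℕ) → 1 ≤ n → proj₁ threshold ≤ n → ℚ.∣ condProb n ℚ.- ½ ∣ ℚ.< ε
    close (suc p) _ large = Counts.condProb-close (suc p) ε 0<ε (proj₁ regular) (proj₁ (proj₂ regular)) (proj₂ (proj₂ regular))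
      where regular = proj₂ threshold p large

open import Defs
open import Data.Nat using (ℕ; _≤_)
open import Data.Product using (∃-syntax)
open import Data.Rational using (ℚ; 0ℚ; ½; _-_; ∣_∣; _<_)

theorem1p5 : (ε : ℚ) → 0ℚ < ε →
    ∃[ N ] ((n : ℕ) → 1 ≤ n → N ≤ n → ∣ condProb n - ½ ∣ < ε)
theorem1p5 = ConditionalProbability.condProb→½
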